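{- Let $q\ge5$ be odd. The Un$\Gamma$-lines form two $G_q$-orbits of size $\frac12(q^3-q)$, and they can be labelled $\mathcal O_1,\mathcal O_2$ so that, writing $\Pi_{\pi,j}$ for the number of $\pi$-planes through any line of $\mathcal O_j$ and $\Lambda_{j,\pi}$ for the number of lines of $\mathcal O_j$ in a $\pi$-plane: $\Pi_{\pi,j}=\Lambda_{j,\pi}=0$ for $\pi\in\{\Gamma,0_{\mathcal C}\}$, $j=1,2$; $\Pi_{2_{\mathcal C},1}=1$; $\Pi_{2_{\mathcal C},2}=3$; $\Lambda_{1,2_{\mathcal C}}=\Pi_{3_{\mathcal C},1}=\Pi_{\overline{1_{\mathcal C}},2}=\Lambda_{2,\overline{1_{\mathcal C}}}=\frac12(q-1)$; $\Pi_{3_{\mathcal C},2}=\frac12(q-3)$; $\Lambda_{2,3_{\mathcal C}}=\frac32(q-3)$; $\Lambda_{2,2_{\mathcal C}}=\Lambda_{1,3_{\mathcal C}}=\frac32(q-1)$; $\Pi_{\overline{1_{\mathcal C}},1}=\Lambda_{1,\overline{1_{\mathcal C}}}=\frac12(q+1)$.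
   Context: Let $\mathrm{PG}(3,q)$ have points $\mathbf{P}(x_0,x_1,x_2,x_3)$; put $P(t)=\mathbf{P}(t^3,t^2,t,1)$ ($t\in\mathbb{F}_q$), $P(\infty)=\mathbf{P}(1,0,0,0)$, $\mathcal{C}=\{P(t):t\in\mathbb{F}_q\cup\{\infty\}\}$ the twisted cubic, $G_q$ the group of projectivities fixing $\mathcal C$. Write $\boldsymbol{\pi}(c_0,c_1,c_2,c_3)$ for the plane $c_0x_0+c_1x_1+c_2x_2+c_3x_3=0$. $\Gamma$-planes: osculating planes $\boldsymbol{\pi}(1,-3t,3t^2,-t^3)$ ($t\in\mathbb{F}_q$) and $\boldsymbol{\pi}(0,0,0,1)$. A $d_{\mathcal C}$-plane ($d\in\{0,2,3\}$) contains exactly $d$ points of $\mathcal C$; a $\overline{1_{\mathcal C}}$-plane is a non-$\Gamma$-plane with exactly one point of $\mathcal C$ (each plane type is a $G_q$-orbit for $q\ge5$). A Un$\Gamma$-line is a line meeting $\mathcal C$ in exactly one point and lying in no $\Gamma$-plane. Known fact: for odd $q\ge5$ the Un$\Gamma$-lines form exactly two $G_q$-orbits, each of size $\frac12(q^3-q)$, namely the orbits of the lines through $\mathbf{P}(0,0,0,1)$ and $\mathbf{P}(1,0,1,0)$, resp. through $\mathbf{P}(0,0,0,1)$ and $\mathbf{P}(1,0,\rho,0)$ with $\rho$ a non-square in $\mathbb{F}_q$. -}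

module Defs where

open import Data.Nat as ℕ using (ℕ; zero; suc)
open import Data.Fin using (Fin; zero; suc; toℕ)
open import Data.Bool using (Bool; true; false; _∧_; _∨_; not; if_then_else_; T)
open import Data.Maybe using (Maybe; just; nothing)
open import Data.Product using (Σ; ∃; _×_; _,_)
open import Relation.Binary.PropositionalEquality using (_≡_; _≢_)
open import Relation.Nullary using (does)
open import Relation.Binary.Definitions using (DecidableEquality)
open import Algebra.Core using (Op₁; Op₂)
import Algebra.Structures as AS
open import Function.Bundles using (_↔_; Inverse)

record FiniteField (q : ℕ) : Set₁ where
  field
    Carrier : Set
    _+_ _*_ : Op₂ Carrier
    -_ : Op₁ Carrier
    0# 1# : Carrier
    isCommutativeRing : AS.IsCommutativeRing {A = Carrier} _≡_ _+_ _*_ -_ 0# 1#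
    0≢1 : 0# ≢ 1#
    inverse : ∀ x → x ≢ 0# → ∃ λ y → x * y ≡ 1#
    _≟_ : DecidableEquality Carrier
    enum : Fin q ↔ Carrier

sumFin : ∀ {n} → (Fin n → ℕ) → ℕ
sumFin {zero}  f = 0
sumFin {suc n} f = f zero ℕ.+ sumFin (λ i → f (suc i))

anyFin : ∀ {n} → (Fin n → Bool) → Bool
anyFin {zero}  f = false
anyFin {suc n} f = f zero ∨ anyFin (λ i → f (suc i))

allFin : ∀ {n} → (Fin n → Bool) → Bool
allFin {zero}  f = true
allFin {suc n} f = f zero ∧ allFin (λ i → f (suc i))

ind : Bool → ℕ
ind true  = 1
ind false = 0

data PlaneType : Set where
  Γ-plane 0C-plane 2C-plane 3C-plane 1̄C-plane : PlaneType

module Geometry {q : ℕ} (𝔽 : FiniteField q) where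
  open FiniteField 𝔽

  elt : Fin q → Carrier
  elt = Inverse.to enum

  countF : (Carrier → ℕ) → ℕ
  countF f = sumFin (λ i → f (elt i))

  anyF : (Carrier → Bool) → Bool
  anyF f = anyFin (λ i → f (elt i))

  _≡ᶠ_ : Carrier → Carrier → Bool
  x ≡ᶠ y = does (x ≟ y)

  V : Set
  V = Fin 4 → Carrier

  vec : Carrier → Carrier → Carrier → Carrier → V
  vec a b c d zero = a
  vec a b c d (suc zero) = b
  vec a b c d (suc (suc zero)) = c
  vec a b c d (suc (suc (suc zero))) = d

  zeroV : V
  zeroV _ = 0#

  _≡ᵛ_ : V → V → Bool
  u ≡ᵛ v = allFin (λ i → u i ≡ᶠ v i)

  _⊛_ : Carrier → V → V
  (k ⊛ v) i = k * v i

  _⊕_ : V → V → V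
  (u ⊕ v) i = u i + v i

  sum4 : (Fin 4 → Carrier) → Carrier
  sum4 f = f zero + (f (suc zero) + (f (suc (suc zero)) + f (suc (suc (suc zero)))))

  _·_ : V → V → Carrier
  c · x = sum4 (λ i → c i * x i)

  countV : (V → ℕ) → ℕ
  countV f = countF λ a → countF λ b → countF λ c → countF λ d → f (vec a b c d)

  countV² : (V → V → ℕ) → ℕ
  countV² f = countV λ u → countV λ v → f u v

  projEq : V → V → Bool
  projEq x y = anyF λ k → not (k ≡ᶠ 0#) ∧ (x ≡ᵛ (k ⊛ y))

  -- canonical representative of a point/plane of PG(3,q):
  -- first nonzero coordinate equals 1 (hence the vector is nonzero)
  normalized : V → Bool
  normalized v =
    if not (v zero ≡ᶠ 0#) then v zero ≡ᶠ 1#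
    else if not (v (suc zero) ≡ᶠ 0#) then v (suc zero) ≡ᶠ 1#
    else if not (v (suc (suc zero)) ≡ᶠ 0#) then v (suc (suc zero)) ≡ᶠ 1#
    else v (suc (suc (suc zero))) ≡ᶠ 1#

  -- the twisted cubic: P(t) = (t³,t²,t,1), P(∞) = (1,0,0,0); nothing = ∞
  cubicPt : Maybe Carrier → V
  cubicPt (just t) = vec (t * (t * t)) (t * t) t 1#
  cubicPt nothing  = vec 1# 0# 0# 0#

  anyPt : (Maybe Carrier → Bool) → Bool
  anyPt f = f nothing ∨ anyF (λ t → f (just t))

  countPt : (Maybe Carrier → ℕ) → ℕ
  countPt f = f nothing ℕ.+ countF (λ t → f (just t))

  onPlane : V → V → Bool
  onPlane c x = (c · x) ≡ᶠ 0#

  pointsOfC : V → ℕ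
  pointsOfC c = countPt λ s → ind (onPlane c (cubicPt s))

  three : Carrier
  three = 1# + (1# + 1#)

  -- osculating plane π(1, -3t, 3t², -t³)
  osc : Carrier → V
  osc t = vec 1# (- (three * t)) (three * (t * t)) (- (t * (t * t)))

  isΓ : V → Bool
  isΓ c = anyF (λ t → projEq c (osc t)) ∨ projEq c (vec 0# 0# 0# 1#)

  hasType : PlaneType → V → Bool
  hasType Γ-plane  c = isΓ c
  hasType 0C-plane c = pointsOfC c ℕ.≡ᵇ 0
  hasType 2C-plane c = pointsOfC c ℕ.≡ᵇ 2
  hasType 3C-plane c = pointsOfC c ℕ.≡ᵇ 3
  hasType 1̄C-plane c = (pointsOfC c ℕ.≡ᵇ 1) ∧ not (isΓ c)

  -- lines of PG(3,q), given by two spanning vectors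
  inSpan : V → V → V → Bool
  inSpan a b w = anyF λ l → anyF λ m → w ≡ᵛ ((l ⊛ a) ⊕ (m ⊛ b))

  indep : V → V → Bool
  indep a b = not (anyF λ l → anyF λ m →
                   not ((l ≡ᶠ 0#) ∧ (m ≡ᶠ 0#)) ∧ (((l ⊛ a) ⊕ (m ⊛ b)) ≡ᵛ zeroV))

  sameLine : V → V → V → V → Bool
  sameLine a b u v = indep a b ∧ indep u v ∧ inSpan a b u ∧ inSpan a b v
                     ∧ inSpan u v a ∧ inSpan u v b

  lineInPlane : V → V → V → Bool
  lineInPlane c u v = onPlane c u ∧ onPlane c v

  UnΓ : V → V → Bool
  UnΓ u v = indep u v
          ∧ (countPt (λ s → ind (inSpan u v (cubicPt s))) ℕ.≡ᵇ 1)
          ∧ not (anyF (λ t → lineInPlane (osc t) u v))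
          ∧ not (lineInPlane (vec 0# 0# 0# 1#) u v)

  -- canonical representative of a line: reduced row echelon form (u,v)
  -- with pivots i < j
  rrefAt : Fin 4 → Fin 4 → V → V → Bool
  rrefAt i j u v = (toℕ i ℕ.<ᵇ toℕ j) ∧ (u i ≡ᶠ 1#) ∧ (v i ≡ᶠ 0#) ∧ (v j ≡ᶠ 1#)
                   ∧ (u j ≡ᶠ 0#)
                   ∧ allFin (λ k → (not (toℕ k ℕ.<ᵇ toℕ i) ∨ (u k ≡ᶠ 0#))
                                 ∧ (not (toℕ k ℕ.<ᵇ toℕ j) ∨ (v k ≡ᶠ 0#)))

  rref : V → V → Bool
  rref u v = anyFin λ i → anyFin λ j → rrefAt i j u v

  Mat : Set
  Mat = Fin 4 → Fin 4 → Carrier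

  apply : Mat → V → V
  apply M x i = sum4 (λ j → M i j * x j)

  _∙_ : Mat → Mat → Mat
  (M ∙ N) i j = sum4 (λ k → M i k * N k j)

  idMat : Mat
  idMat i j = if does (i Data.Fin.≟ j) then 1# else 0#

  Invertible : Mat → Set
  Invertible M = Σ Mat λ N → (∀ i j → (M ∙ N) i j ≡ idMat i j)
                           × (∀ i j → (N ∙ M) i j ≡ idMat i j)

  FixesC : Mat → Set
  FixesC M = (∀ s → ∃ λ t → T (projEq (apply M (cubicPt s)) (cubicPt t)))
           × (∀ t → ∃ λ s → T (projEq (apply M (cubicPt s)) (cubicPt t)))

  InG : Mat → Set
  InG M = Invertible M × FixesC M

  -- a (decidable) set of lines, given on spanning pairs
  LineSet : Set
  LineSet = V → V → Bool

  IsOrbit : LineSet → Set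
  IsOrbit O = Σ V λ u₀ → Σ V λ v₀ → T (indep u₀ v₀) ×
    (∀ u v → (T (O u v) → ∃ λ M → InG M × T (sameLine (apply M u₀) (apply M v₀) u v))
           × ((∃ λ M → InG M × T (sameLine (apply M u₀) (apply M v₀) u v)) → T (O u v)))

  size : LineSet → ℕ
  size O = countV² λ u v → ind (rref u v ∧ O u v)

  planesThrough : PlaneType → V → V → ℕ
  planesThrough π u v = countV λ c → ind (normalized c ∧ lineInPlane c u v ∧ hasType π c)

  linesIn : LineSet → V → ℕ
  linesIn O c = countV² λ u v → ind (rref u v ∧ O u v ∧ lineInPlane c u v)

  PiIs : PlaneType → LineSet → (ℕ → Set) → Set
  PiIs π O P = ∀ u v → T (O u v) → P (planesThrough π u v)

  LamIs : LineSet → PlaneType → (ℕ → Set) → Set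
  LamIs O π P = ∀ c → T (normalized c) → T (hasType π c) → P (linesIn O c)

{-# OPTIONS --safe #-}
-- GL₂ acts on PG(3,q) by third symmetric powers and is transitive on the cubic,
-- so everything can be computed at P(∞) = e₀. The lines through P(∞) outside its
-- osculating plane are ⟨e₀, (0,b,a,1)⟩; such a line is an UnΓ-line iff D = a² − b
-- is nonzero, and its orbit is the square class of D. A plane (0,c₁,c₂,c₃) meets
-- the rest of the cubic in the roots of c₁t² + c₂t + c₃, and contains this line
-- iff c₁b + c₂a + c₃ = 0. Completing the square, the planes through the line are
-- governed by the values z² − 4D and the lines in the plane by the values z² − d,
-- d the discriminant; how often these are 0, squares or nonsquares follows from
-- the q − 1 points of the hyperbola z² − w² = d. Finally, a projectivity fixing the
-- cubic and P(∞) maps P(t) to a point (f₀,f₁,f₂,f₃) with f₁, f₂, f₃ of degree at most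
-- 2 in t. As q ≥ 5 values of t determine a quartic, f₂² = f₁f₃ holds for polynomials;
-- f₃ has no roots, so it is constant and the projectivity is an affine map of t.

module Submission where

open import Defs
open import Algebra.Bundles using (CommutativeRing)
open import Data.Bool using (Bool; true; false; _∧_; _∨_; not; T)
open import Data.Bool.Properties using (T-∧; T-∨)
open import Data.Empty using (⊥; ⊥-elim)
open import Data.Fin as Fin using (Fin; zero; suc; toℕ; inject≤)
open import Data.Fin.Patterns using (0F; 1F; 2F; 3F)
open import Data.Fin.Properties using (toℕ-injective; inject≤-injective)
open import Data.Maybe using (Maybe; just; nothing)
open import Data.Maybe.Properties using (just-injective)
open import Data.Nat as ℕ using (ℕ; zero; suc)
import Data.Nat.Properties as ℕ
open import Data.Nat.DivMod using (m*n%n≡0)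
open import Data.Nat.Solver using (module +-*-Solver)
open import Data.Product using (Σ; ∃; ∃₂; _×_; _,_; proj₁; proj₂)
open import Data.Sum using (_⊎_; inj₁; inj₂)
open import Data.Unit using (tt)
open import Data.Vec using (Vec; []; _∷_)
open import Data.Vec.Relation.Unary.All using (All; []; _∷_)
open import Function using (_∘_)
open import Function.Bundles using (_↔_; Inverse; Equivalence)
open import Relation.Binary.Definitions using (DecidableEquality; tri<; tri≈; tri>)
open import Relation.Binary.PropositionalEquality
open import Relation.Nullary using (¬_; yes; no; Dec; does)
open import Relation.Nullary.Decidable using (¬?; _×-dec_; decidable-stable)

-- The group and the third symmetric powers enter in two unequal ways. All counts use only that each
-- `S³ g` preserves the cubic and that some `g` carries P(∞) to any given point; that the group
-- contains nothing else is needed only to see that an orbit does not leave its class. The value D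
-- depends on the frame in which a line is read, so the two sets of lines are defined by the number
-- of 2_C-planes instead: one plane through the tangent at P(∞), plus one for each square root of
-- 4D. Lines in a plane are sorted by their unique point on the cubic. For planes of type 3_C and
-- 1_C all points contribute equally. A 2_C-plane is tangent at only one of its two points, the
-- contributions differ, and a separate normal form is required. The zero covector, incident with
-- every line, makes the same count yield the orbit sizes. A rootless f₃ might still be an
-- irreducible quadratic; then f₂ would be a constant multiple of it, and all finite points would
-- have the same image.

-- Finite sums and counting.

module Counting where
  open import Data.Nat using (_+_; _*_)
  open import Data.Nat.Properties using (+-identityʳ; *-comm; m+n≡0⇒m≡0; 1+n≢0; suc-injective; +-cancelˡ-≡; +-commutativeSemigroup)
  open import Algebra.Properties.CommutativeSemigroup +-commutativeSemigroup using (interchange)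
  open import Data.Fin.Properties using () renaming (_≟_ to _≟Fin_)
  open import Data.Maybe.Properties using () renaming (≡-dec to Maybe-≡-dec)
  open import Data.Product.Properties using () renaming (≡-dec to ×-≡-dec)

  private
    variable
      A B : Set

  infixr 5 _∧⁺_

  _∧⁺_ : ∀ {x y} → T x → T y → T (x ∧ y)
  p ∧⁺ q = Equivalence.from T-∧ (p , q)

  ∧⁻ : ∀ {x y} → T (x ∧ y) → T x × T y
  ∧⁻ = Equivalence.to T-∧

  not⁺ : ∀ {x} → ¬ T x → T (not x)
  not⁺ {true}  p = p tt
  not⁺ {false} p = tt

  not⁻ : ∀ {x} → T (not x) → ¬ T x
  not⁻ {false} _ ()

  bool-ext : ∀ {x y} → (T x → T y) → (T y → T x) → x ≡ y
  bool-ext {true}  {true}  f g = refl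
  bool-ext {true}  {false} f g = ⊥-elim (f tt)
  bool-ext {false} {true}  f g = ⊥-elim (g tt)
  bool-ext {false} {false} f g = refl

  ind-true : ∀ {x} → T x → ind x ≡ 1
  ind-true {true} _ = refl

  ind-false : ∀ {x} → ¬ T x → ind x ≡ 0
  ind-false {true}  p = ⊥-elim (p tt)
  ind-false {false} p = refl

  does⁺ : ∀ {P : Set} (d : Dec P) → P → T (does d)
  does⁺ (yes _) _ = tt
  does⁺ (no ¬p) p = ⊥-elim (¬p p)

  does⁻ : ∀ {P : Set} (d : Dec P) → T (does d) → P
  does⁻ (yes p) _ = p

  record Additive (S : (A → ℕ) → ℕ) : Set where
    field
      ∑-cong : ∀ {f g} → (∀ x → f x ≡ g x) → S f ≡ S g
      ∑-zero : S (λ _ → 0) ≡ 0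
      ∑-plus : ∀ f g → S (λ x → f x + g x) ≡ S f + S g

  -- A finite set is presented by its sum functional, so that the nested sums of the statement, over
  -- field elements, vectors and parameters, are instances on the nose. `∑-swap` ranges over all
  -- additive functionals, which reduces the interchange with any second sum to an argument in one
  -- variable.
  record Summation (A : Set) : Set₁ where
    infix 4 _≟_
    field
      ∑        : (A → ℕ) → ℕ
      additive : Additive ∑
      ∑-swap   : ∀ {B : Set} {S : (B → ℕ) → ℕ} → Additive S → (f : A → B → ℕ) →
                 ∑ (λ a → S (f a)) ≡ S (λ b → ∑ (λ a → f a b))
      ∑-single : ∀ a f → (∀ x → x ≢ a → f x ≡ 0) → ∑ f ≡ f a
      _≟_      : DecidableEquality A
    open Additive additive public

    card : (A → Bool) → ℕ
    card p = ∑ (λ a → ind (p a))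

    card-cong : ∀ {p r} → (∀ x → T (p x) → T (r x)) → (∀ x → T (r x) → T (p x)) → card p ≡ card r
    card-cong f g = ∑-cong λ x → cong ind (bool-ext (f x) (g x))

    ∑-vanish : ∀ {f} → (∀ x → f x ≡ 0) → ∑ f ≡ 0
    ∑-vanish e = trans (∑-cong e) ∑-zero

    card-empty : ∀ {p} → (∀ x → ¬ T (p x)) → card p ≡ 0
    card-empty e = ∑-vanish λ x → ind-false (e x)

    card-point : ∀ {p} a → T (p a) → (∀ x → T (p x) → x ≡ a) → card p ≡ 1
    card-point a pa u =
      trans (∑-single a _ λ x x≢a → ind-false λ px → x≢a (u x px)) (ind-true pa)

    ∑-scale : ∀ k f → ∑ (λ x → k * f x) ≡ k * ∑ f
    ∑-scale zero    f = ∑-zero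
    ∑-scale (suc k) f = trans (∑-plus f (λ x → k * f x)) (cong (∑ f +_) (∑-scale k f))

    ∑-scaleʳ : ∀ k f → ∑ (λ x → f x * k) ≡ ∑ f * k
    ∑-scaleʳ k f =
      trans (∑-cong λ x → *-comm (f x) k) (trans (∑-scale k f) (*-comm k (∑ f)))

    ∑-isolate : ∀ a f → ∑ f ≡ f a + ∑ (λ x → ind (not (does (x ≟ a))) * f x)
    ∑-isolate a f = begin
      ∑ f  ≡⟨ ∑-cong (λ x → split (does (x ≟ a)) (f x)) ⟩
      ∑ (λ x → ind (does (x ≟ a)) * f x + rest x)  ≡⟨ ∑-plus _ rest ⟩
      ∑ (λ x → ind (does (x ≟ a)) * f x) + ∑ rest  ≡⟨ cong (_+ ∑ rest) (∑-single a _ off) ⟩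
      ind (does (a ≟ a)) * f a + ∑ rest  ≡⟨ cong (λ n → n * f a + ∑ rest) (ind-true (does⁺ (a ≟ a) refl)) ⟩
      1 * f a + ∑ rest  ≡⟨ cong (_+ ∑ rest) (+-identityʳ (f a)) ⟩
      f a + ∑ rest  ∎
      where
      open ≡-Reasoning
      rest : A → ℕ
      rest x = ind (not (does (x ≟ a))) * f x
      split : ∀ b n → n ≡ ind b * n + ind (not b) * n
      split true  n = sym (trans (+-identityʳ _) (+-identityʳ n))
      split false n = sym (+-identityʳ n)
      off : ∀ x → x ≢ a → ind (does (x ≟ a)) * f x ≡ 0
      off x x≢a = cong (_* f x) (ind-false (λ t → x≢a (does⁻ (x ≟ a) t)))

    ∑≡0⇒vanish : ∀ f → ∑ f ≡ 0 → ∀ a → f a ≡ 0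
    ∑≡0⇒vanish f e a = m+n≡0⇒m≡0 (f a) (trans (sym (∑-isolate a f)) e)

    card≡0⇒empty : ∀ p → card p ≡ 0 → ∀ a → ¬ T (p a)
    card≡0⇒empty p e a pa = 1+n≢0 (trans (sym (ind-true pa)) (∑≡0⇒vanish _ e a))

    card≡1⇒unique : ∀ p → card p ≡ 1 → ∀ {a b} → T (p a) → T (p b) → a ≡ b
    card≡1⇒unique p e {a} {b} pa pb with b ≟ a in eq
    ... | yes b≡a = sym b≡a
    ... | no  b≢a = ⊥-elim (1+n≢0 {0} (begin
      1  ≡⟨ ind-true pb ⟨
      ind (p b)  ≡⟨ +-identityʳ _ ⟨
      1 * ind (p b)  ≡⟨ cong (λ d → ind (not (does d)) * ind (p b)) eq ⟨
      ind (not (does (b ≟ a))) * ind (p b)  ≡⟨ ∑≡0⇒vanish _ rest≡0 b ⟩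
      0  ∎))
      where
      open ≡-Reasoning
      rest : ℕ
      rest = ∑ (λ x → ind (not (does (x ≟ a))) * ind (p x))
      rest≡0 : rest ≡ 0
      rest≡0 = suc-injective (trans (cong (_+ rest) (sym (ind-true pa))) (trans (sym (∑-isolate a _)) e))

    card-complement : ∀ p → card p + card (λ x → not (p x)) ≡ ∑ (λ _ → 1)
    card-complement p = trans (sym (∑-plus _ _)) (∑-cong λ x → eq (p x))
      where
      eq : ∀ b → ind b + ind (not b) ≡ 1
      eq true  = refl
      eq false = refl

    -- Pigeonhole: `r` splits into `p` and the difference, whose cardinality is therefore 0.
    ⊆∧card≡⇒⊇ : ∀ {p r} → (∀ x → T (p x) → T (r x)) → card p ≡ card r → ∀ x → T (r x) → T (p x)
    ⊆∧card≡⇒⊇ {p} {r} p⊆r e x rx with p x in px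
    ... | true  = tt
    ... | false = card≡0⇒empty (λ y → r y ∧ not (p y)) none x
                    (rx ∧⁺ not⁺ λ t → subst T px t)
      where
      eq : ∀ y → ind (r y) ≡ ind (p y) + ind (r y ∧ not (p y))
      eq y with p y | r y | p⊆r y
      ... | true  | true  | _ = refl
      ... | true  | false | h = ⊥-elim (h tt)
      ... | false | true  | _ = refl
      ... | false | false | _ = refl
      none : card (λ y → r y ∧ not (p y)) ≡ 0
      none = +-cancelˡ-≡ (card p) _ 0
        (trans (sym (trans (∑-cong eq) (∑-plus _ _))) (trans (sym e) (sym (+-identityʳ (card p)))))

  -- A Boolean relation R restricting to a bijection between two subsets makes
  -- them equinumerous: count the incident pairs in both orders.
  module _ (𝓐 : Summation A) (𝓑 : Summation B) where
    private
      module 𝓐 = Summation 𝓐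
      module 𝓑 = Summation 𝓑

    card-bijection : (R : A → B → Bool) {p : A → Bool} {r : B → Bool} →
      (∀ a → T (p a) → Σ B λ b → T (r b) × T (R a b) × (∀ b′ → T (r b′) → T (R a b′) → b′ ≡ b)) →
      (∀ b → T (r b) → Σ A λ a → T (p a) × T (R a b) × (∀ a′ → T (p a′) → T (R a′ b) → a′ ≡ a)) →
      𝓐.card p ≡ 𝓑.card r
    card-bijection R {p} {r} f g = begin
      𝓐.card p  ≡⟨ 𝓐.∑-cong (λ a → row a) ⟩
      𝓐.∑ (λ a → 𝓑.∑ (λ b → h a b))  ≡⟨ 𝓐.∑-swap 𝓑.additive h ⟩
      𝓑.∑ (λ b → 𝓐.∑ (λ a → h a b))  ≡⟨ 𝓑.∑-cong (λ b → column b) ⟩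
      𝓑.card r  ∎
      where
      open ≡-Reasoning
      h : A → B → ℕ
      h a b = ind (p a ∧ r b ∧ R a b)
      row : ∀ a → ind (p a) ≡ 𝓑.∑ (λ b → h a b)
      row a with p a in e
      ... | false = sym 𝓑.∑-zero
      ... | true  = let b , rb , ab , u = f a (subst T (sym e) tt) in
        sym (𝓑.card-point b (rb ∧⁺ ab) λ b′ t → let rb′ , ab′ = ∧⁻ t in u b′ rb′ ab′)
      column : ∀ b → 𝓐.∑ (λ a → h a b) ≡ ind (r b)
      column b with r b in e
      ... | false = 𝓐.∑-vanish λ a → ind-false λ t → proj₂ (∧⁻ {p a} t)
      ... | true  = let a , pa , ab , u = g b (subst T (sym e) tt) in
        𝓐.card-point a (pa ∧⁺ ab) λ a′ t → let pa′ , ab′ = ∧⁻ {p a′} t in u a′ pa′ ab′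

    -- Both sides sum `f` over the graph of `to`, in the two possible orders.
    ∑-reindex : (to : A → B) (from : B → A) → (∀ a → from (to a) ≡ a) → (∀ b → to (from b) ≡ b) →
                ∀ f → 𝓑.∑ f ≡ 𝓐.∑ (λ a → f (to a))
    ∑-reindex to from ft tf f = begin
      𝓑.∑ f  ≡⟨ 𝓑.∑-cong (λ b → column b) ⟩
      𝓑.∑ (λ b → 𝓐.∑ (λ a → h a b))  ≡⟨ 𝓐.∑-swap 𝓑.additive h ⟨
      𝓐.∑ (λ a → 𝓑.∑ (λ b → h a b))  ≡⟨ 𝓐.∑-cong (λ a → row a) ⟩
      𝓐.∑ (λ a → f (to a))  ∎
      where
      open ≡-Reasoning
      h : A → B → ℕ
      h a b = ind (does (b 𝓑.≟ to a)) * f b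
      hit : ∀ {a b} → b ≡ to a → h a b ≡ f b
      hit {a} {b} e = trans (cong (_* f b) (ind-true (does⁺ (b 𝓑.≟ to a) e))) (+-identityʳ (f b))
      miss : ∀ {a b} → b ≢ to a → h a b ≡ 0
      miss {a} {b} e = cong (_* f b) (ind-false (λ t → e (does⁻ (b 𝓑.≟ to a) t)))
      column : ∀ b → f b ≡ 𝓐.∑ (λ a → h a b)
      column b = sym (trans (𝓐.∑-single (from b) _ λ a n → miss λ e → n (trans (sym (ft a)) (cong from (sym e))))
                            (hit (sym (tf b))))
      row : ∀ a → 𝓑.∑ (λ b → h a b) ≡ f (to a)
      row a = trans (𝓑.∑-single (to a) _ λ b → miss) (hit refl)

  sumFin-additive : ∀ n → Additive (sumFin {n})
  sumFin-additive zero = record { ∑-cong = λ _ → refl ; ∑-zero = refl ; ∑-plus = λ _ _ → refl }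
  sumFin-additive (suc n) = record
    { ∑-cong = λ e → cong₂ _+_ (e zero) (IH.∑-cong λ i → e (suc i))
    ; ∑-zero = IH.∑-zero
    ; ∑-plus = λ f g → trans (cong (f zero + g zero +_) (IH.∑-plus _ _))
                             (interchange (f zero) (g zero) _ _)
    }
    where
    module IH = Additive (sumFin-additive n)

  Fin-summation : ∀ n → Summation (Fin n)
  Fin-summation n = record
    { ∑ = sumFin ; additive = sumFin-additive n ; ∑-swap = swap n ; ∑-single = single n ; _≟_ = _≟Fin_ }
    where
    swap : ∀ n {B : Set} {S : (B → ℕ) → ℕ} → Additive S → (f : Fin n → B → ℕ) →
           sumFin (λ a → S (f a)) ≡ S (λ b → sumFin (λ a → f a b))
    swap zero        S+ f = sym (Additive.∑-zero S+)
    swap (suc n) {S = S} S+ f =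
      trans (cong (S (f zero) +_) (swap n S+ λ i → f (suc i))) (sym (Additive.∑-plus S+ _ _))
    single : ∀ n (a : Fin n) (f : Fin n → ℕ) → (∀ x → x ≢ a → f x ≡ 0) → sumFin f ≡ f a
    single (suc n) zero f e =
      trans (cong (f zero +_) (trans (Additive.∑-cong (sumFin-additive n) λ i → e (suc i) λ ())
                                     (Additive.∑-zero (sumFin-additive n))))
            (+-identityʳ (f zero))
    single (suc n) (suc a) f e =
      cong₂ _+_ (e zero λ ()) (single n a (λ i → f (suc i)) λ x n → e (suc x) λ { refl → n refl })

  transport-summation : A ↔ B → Summation A → DecidableEquality B → Summation B
  transport-summation {A} {B} iso 𝓐 _≟B_ = record
    { ∑ = λ f → ∑ (λ a → f (to a))
    ; additive = record
      { ∑-cong = λ e → ∑-cong λ a → e (to a) ; ∑-zero = ∑-zero ; ∑-plus = λ f g → ∑-plus _ _ }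
    ; ∑-swap = λ S+ f → ∑-swap S+ λ a → f (to a)
    ; ∑-single = λ b f e →
        trans (∑-single (from b) _ λ a n → e (to a) λ { refl → n (sym (strictlyInverseʳ a)) })
              (cong f (strictlyInverseˡ b))
    ; _≟_ = _≟B_
    }
    where
    open Summation 𝓐
    open Inverse iso

  infixr 2 _×-summation_

  _×-summation_ : Summation A → Summation B → Summation (A × B)
  𝓐 ×-summation 𝓑 = record
    { ∑ = λ f → 𝓐.∑ λ a → 𝓑.∑ λ b → f (a , b)
    ; additive = record
      { ∑-cong = λ e → 𝓐.∑-cong λ a → 𝓑.∑-cong λ b → e (a , b)
      ; ∑-zero = 𝓐.∑-vanish λ a → 𝓑.∑-zero
      ; ∑-plus = λ f g → trans (𝓐.∑-cong λ a → 𝓑.∑-plus _ _) (𝓐.∑-plus _ _)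
      }
    ; ∑-swap = λ S+ f → trans (𝓐.∑-cong λ a → 𝓑.∑-swap S+ λ b → f (a , b)) (𝓐.∑-swap S+ λ a b′ → 𝓑.∑ λ b → f (a , b) b′)
    ; ∑-single = λ (a , b) f e →
        trans (𝓐.∑-single a _ λ x n → 𝓑.∑-vanish λ y → e (x , y) λ { refl → n refl })
              (𝓑.∑-single b _ λ y n → e (a , y) λ { refl → n refl })
    ; _≟_ = ×-≡-dec 𝓐._≟_ 𝓑._≟_
    }
    where
    module 𝓐 = Summation 𝓐
    module 𝓑 = Summation 𝓑

  Maybe-summation : Summation A → Summation (Maybe A)
  Maybe-summation {A} 𝓐 = record
    { ∑ = λ f → f nothing + ∑ λ a → f (just a)
    ; additive = record
      { ∑-cong = λ e → cong₂ _+_ (e nothing) (∑-cong λ a → e (just a))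
      ; ∑-zero = ∑-zero
      ; ∑-plus = λ f g → trans (cong (f nothing + g nothing +_) (∑-plus _ _))
                               (interchange (f nothing) (g nothing) _ _)
      }
    ; ∑-swap = λ {B} {S} S+ f →
        trans (cong (S (f nothing) +_) (∑-swap S+ λ a → f (just a))) (sym (Additive.∑-plus S+ _ _))
    ; ∑-single = λ where
        nothing f e → trans (cong (f nothing +_) (∑-vanish λ a → e (just a) λ ())) (+-identityʳ _)
        (just a) f e → cong₂ _+_ (e nothing λ ()) (∑-single a _ λ x n → e (just x) λ { refl → n refl })
    ; _≟_ = Maybe-≡-dec _≟_
    }
    where
    open Summation 𝓐

open Counting

-- Polynomial identities over the field.

-- A ring solver with integer coefficients, so that numerical coefficients
-- compute even though the field is abstract.
module IntegerCoefficients {q : ℕ} (𝔽 : FiniteField q) where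
  open import Data.Integer as ℤ using (ℤ; -[1+_]) renaming (+_ to pos)
  import Data.Integer.Properties as ℤ
  open import Data.Vec.N-ary using (N-ary; curryⁿ; curryⁿ-cong; Eq)
  import Relation.Binary.Reflection as Reflection
  open import Tactic.RingSolver.Core.AlmostCommutativeRing using (AlmostCommutativeRing; fromCommutativeRing)
  open import Tactic.RingSolver.Core.Expression using (Expr; Κ; Ι; _⊕_; _⊗_; ⊝_; module Eval)
  import Tactic.RingSolver.Core.Polynomial.Base as Base
  import Tactic.RingSolver.Core.Polynomial.Homomorphism as PolyHom
  import Tactic.RingSolver.Core.Polynomial.Parameters as Parameters
  import Tactic.RingSolver.Core.Polynomial.Semantics as Semantics
  open FiniteField 𝔽

  commutativeRing : CommutativeRing _ _
  commutativeRing = record { isCommutativeRing = isCommutativeRing }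

  acr : AlmostCommutativeRing _ _
  acr = fromCommutativeRing commutativeRing (λ _ → nothing)

  open CommutativeRing commutativeRing using (+-identityˡ; +-identityʳ; +-assoc; +-comm; -‿inverseʳ; distribʳ; zeroˡ; *-identityˡ; ring)
  open import Algebra.Properties.Ring ring using (-‿+-comm; -‿involutive; -‿distribˡ-*; -‿distribʳ-*; -0#≈0#)

  -- The separate clause for 1 avoids a trailing `0#`: the constants `:1`, `:2`, `:3` and `:4`
  -- denote literally `1#`, `1# + 1#` and so on, and match the terms of the geometry without
  -- rewriting.
  fromℕ : ℕ → Carrier
  fromℕ zero    = 0#
  fromℕ (suc zero) = 1#
  fromℕ (suc n@(suc _)) = 1# + fromℕ n

  fromℤ : ℤ → Carrier
  fromℤ (pos n)    = fromℕ n
  fromℤ -[1+ n ] = - fromℕ (suc n)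

  fromℕ-suc : ∀ n → fromℕ (suc n) ≡ 1# + fromℕ n
  fromℕ-suc zero    = sym (+-identityʳ 1#)
  fromℕ-suc (suc n) = refl

  fromℕ-+ : ∀ m n → fromℕ (m ℕ.+ n) ≡ fromℕ m + fromℕ n
  fromℕ-+ zero    n = sym (+-identityˡ _)
  fromℕ-+ (suc m) n = begin
    fromℕ (suc (m ℕ.+ n))  ≡⟨ fromℕ-suc (m ℕ.+ n) ⟩
    1# + fromℕ (m ℕ.+ n)  ≡⟨ cong (1# +_) (fromℕ-+ m n) ⟩
    1# + (fromℕ m + fromℕ n)  ≡⟨ +-assoc _ _ _ ⟨
    (1# + fromℕ m) + fromℕ n  ≡⟨ cong (_+ fromℕ n) (fromℕ-suc m) ⟨
    fromℕ (suc m) + fromℕ n  ∎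
    where open ≡-Reasoning

  fromℕ-* : ∀ m n → fromℕ (m ℕ.* n) ≡ fromℕ m * fromℕ n
  fromℕ-* zero    n = sym (zeroˡ _)
  fromℕ-* (suc m) n = begin
    fromℕ (n ℕ.+ m ℕ.* n)  ≡⟨ fromℕ-+ n _ ⟩
    fromℕ n + fromℕ (m ℕ.* n)  ≡⟨ cong₂ _+_ (sym (*-identityˡ _)) (fromℕ-* m n) ⟩
    (1# * fromℕ n) + (fromℕ m * fromℕ n) ≡⟨ distribʳ _ _ _ ⟨
    (1# + fromℕ m) * fromℕ n  ≡⟨ cong (_* fromℕ n) (fromℕ-suc m) ⟨
    fromℕ (suc m) * fromℕ n  ∎
    where open ≡-Reasoning

  fromℤ-neg : ∀ i → fromℤ (ℤ.- i) ≡ - fromℤ i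
  fromℤ-neg (pos zero)  = sym -0#≈0#
  fromℤ-neg (pos (suc n)) = refl
  fromℤ-neg -[1+ n ]  = sym (-‿involutive _)

  fromℤ-⊖ : ∀ m n → fromℤ (m ℤ.⊖ n) ≡ fromℕ m + (- fromℕ n)
  fromℤ-⊖ m       zero    = sym (trans (cong (fromℕ m +_) -0#≈0#) (+-identityʳ _))
  fromℤ-⊖ zero    (suc n) = sym (+-identityˡ _)
  fromℤ-⊖ (suc m) (suc n) = begin
    fromℤ (suc m ℤ.⊖ suc n)  ≡⟨ cong fromℤ (ℤ.[1+m]⊖[1+n]≡m⊖n m n) ⟩
    fromℤ (m ℤ.⊖ n)  ≡⟨ fromℤ-⊖ m n ⟩
    fromℕ m + (- fromℕ n)  ≡⟨ cong (_+ (- fromℕ n)) (+-identityʳ _) ⟨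
    (fromℕ m + 0#) + (- fromℕ n)  ≡⟨ cong (λ z → (fromℕ m + z) + (- fromℕ n)) (-‿inverseʳ 1#) ⟨
    (fromℕ m + (1# + (- 1#))) + (- fromℕ n)  ≡⟨ cong (_+ (- fromℕ n)) (+-assoc _ _ _) ⟨
    ((fromℕ m + 1#) + (- 1#)) + (- fromℕ n)  ≡⟨ +-assoc _ _ _ ⟩
    (fromℕ m + 1#) + ((- 1#) + (- fromℕ n))  ≡⟨ cong₂ _+_ (trans (+-comm _ _) (sym (fromℕ-suc m))) (trans (-‿+-comm _ _) (cong -_ (sym (fromℕ-suc n)))) ⟩
    fromℕ (suc m) + (- fromℕ (suc n))  ∎
    where open ≡-Reasoning

  fromℤ-+ : ∀ i j → fromℤ (i ℤ.+ j) ≡ fromℤ i + fromℤ j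
  fromℤ-+ (pos m)    (pos n)    = fromℕ-+ m n
  fromℤ-+ (pos m)    -[1+ n ] = fromℤ-⊖ m (suc n)
  fromℤ-+ -[1+ m ] (pos n)    = trans (fromℤ-⊖ n (suc m)) (+-comm _ _)
  fromℤ-+ -[1+ m ] -[1+ n ] = begin
    - fromℕ (suc (suc (m ℕ.+ n)))  ≡⟨ cong (λ k → - fromℕ (suc k)) (ℕ+-suc m n) ⟨
    - fromℕ (suc m ℕ.+ suc n)  ≡⟨ cong -_ (fromℕ-+ (suc m) (suc n)) ⟩
    - (fromℕ (suc m) + fromℕ (suc n))  ≡⟨ -‿+-comm _ _ ⟨
    (- fromℕ (suc m)) + (- fromℕ (suc n))  ∎
    where
    open ≡-Reasoning
    open import Data.Nat.Properties using () renaming (+-suc to ℕ+-suc)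

  fromℤ-*⁺ : ∀ m j → fromℤ (pos m ℤ.* j) ≡ fromℤ (pos m) * fromℤ j
  fromℤ-*⁺ m (pos n) = trans (cong fromℤ (sym (ℤ.pos-* m n))) (fromℕ-* m n)
  fromℤ-*⁺ m -[1+ n ] = begin
    fromℤ (pos m ℤ.* -[1+ n ])  ≡⟨ cong fromℤ (ℤ.neg-distribʳ-* (pos m) (pos (suc n))) ⟨
    fromℤ (ℤ.- (pos m ℤ.* pos (suc n)))  ≡⟨ fromℤ-neg (pos m ℤ.* pos (suc n)) ⟩
    - fromℤ (pos m ℤ.* pos (suc n))  ≡⟨ cong -_ (fromℤ-*⁺ m (pos (suc n))) ⟩
    - (fromℕ m * fromℕ (suc n))  ≡⟨ -‿distribʳ-* _ _ ⟩
    fromℕ m * (- fromℕ (suc n))  ∎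
    where open ≡-Reasoning

  fromℤ-* : ∀ i j → fromℤ (i ℤ.* j) ≡ fromℤ i * fromℤ j
  fromℤ-* (pos m)    j = fromℤ-*⁺ m j
  fromℤ-* -[1+ m ] j = begin
    fromℤ (-[1+ m ] ℤ.* j)  ≡⟨ cong fromℤ (ℤ.neg-distribˡ-* (pos (suc m)) j) ⟨
    fromℤ (ℤ.- (pos (suc m) ℤ.* j))  ≡⟨ fromℤ-neg (pos (suc m) ℤ.* j) ⟩
    - fromℤ (pos (suc m) ℤ.* j)  ≡⟨ cong -_ (fromℤ-*⁺ (suc m) j) ⟩
    - (fromℕ (suc m) * fromℤ j)  ≡⟨ -‿distribˡ-* _ _ ⟩
    (- fromℕ (suc m)) * fromℤ j  ∎
    where open ≡-Reasoning

  isZero : ℤ → Bool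
  isZero (pos zero) = true
  isZero _        = false

  homomorphism : Parameters.Homomorphism _ _ _ _
  homomorphism = record
    { from = record { rawRing = ℤ.+-*-rawRing ; isZero = isZero }
    ; to = acr
    ; morphism = record
      { ⟦_⟧ = fromℤ ; +-homo = fromℤ-+ ; *-homo = fromℤ-* ; -‿homo = fromℤ-neg
      ; 0-homo = refl ; 1-homo = refl }
    ; Zero-C⟶Zero-R = λ { (pos zero) _ → refl }
    }

  open Eval (AlmostCommutativeRing.rawRing acr) fromℤ public using (⟦_⟧)
  open Base (Parameters.Homomorphism.from homomorphism) using (Poly; κ; ι; _⊞_; _⊠_; ⊟_; _⊡_)
  open Semantics homomorphism renaming (⟦_⟧ to ⟦_⟧ₚ)
  open PolyHom homomorphism
  open import Algebra.Properties.Semiring.Exp.TCOptimised (AlmostCommutativeRing.semiring acr) using (^-congˡ)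

  Expression : ℕ → Set
  Expression = Expr ℤ

  infixl 6 _:+_ _:-_
  infixl 7 _:*_
  infix  8 :-_

  _:+_ _:*_ _:-_ : ∀ {n} → Expression n → Expression n → Expression n
  _:+_ = _⊕_
  _:*_ = _⊗_
  x :- y = x ⊕ (⊝ y)

  :-_ : ∀ {n} → Expression n → Expression n
  :-_ = ⊝_

  :0 :1 :2 :3 :4 : ∀ {n} → Expression n
  :0 = Κ (pos 0)
  :1 = Κ (pos 1)
  :2 = :1 :+ :1
  :3 = :1 :+ (:1 :+ :1)
  :4 = :2 :* :2

  norm : ∀ {n} → Expression n → Poly n
  norm (Κ x)   = κ x
  norm (Ι x)   = ι x
  norm (x ⊕ y) = norm x ⊞ norm y
  norm (x ⊗ y) = norm x ⊠ norm y
  norm (⊝ x)   = ⊟ norm x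
  norm (x Expr.⊛ i) = norm x ⊡ i

  correct : ∀ {n} (e : Expression n) ρ → ⟦ norm e ⟧ₚ ρ ≡ ⟦ e ⟧ ρ
  correct (Κ x)   ρ = κ-hom x ρ
  correct (Ι x)   ρ = ι-hom x ρ
  correct (x ⊕ y) ρ = trans (⊞-hom (norm x) (norm y) ρ) (cong₂ _+_ (correct x ρ) (correct y ρ))
  correct (x ⊗ y) ρ = trans (⊠-hom (norm x) (norm y) ρ) (cong₂ _*_ (correct x ρ) (correct y ρ))
  correct (⊝ x)   ρ = trans (⊟-hom (norm x) ρ) (cong -_ (correct x ρ))
  correct (x Expr.⊛ i) ρ = trans (⊡-hom (norm x) i ρ) (^-congˡ i (correct x ρ))

  -- The premise compares normal forms whose coefficients are integers. These are closed data, so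
  -- `refl` proves it by computation, whatever the field is.
  by-ring : ∀ n (f : N-ary n (Expression n) (Expression n × Expression n)) →
          let open Reflection (setoid Carrier) Ι ⟦_⟧ (λ e → ⟦ norm e ⟧ₚ) correct using (close) in
          norm (proj₁ (close n f)) ≡ norm (proj₂ (close n f)) →
          Eq n _≡_ (curryⁿ ⟦ proj₁ (close n f) ⟧) (curryⁿ ⟦ proj₂ (close n f) ⟧)
  by-ring n f e = curryⁿ-cong _≡_ _ _ λ ρ →
    trans (sym (correct (proj₁ (close n f)) ρ))
          (trans (cong (λ p → ⟦ p ⟧ₚ ρ) e) (correct (proj₂ (close n f)) ρ))
    where
    open Reflection (setoid Carrier) Ι ⟦_⟧ (λ e → ⟦ norm e ⟧ₚ) correct using (close)

-- Elementary arithmetic of a finite field of odd order.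

T-any⁻ : ∀ {n} (f : Fin n → Bool) → T (anyFin f) → ∃ λ i → T (f i)
T-any⁻ {suc n} f t with f zero in e
... | true  = zero , subst T (sym e) tt
... | false = let i , p = T-any⁻ (λ i → f (suc i)) t in suc i , p

T-any⁺ : ∀ {n} (f : Fin n → Bool) i → T (f i) → T (anyFin f)
T-any⁺ f zero    p with true ← f zero = tt
T-any⁺ f (suc i) p with f zero
... | true  = tt
... | false = T-any⁺ (λ i → f (suc i)) i p

T-all⁻ : ∀ {n} (f : Fin n → Bool) → T (allFin f) → ∀ i → T (f i)
T-all⁻ f t zero    = proj₁ (∧⁻ t)
T-all⁻ f t (suc i) = T-all⁻ (λ i → f (suc i)) (proj₂ (∧⁻ {f zero} t)) i

T-all⁺ : ∀ {n} (f : Fin n → Bool) → (∀ i → T (f i)) → T (allFin f)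
T-all⁺ {zero}  f p = tt
T-all⁺ {suc n} f p = p zero ∧⁺ T-all⁺ (λ i → f (suc i)) λ i → p (suc i)

sumFin-1 : ∀ n → sumFin {n} (λ _ → 1) ≡ n
sumFin-1 zero    = refl
sumFin-1 (suc n) = cong suc (sumFin-1 n)

module FieldTheory {q : ℕ} (𝔽 : FiniteField q) where
  open FiniteField 𝔽 public renaming (_+_ to infixl 6 _+_; _*_ to infixl 7 _*_; -_ to infix 8 -_; _≟_ to infix 4 _≟_)
  open Geometry 𝔽 public
  open IntegerCoefficients 𝔽 public using (by-ring; Expression; _:+_; _:*_; _:-_; :-_; :0; :1; :2; :3; :4)
  open CommutativeRing (IntegerCoefficients.commutativeRing 𝔽) public
    using (+-identityˡ; +-identityʳ; +-comm; +-assoc; -‿inverseʳ; *-comm; *-assoc; *-identityˡ; *-identityʳ; zeroˡ; zeroʳ; _-_)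

  -- Kept opaque so that a count over the field remains a single term in later goals; `∑≡countF`
  -- leads back to the definition.
  opaque
    𝓕 : Summation Carrier
    𝓕 = transport-summation enum (Fin-summation q) _≟_

    ∑≡countF : ∀ f → Summation.∑ 𝓕 f ≡ countF f
    ∑≡countF f = refl

  open Summation 𝓕 public using (card)
  module 𝓕 = Summation 𝓕

  1≢0 : 1# ≢ 0#
  1≢0 e = 0≢1 (sym e)

  x≡0⇒xy≡0 : ∀ {x} y → x ≡ 0# → x * y ≡ 0#
  x≡0⇒xy≡0 y e = trans (cong (_* y) e) (zeroˡ y)

  inverse-cancelʳ : ∀ {k i} → k * i ≡ 1# → ∀ x → k * (i * x) ≡ x
  inverse-cancelʳ {k} {i} ki x = trans (sym (*-assoc k i x)) (trans (cong (_* x) ki) (*-identityˡ x))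

  inverse-cancelˡ : ∀ {k i} → k * i ≡ 1# → ∀ x → i * (k * x) ≡ x
  inverse-cancelˡ {k} {i} ki = inverse-cancelʳ (trans (*-comm i k) ki)

  inverse-nonzero : ∀ {k i} → k * i ≡ 1# → i ≢ 0#
  inverse-nonzero {k} ki i≡0 = 1≢0 (trans (sym ki) (trans (cong (k *_) i≡0) (zeroʳ k)))

  *-cancel-0 : ∀ {x y} → x ≢ 0# → x * y ≡ 0# → y ≡ 0#
  *-cancel-0 {x} {y} x≢0 xy≡0 = let i , xi = inverse x x≢0 in
    trans (sym (inverse-cancelˡ xi y)) (trans (cong (i *_) xy≡0) (zeroʳ i))

  *-nonzero : ∀ {x y} → x ≢ 0# → y ≢ 0# → x * y ≢ 0#
  *-nonzero x≢0 y≢0 e = y≢0 (*-cancel-0 x≢0 e)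

  x²≡0⇒x≡0 : ∀ {x} → x * x ≡ 0# → x ≡ 0#
  x²≡0⇒x≡0 {x} e with x ≟ 0#
  ... | yes x≡0 = x≡0
  ... | no  x≢0 = *-cancel-0 x≢0 e

  -≡0⇒≡ : ∀ {x y} → x - y ≡ 0# → x ≡ y
  -≡0⇒≡ {x} {y} e = begin
    x  ≡⟨ by-ring 2 (λ x y → x , (x :- y) :+ y) refl x y ⟩
    x - y + y  ≡⟨ cong (_+ y) e ⟩
    0# + y  ≡⟨ +-identityˡ y ⟩
    y  ∎
    where open ≡-Reasoning

  ≡⇒-≡0 : ∀ {x y} → x ≡ y → x - y ≡ 0#
  ≡⇒-≡0 {x} refl = -‿inverseʳ x

  *-cancelˡ : ∀ {x y z} → x ≢ 0# → x * y ≡ x * z → y ≡ z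
  *-cancelˡ {x} {y} {z} x≢0 e = -≡0⇒≡ (*-cancel-0 x≢0
    (trans (by-ring 3 (λ x y z → x :* (y :- z) , x :* y :- x :* z) refl x y z) (≡⇒-≡0 e)))

  ≡ᶠ⁺ : ∀ {x y} → x ≡ y → T (x ≡ᶠ y)
  ≡ᶠ⁺ = does⁺ (_ ≟ _)

  ≡ᶠ⁻ : ∀ {x y} → T (x ≡ᶠ y) → x ≡ y
  ≡ᶠ⁻ = does⁻ (_ ≟ _)

  ≢ᶠ⁺ : ∀ {x y} → x ≢ y → T (not (x ≡ᶠ y))
  ≢ᶠ⁺ n = not⁺ λ t → n (≡ᶠ⁻ t)

  ≢ᶠ⁻ : ∀ {x y} → T (not (x ≡ᶠ y)) → x ≢ y
  ≢ᶠ⁻ t e = not⁻ t (≡ᶠ⁺ e)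

  anyF⁻ : ∀ f → T (anyF f) → ∃ λ x → T (f x)
  anyF⁻ f t = let i , p = T-any⁻ _ t in elt i , p

  anyF⁺ : ∀ f x → T (f x) → T (anyF f)
  anyF⁺ f x p = T-any⁺ _ (Inverse.from enum x)
    (subst (λ y → T (f y)) (sym (Inverse.strictlyInverseˡ enum x)) p)

  ∑1≡q : 𝓕.∑ (λ _ → 1) ≡ q
  ∑1≡q = trans (∑≡countF _) (sumFin-1 q)

  -- In characteristic 2 the fixed-point-free involution x ↦ x + 1 would pair off the elements.
  two≢0 : q ℕ.% 2 ≡ 1 → 1# + 1# ≢ 0#
  two≢0 odd 2≡0 = ℕ.1+n≢0 (sym (trans (sym (m*n%n≡0 (card up) 2)) (trans (cong (ℕ._% 2) 2∣q) odd)))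
    where
    open ≡-Reasoning
    rank : Carrier → ℕ
    rank x = toℕ (Inverse.from enum x)
    -- The enumeration supplies an order, and the element of smaller rank in each pair `x`, `x + 1`
    -- is marked. Adding 1 then exchanges marked and unmarked elements.
    up : Carrier → Bool
    up x = rank x ℕ.<ᵇ rank (x + 1#)
    rank-injective : ∀ {x y} → rank x ≡ rank y → x ≡ y
    rank-injective e = trans (sym (Inverse.strictlyInverseˡ enum _))
      (trans (cong elt (toℕ-injective e)) (Inverse.strictlyInverseˡ enum _))
    involutive : ∀ x → x + 1# + 1# ≡ x
    involutive x = trans (+-assoc x 1# 1#) (trans (cong (x +_) 2≡0) (+-identityʳ x))
    flip⁻ : ∀ x → T (up x) → T (not (up (x + 1#)))
    flip⁻ x u = not⁺ λ v → ℕ.<-asym (ℕ.<ᵇ⇒< _ _ u)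
      (subst (rank (x + 1#) ℕ.<_) (cong rank (involutive x)) (ℕ.<ᵇ⇒< _ _ v))
    flip⁺ : ∀ x → T (not (up x)) → T (up (x + 1#))
    flip⁺ x u = ℕ.<⇒<ᵇ (subst (rank (x + 1#) ℕ.<_) (cong rank (sym (involutive x)))
      (ℕ.≤∧≢⇒< (ℕ.≮⇒≥ λ v → not⁻ u (ℕ.<⇒<ᵇ v)) λ e → 1≢0 (begin
        1#  ≡⟨ by-ring 1 (λ x → :1 , (x :+ :1) :- x) refl x ⟩
        x + 1# - x  ≡⟨ ≡⇒-≡0 (rank-injective e) ⟩
        0#  ∎)))
    halves : card up ≡ card (λ x → not (up x))
    halves = card-bijection 𝓕 𝓕 (λ x y → y ≡ᶠ (x + 1#))
      (λ x u → x + 1# , flip⁻ x u , ≡ᶠ⁺ refl , λ _ _ e → ≡ᶠ⁻ e)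
      (λ y v → y + 1# , flip⁺ y v , ≡ᶠ⁺ (sym (involutive y)) ,
        λ x _ e → trans (sym (involutive x)) (cong (_+ 1#) (sym (≡ᶠ⁻ e))))
    2∣q : card up ℕ.* 2 ≡ q
    2∣q = begin
      card up ℕ.* 2  ≡⟨ ℕ.*-comm (card up) 2 ⟩
      card up ℕ.+ (card up ℕ.+ 0)  ≡⟨ cong (card up ℕ.+_) (trans (ℕ.+-identityʳ _) halves) ⟩
      card up ℕ.+ card (λ x → not (up x))  ≡⟨ 𝓕.card-complement up ⟩
      𝓕.∑ (λ _ → 1)  ≡⟨ ∑1≡q ⟩
      q  ∎

-- Squares, nonsquares and the values of z² - d.

data Class : Set where
  nonsquare square : Class

module Squares {q : ℕ} (𝔽 : FiniteField q) (odd : q ℕ.% 2 ≡ 1) where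
  open FieldTheory 𝔽

  2# 4# : Carrier
  2# = 1# + 1#
  4# = 2# * 2#

  2≢0 : 2# ≢ 0#
  2≢0 = two≢0 odd

  4≢0 : 4# ≢ 0#
  4≢0 = *-nonzero 2≢0 2≢0

  isSquare : Carrier → Bool
  isSquare d = anyF λ x → (x * x) ≡ᶠ d

  -- The two classes partition the nonzero elements. Zero is a square, so only the class of squares
  -- has to exclude it explicitly.
  inClass : Class → Carrier → Bool
  inClass nonsquare d = not (isSquare d)
  inClass square    d = not (d ≡ᶠ 0#) ∧ isSquare d

  isSquare⁺ : ∀ {d} x → x * x ≡ d → T (isSquare d)
  isSquare⁺ x e = anyF⁺ _ x (≡ᶠ⁺ e)

  isSquare⁻ : ∀ {d} → T (isSquare d) → ∃ λ x → x * x ≡ d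
  isSquare⁻ {d} t = let x , e = anyF⁻ (λ x → (x * x) ≡ᶠ d) t in x , ≡ᶠ⁻ e

  square⁺ : ∀ {d} x → x ≢ 0# → x * x ≡ d → T (inClass square d)
  square⁺ {d} x x≢0 e = ≢ᶠ⁺ (λ d≡0 → x≢0 (x²≡0⇒x≡0 (trans e d≡0))) ∧⁺ isSquare⁺ x e

  square⁻ : ∀ {d} → T (inClass square d) → ∃ λ x → x ≢ 0# × x * x ≡ d
  square⁻ {d} t = let d≢0 , s = ∧⁻ {not (d ≡ᶠ 0#)} t
                      x , e = isSquare⁻ s
    in x , (λ x≡0 → ≢ᶠ⁻ d≢0 (trans (sym e) (x≡0⇒xy≡0 x x≡0))) , e

  inClass⇒≢0 : ∀ j {d} → T (inClass j d) → d ≢ 0#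
  inClass⇒≢0 nonsquare t refl = not⁻ t (isSquare⁺ 0# (zeroʳ 0#))
  inClass⇒≢0 square {d} t = ≢ᶠ⁻ (proj₁ (∧⁻ {not (d ≡ᶠ 0#)} t))

  classify : ∀ {d} → d ≢ 0# → ∃ λ j → T (inClass j d)
  classify {d} d≢0 with isSquare d in e
  ... | false = nonsquare , subst (λ b → T (not b)) (sym e) tt
  ... | true  = square , (≢ᶠ⁺ d≢0 ∧⁺ subst T (sym e) tt)

  inClass-unique : ∀ i j {d} → T (inClass i d) → T (inClass j d) → i ≡ j
  inClass-unique nonsquare nonsquare _ _ = refl
  inClass-unique square square _ _ = refl
  inClass-unique nonsquare square {d} t u = ⊥-elim (not⁻ t (proj₂ (∧⁻ {not (d ≡ᶠ 0#)} u)))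
  inClass-unique square nonsquare {d} t u = ⊥-elim (not⁻ u (proj₂ (∧⁻ {not (d ≡ᶠ 0#)} t)))

  inClass-scale⁺ : ∀ j {k d} → k ≢ 0# → T (inClass j d) → T (inClass j (k * k * d))
  inClass-scale⁺ nonsquare {k} {d} k≢0 t = not⁺ λ s →
    let x , e = isSquare⁻ s
        k⁻¹ , ke = inverse k k≢0
    in not⁻ t (isSquare⁺ (k⁻¹ * x) (begin
      k⁻¹ * x * (k⁻¹ * x)  ≡⟨ by-ring 2 (λ i x → i :* x :* (i :* x) , i :* i :* (x :* x)) refl k⁻¹ x ⟩
      k⁻¹ * k⁻¹ * (x * x)  ≡⟨ cong (k⁻¹ * k⁻¹ *_) e ⟩
      k⁻¹ * k⁻¹ * (k * k * d)  ≡⟨ by-ring 3 (λ i k d → i :* i :* (k :* k :* d) , k :* i :* (k :* i) :* d) refl k⁻¹ k d ⟩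
      k * k⁻¹ * (k * k⁻¹) * d  ≡⟨ cong (λ z → z * z * d) ke ⟩
      1# * 1# * d  ≡⟨ by-ring 1 (λ d → :1 :* :1 :* d , d) refl d ⟩
      d  ∎))
    where open ≡-Reasoning
  inClass-scale⁺ square {k} {d} k≢0 t =
    let x , x≢0 , e = square⁻ t
    in square⁺ (k * x) (*-nonzero k≢0 x≢0)
         (trans (by-ring 2 (λ k x → k :* x :* (k :* x) , k :* k :* (x :* x)) refl k x) (cong (k * k *_) e))

  inClass-scale⁻ : ∀ j {k d} → k ≢ 0# → T (inClass j (k * k * d)) → T (inClass j d)
  inClass-scale⁻ j {k} {d} k≢0 t =
    let i , u = classify d≢0 in subst (λ j → T (inClass j d)) (inClass-unique i j (inClass-scale⁺ i k≢0 u) t) u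
    where
    d≢0 : d ≢ 0#
    d≢0 refl = inClass⇒≢0 j t (zeroʳ (k * k))

  -- This is 1 + χ(d) for the quadratic character χ; sums of it take the place of character sums.
  roots : Carrier → ℕ
  roots d = card λ z → (z * z) ≡ᶠ d

  x≢-x : ∀ {x} → x ≢ 0# → x ≢ - x
  x≢-x {x} x≢0 e = x≢0 (*-cancel-0 2≢0
    (trans (by-ring 1 (λ x → :2 :* x , x :- (:- x)) refl x) (≡⇒-≡0 e)))

  x²≡y²⇒ : ∀ {x y} → x * x ≡ y * y → x ≡ y ⊎ x ≡ - y
  x²≡y²⇒ {x} {y} e with x ≟ y
  ... | yes x≡y = inj₁ x≡y
  ... | no  x≢y = inj₂ (-≡0⇒≡ (*-cancel-0 (λ z → x≢y (-≡0⇒≡ z))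
    (trans (by-ring 2 (λ x y → (x :- y) :* (x :- (:- y)) , x :* x :- y :* y) refl x y) (≡⇒-≡0 e))))

  roots-0 : roots 0# ≡ 1
  roots-0 = 𝓕.card-point 0# (≡ᶠ⁺ (zeroʳ 0#)) λ x e → x²≡0⇒x≡0 (≡ᶠ⁻ e)

  roots-nonsquare : ∀ {d} → T (inClass nonsquare d) → roots d ≡ 0
  roots-nonsquare t = 𝓕.card-empty λ x e → not⁻ t (isSquare⁺ x (≡ᶠ⁻ e))

  roots-square : ∀ {d} → T (inClass square d) → roots d ≡ 2
  roots-square {d} t with square⁻ t
  ... | y , y≢0 , refl = begin
    card (λ z → (z * z) ≡ᶠ (y * y))  ≡⟨ 𝓕.∑-cong pointwise ⟩
    𝓕.∑ (λ z → ind (z ≡ᶠ y) ℕ.+ ind (z ≡ᶠ (- y)))  ≡⟨ 𝓕.∑-plus _ _ ⟩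
    card (λ z → z ≡ᶠ y) ℕ.+ card (λ z → z ≡ᶠ (- y))  ≡⟨ cong₂ ℕ._+_ (one y) (one (- y)) ⟩
    2  ∎
    where
    open ≡-Reasoning
    one : ∀ a → card (λ z → z ≡ᶠ a) ≡ 1
    one a = 𝓕.card-point a (≡ᶠ⁺ refl) λ x → ≡ᶠ⁻
    pointwise : ∀ z → ind ((z * z) ≡ᶠ (y * y)) ≡ ind (z ≡ᶠ y) ℕ.+ ind (z ≡ᶠ (- y))
    pointwise z with z ≟ y | z ≟ (- y)
    ... | yes refl | yes e = ⊥-elim (x≢-x y≢0 e)
    ... | yes refl | no _  = ind-true (≡ᶠ⁺ refl)
    ... | no _ | yes refl  = ind-true (≡ᶠ⁺ (by-ring 1 (λ y → :- y :* :- y , y :* y) refl y))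
    ... | no n | no m      = ind-false λ t → case (x²≡y²⇒ (≡ᶠ⁻ t))
      where
      case : z ≡ y ⊎ z ≡ - y → ⊥
      case (inj₁ e) = n e
      case (inj₂ e) = m e

  trichotomy : ∀ d → ind (inClass nonsquare d) ℕ.+ (ind (inClass square d) ℕ.+ ind (d ≡ᶠ 0#)) ≡ 1
  trichotomy d with d ≟ 0#
  ... | yes refl = cong₂ ℕ._+_ (ind-false λ t → not⁻ t (isSquare⁺ 0# (zeroʳ 0#))) refl
  ... | no _ with isSquare d
  ... | true  = refl
  ... | false = refl

  roots-formula : ∀ d → roots d ≡ 2 ℕ.* ind (inClass square d) ℕ.+ ind (d ≡ᶠ 0#)
  roots-formula d with d ≟ 0#
  ... | yes refl = roots-0
  ... | no d≢0 with isSquare d in e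
  ... | true  = roots-square (≢ᶠ⁺ d≢0 ∧⁺ subst T (sym e) tt)
  ... | false = roots-nonsquare (subst (λ b → T (not b)) (sym e) tt)

  card-trichotomy : ∀ (f : Carrier → Carrier) →
    card (λ x → inClass nonsquare (f x)) ℕ.+ (card (λ x → inClass square (f x)) ℕ.+ card (λ x → f x ≡ᶠ 0#)) ≡ q
  card-trichotomy f = trans (sym (trans (𝓕.∑-plus _ _) (cong (card (λ x → inClass nonsquare (f x)) ℕ.+_) (𝓕.∑-plus _ _))))
    (trans (𝓕.∑-cong λ x → trichotomy (f x)) ∑1≡q)

  -- The left side is the number of points of the curve `w² = f x`, so that a point count determines
  -- how often `f` takes nonzero square values.
  ∑-roots : ∀ (f : Carrier → Carrier) →
    𝓕.∑ (λ x → roots (f x)) ≡ 2 ℕ.* card (λ x → inClass square (f x)) ℕ.+ card (λ x → f x ≡ᶠ 0#)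
  ∑-roots f = trans (𝓕.∑-cong λ x → roots-formula (f x))
    (trans (𝓕.∑-plus _ _) (cong (ℕ._+ card (λ x → f x ≡ᶠ 0#)) (𝓕.∑-scale 2 _)))

  card-0 : card (λ x → x ≡ᶠ 0#) ≡ 1
  card-0 = 𝓕.card-point 0# (≡ᶠ⁺ refl) λ x → ≡ᶠ⁻

  -- The pairs with `z² = d` number q, since each `z` determines its `d`.
  card-square : 2 ℕ.* card (inClass square) ℕ.+ 1 ≡ q
  card-square = begin
    2 ℕ.* card (inClass square) ℕ.+ 1  ≡⟨ cong (2 ℕ.* card (inClass square) ℕ.+_) card-0 ⟨
    2 ℕ.* card (inClass square) ℕ.+ card (λ x → x ≡ᶠ 0#)  ≡⟨ ∑-roots (λ x → x) ⟨
    𝓕.∑ (λ d → 𝓕.∑ λ z → ind ((z * z) ≡ᶠ d))  ≡⟨ 𝓕.∑-swap 𝓕.additive _ ⟩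
    𝓕.∑ (λ z → 𝓕.∑ λ d → ind ((z * z) ≡ᶠ d))  ≡⟨ 𝓕.∑-cong (λ z → 𝓕.card-point (z * z) (≡ᶠ⁺ refl) λ _ e → sym (≡ᶠ⁻ e)) ⟩
    𝓕.∑ (λ _ → 1)  ≡⟨ ∑1≡q ⟩
    q  ∎
    where open ≡-Reasoning

  card-nonsquare : card (inClass nonsquare) ≡ card (inClass square)
  card-nonsquare = ℕ.+-cancelʳ-≡ (card (inClass square) ℕ.+ 1) _ _ (begin
    N ℕ.+ (S ℕ.+ 1)  ≡⟨ cong (λ k → N ℕ.+ (S ℕ.+ k)) card-0 ⟨
    N ℕ.+ (S ℕ.+ card (λ x → x ≡ᶠ 0#))  ≡⟨ card-trichotomy (λ x → x) ⟩
    q  ≡⟨ card-square ⟨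
    S ℕ.+ (S ℕ.+ 0) ℕ.+ 1  ≡⟨ cong (λ k → S ℕ.+ k ℕ.+ 1) (ℕ.+-identityʳ S) ⟩
    S ℕ.+ S ℕ.+ 1  ≡⟨ ℕ.+-assoc S S 1 ⟩
    S ℕ.+ (S ℕ.+ 1)  ∎)
    where
    open ≡-Reasoning
    N S : ℕ
    N = card (inClass nonsquare)
    S = card (inClass square)

  card-class : ∀ j → 2 ℕ.* card (inClass j) ℕ.+ 1 ≡ q
  card-class square = card-square
  card-class nonsquare = trans (cong (λ k → 2 ℕ.* k ℕ.+ 1) card-nonsquare) card-square

  -- Without nonsquares `card-class` would give `q = 1`.
  nonsquare-exists : 2 ℕ.≤ q → ∃ λ ν → T (inClass nonsquare ν)
  nonsquare-exists 2≤q with anyF (inClass nonsquare) in e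
  ... | true  = anyF⁻ _ (subst T (sym e) tt)
  ... | false = ⊥-elim (ℕ.<-irrefl (trans (cong (λ k → 2 ℕ.* k ℕ.+ 1) (sym none)) (card-class nonsquare)) 2≤q)
    where
    none : card (inClass nonsquare) ≡ 0
    none = 𝓕.card-empty λ x t → subst T e (anyF⁺ (inClass nonsquare) x t)

  -- Multiplication by a nonsquare μ maps the nonzero squares injectively into
  -- the equally many nonsquares, hence onto them.
  nonsquare-ratio : ∀ {d μ} → T (inClass nonsquare d) → T (inClass nonsquare μ) → ∃ λ k → k ≢ 0# × d ≡ k * k * μ
  nonsquare-ratio {d} {μ} d∈ μ∈ = k , k≢0 , d≡
    where
    open ≡-Reasoning
    μ≢0 : μ ≢ 0#
    μ≢0 = inClass⇒≢0 nonsquare μ∈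
    i : Carrier
    i = proj₁ (inverse μ μ≢0)
    μi : μ * i ≡ 1#
    μi = proj₂ (inverse μ μ≢0)
    unscale : ∀ x → x * μ * i ≡ x
    unscale x = trans (*-assoc x μ i) (trans (cong (x *_) μi) (*-identityʳ x))
    unscale′ : ∀ x → x * i * μ ≡ x
    unscale′ x = trans (by-ring 3 (λ x i m → x :* i :* m , x :* (m :* i)) refl x i μ) (trans (cong (x *_) μi) (*-identityʳ x))
    -- If `e = w²` and `e μ = y²`, then `μ = (y / w)²` would be a square.
    ⊆ : ∀ e → T (inClass square (e * μ)) → T (inClass nonsquare e)
    ⊆ e t = not⁺ λ s →
      let y , y≢0 , y² = square⁻ t
          w , w² = isSquare⁻ s
          w≢0 = λ w≡0 → inClass⇒≢0 square t (x≡0⇒xy≡0 μ (trans (sym w²) (x≡0⇒xy≡0 w w≡0)))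
          v , wv = inverse w w≢0
      in not⁻ μ∈ (isSquare⁺ (y * v) (begin
        y * v * (y * v)  ≡⟨ by-ring 2 (λ y v → y :* v :* (y :* v) , y :* y :* (v :* v)) refl y v ⟩
        y * y * (v * v)  ≡⟨ cong (_* (v * v)) (trans y² (cong (_* μ) (sym w²))) ⟩
        w * w * μ * (v * v)  ≡⟨ by-ring 3 (λ w m v → w :* w :* m :* (v :* v) , w :* v :* (w :* v) :* m) refl w μ v ⟩
        w * v * (w * v) * μ  ≡⟨ cong (λ z → z * z * μ) wv ⟩
        1# * 1# * μ  ≡⟨ by-ring 1 (λ m → :1 :* :1 :* m , m) refl μ ⟩
        μ  ∎))
    count : card (λ e → inClass square (e * μ)) ≡ card (inClass nonsquare)
    count = trans (card-bijection 𝓕 𝓕 (λ e e′ → e′ ≡ᶠ (e * μ))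
        (λ e t → e * μ , t , ≡ᶠ⁺ refl , λ _ _ r → ≡ᶠ⁻ r)
        (λ e t → e * i , subst (λ x → T (inClass square x)) (sym (unscale′ e)) t , ≡ᶠ⁺ (sym (unscale′ e)) ,
          λ e′ _ r → trans (sym (unscale e′)) (cong (_* i) (sym (≡ᶠ⁻ r)))))
      (sym card-nonsquare)
    dμ∈ : T (inClass square (d * μ))
    dμ∈ = 𝓕.⊆∧card≡⇒⊇ {λ e → inClass square (e * μ)} ⊆ count d d∈
    -- With `y² = d μ`, the quotient `k = y / μ` satisfies `k² μ = d`.
    y k : Carrier
    y = proj₁ (square⁻ dμ∈)
    k = y * i
    k≢0 : k ≢ 0#
    k≢0 = *-nonzero (proj₁ (proj₂ (square⁻ dμ∈))) (inverse-nonzero μi)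
    d≡ : d ≡ k * k * μ
    d≡ = sym (begin
      y * i * (y * i) * μ  ≡⟨ by-ring 3 (λ y i m → y :* i :* (y :* i) :* m , y :* y :* i :* (m :* i)) refl y i μ ⟩
      y * y * i * (μ * i)  ≡⟨ cong₂ (λ a b → a * i * b) (proj₂ (proj₂ (square⁻ dμ∈))) μi ⟩
      d * μ * i * 1#  ≡⟨ trans (*-identityʳ _) (unscale d) ⟩
      d  ∎)

  -- On `z² - w² = d` the factor `x = z - w` is nonzero and determines the other factor
  -- `z + w = d / x`. As 2 is invertible, `x` determines the point, so the points correspond to the
  -- nonzero `x`; the added 1 accounts for `x = 0`.
  hyperbola : ∀ {d} → d ≢ 0# → 𝓕.∑ (λ z → roots (z * z - d)) ℕ.+ 1 ≡ q
  hyperbola {d} d≢0 = begin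
    𝓕𝓕.card onHyperbola ℕ.+ 1  ≡⟨ ℕ.+-comm _ 1 ⟩
    1 ℕ.+ 𝓕𝓕.card onHyperbola  ≡⟨ cong₂ ℕ._+_ (sym card-0) param ⟩
    card (λ x → x ≡ᶠ 0#) ℕ.+ card (λ x → not (x ≡ᶠ 0#))  ≡⟨ 𝓕.card-complement (λ x → x ≡ᶠ 0#) ⟩
    𝓕.∑ (λ _ → 1)  ≡⟨ ∑1≡q ⟩
    q  ∎
    where
    open ≡-Reasoning
    module 𝓕𝓕 = Summation (𝓕 ×-summation 𝓕)
    onHyperbola : Carrier × Carrier → Bool
    onHyperbola (z , w) = (w * w) ≡ᶠ (z * z - d)
    ½ : Carrier
    ½ = proj₁ (inverse 2# 2≢0)
    2½ : 2# * ½ ≡ 1#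
    2½ = proj₂ (inverse 2# 2≢0)
    factor : ∀ {z w} → w * w ≡ z * z - d → (z - w) * (z + w) ≡ d
    factor {z} {w} e = begin
      (z - w) * (z + w)  ≡⟨ by-ring 2 (λ z w → (z :- w) :* (z :+ w) , z :* z :- w :* w) refl z w ⟩
      z * z - w * w  ≡⟨ cong (λ y → z * z - y) e ⟩
      z * z - (z * z - d)  ≡⟨ by-ring 2 (λ z d → z :* z :- (z :* z :- d) , d) refl z d ⟩
      d  ∎
    double : ∀ {x y} → 2# * x ≡ 2# * y → x ≡ y
    double = *-cancelˡ 2≢0
    halve : ∀ x → 2# * (½ * x) ≡ x
    halve = inverse-cancelʳ 2½
    param : 𝓕𝓕.card onHyperbola ≡ card (λ x → not (x ≡ᶠ 0#))
    param = card-bijection (𝓕 ×-summation 𝓕) 𝓕 (λ (z , w) x → x ≡ᶠ (z - w))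
      (λ (z , w) t → z - w , ≢ᶠ⁺ (λ e → d≢0 (begin
          d  ≡⟨ factor (≡ᶠ⁻ t) ⟨
          (z - w) * (z + w)  ≡⟨ cong (_* (z + w)) e ⟩
          0# * (z + w)  ≡⟨ zeroˡ _ ⟩
          0#  ∎)) , ≡ᶠ⁺ refl , λ _ _ e → ≡ᶠ⁻ e)
      back
      where
      back : ∀ x → T (not (x ≡ᶠ 0#)) → Σ (Carrier × Carrier) λ zw →
        T (onHyperbola zw) × T (x ≡ᶠ (proj₁ zw - proj₂ zw)) ×
        (∀ zw′ → T (onHyperbola zw′) → T (x ≡ᶠ (proj₁ zw′ - proj₂ zw′)) → zw′ ≡ zw)
      back x x≢0 = (z , w) , ≡ᶠ⁺ eqn , ≡ᶠ⁺ diff , unique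
        where
        y z w : Carrier
        y = d * proj₁ (inverse x (≢ᶠ⁻ x≢0))
        z = ½ * (y + x)
        w = ½ * (y - x)
        xy : x * y ≡ d
        xy = trans (by-ring 3 (λ x d i → x :* (d :* i) , d :* (x :* i)) refl x d _)
          (trans (cong (d *_) (proj₂ (inverse x (≢ᶠ⁻ x≢0)))) (*-identityʳ d))
        diff : x ≡ z - w
        diff = trans (sym (halve x)) (by-ring 3 (λ h x y → :2 :* (h :* x) , h :* (y :+ x) :- h :* (y :- x)) refl ½ x y)
        eqn : w * w ≡ z * z - d
        eqn = begin
          w * w  ≡⟨ by-ring 3 (λ h x y → h :* (y :- x) :* (h :* (y :- x)) , h :* (y :+ x) :* (h :* (y :+ x)) :- :2 :* h :* (:2 :* h) :* (x :* y)) refl ½ x y ⟩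
          z * z - 2# * ½ * (2# * ½) * (x * y)  ≡⟨ cong₂ (λ a b → z * z - a * a * b) 2½ xy ⟩
          z * z - 1# * 1# * d  ≡⟨ by-ring 2 (λ z d → z :* z :- :1 :* :1 :* d , z :* z :- d) refl z d ⟩
          z * z - d  ∎
        unique : ∀ zw′ → T (onHyperbola zw′) → T (x ≡ᶠ (proj₁ zw′ - proj₂ zw′)) → zw′ ≡ (z , w)
        unique (z′ , w′) t e = cong₂ _,_
          (double (begin
            2# * z′  ≡⟨ by-ring 2 (λ z w → :2 :* z , (z :+ w) :+ (z :- w)) refl z′ w′ ⟩
            z′ + w′ + (z′ - w′)  ≡⟨ cong₂ _+_ y′ (sym x≡) ⟩
            y + x  ≡⟨ halve (y + x) ⟨
            2# * z  ∎))
          (double (begin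
            2# * w′  ≡⟨ by-ring 2 (λ z w → :2 :* w , (z :+ w) :- (z :- w)) refl z′ w′ ⟩
            z′ + w′ - (z′ - w′)  ≡⟨ cong₂ _-_ y′ (sym x≡) ⟩
            y - x  ≡⟨ halve (y - x) ⟨
            2# * w  ∎))
          where
          x≡ : x ≡ z′ - w′
          x≡ = ≡ᶠ⁻ e
          y′ : z′ + w′ ≡ y
          y′ = *-cancelˡ (≢ᶠ⁻ x≢0) (trans (cong (_* (z′ + w′)) x≡) (trans (factor (≡ᶠ⁻ t)) (sym xy)))

  shifted : Class → Carrier → ℕ
  shifted j d = card λ z → inClass j (z * z - d)

  card-shift-0 : ∀ d → card (λ z → (z * z - d) ≡ᶠ 0#) ≡ roots d
  card-shift-0 d = 𝓕.card-cong (λ z t → ≡ᶠ⁺ (-≡0⇒≡ (≡ᶠ⁻ t))) (λ z t → ≡ᶠ⁺ (≡⇒-≡0 (≡ᶠ⁻ t)))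

  -- The fibre of the hyperbola over `z` has `roots (z * z - d)` points: two where the value is a
  -- nonzero square, one where it is zero, and the zeros of `z² - d` number `roots d`.
  shifted-square : ∀ {d} → d ≢ 0# → 2 ℕ.* shifted square d ℕ.+ roots d ℕ.+ 1 ≡ q
  shifted-square {d} d≢0 = trans (cong (ℕ._+ 1) (trans (cong (2 ℕ.* shifted square d ℕ.+_) (sym (card-shift-0 d)))
    (sym (∑-roots (λ z → z * z - d))))) (hyperbola d≢0)

  shifted-sum : ∀ d → shifted nonsquare d ℕ.+ (shifted square d ℕ.+ roots d) ≡ q
  shifted-sum d = trans (cong (λ k → shifted nonsquare d ℕ.+ (shifted square d ℕ.+ k)) (sym (card-shift-0 d)))
    (card-trichotomy (λ z → z * z - d))

  shifted-nonsquare-0 : shifted nonsquare 0# ≡ 0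
  shifted-nonsquare-0 = 𝓕.card-empty λ z t → not⁻ t (isSquare⁺ z (by-ring 1 (λ z → z :* z , z :* z :- :0) refl z))

  shifted-square-0 : shifted square 0# ℕ.+ 1 ≡ q
  shifted-square-0 = begin
    shifted square 0# ℕ.+ 1  ≡⟨ cong (shifted square 0# ℕ.+_) roots-0 ⟨
    shifted square 0# ℕ.+ roots 0#  ≡⟨ cong (ℕ._+ (shifted square 0# ℕ.+ roots 0#)) shifted-nonsquare-0 ⟨
    shifted nonsquare 0# ℕ.+ (shifted square 0# ℕ.+ roots 0#)  ≡⟨ shifted-sum 0# ⟩
    q  ∎
    where open ≡-Reasoning

-- Linear algebra of points, planes and lines.

∀₄ : ∀ {P : Fin 4 → Set} → P zero → P 1F → P 2F → P 3F → ∀ i → P i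
∀₄ a b c d zero = a
∀₄ a b c d 1F = b
∀₄ a b c d 2F = c
∀₄ a b c d 3F = d

first : ∀ {n} {P : Fin n → Set} → (∀ i → Dec (P i)) →
        (∀ i → ¬ P i) ⊎ ∃ λ i → P i × (∀ k → k Fin.< i → ¬ P k)
first {zero} P? = inj₁ λ ()
first {suc n} P? with P? zero
... | yes p = inj₂ (zero , p , λ k ())
... | no ¬p with first (P? ∘ suc)
... | inj₁ none = inj₁ λ { zero → ¬p ; (suc i) → none i }
... | inj₂ (i , p , before) = inj₂ (suc i , p , λ { zero _ → ¬p ; (suc k) (ℕ.s≤s k<i) → before k k<i })

module LinearAlgebra {q : ℕ} (𝔽 : FiniteField q) where
  open FieldTheory 𝔽

  infix 4 _≐_ _∝_

  -- Vectors are functions, so pointwise equality is used wherever vectors are compared.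
  _≐_ : V → V → Set
  u ≐ v = ∀ i → u i ≡ v i

  _∝_ : V → V → Set
  x ∝ y = ∃ λ k → k ≢ 0# × x ≐ k ⊛ y

  Span : V → V → V → Set
  Span a b w = ∃₂ λ l m → w ≐ (l ⊛ a) ⊕ (m ⊛ b)

  Sub : V → V → V → V → Set
  Sub a b u v = Span a b u × Span a b v

  Indep : V → V → Set
  Indep u v = ∀ l m → (l ⊛ u) ⊕ (m ⊛ v) ≐ zeroV → l ≡ 0# × m ≡ 0#

  Same : V → V → V → V → Set
  Same a b u v = Indep a b × Indep u v × Sub a b u v × Sub u v a b

  ≡ᵛ⁺ : ∀ {u v} → u ≐ v → T (u ≡ᵛ v)
  ≡ᵛ⁺ e = T-all⁺ _ λ i → ≡ᶠ⁺ (e i)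

  ≡ᵛ⁻ : ∀ {u v} → T (u ≡ᵛ v) → u ≐ v
  ≡ᵛ⁻ {u} {v} t i = ≡ᶠ⁻ (T-all⁻ (λ i → u i ≡ᶠ v i) t i)

  projEq⁺ : ∀ {x y} → x ∝ y → T (projEq x y)
  projEq⁺ {x} {y} (k , k≢0 , e) = anyF⁺ (λ k → not (k ≡ᶠ 0#) ∧ (x ≡ᵛ (k ⊛ y))) k (≢ᶠ⁺ k≢0 ∧⁺ ≡ᵛ⁺ e)

  projEq⁻ : ∀ {x y} → T (projEq x y) → x ∝ y
  projEq⁻ {x} {y} t =
    let k , u = anyF⁻ (λ k → not (k ≡ᶠ 0#) ∧ (x ≡ᵛ (k ⊛ y))) t
        k≢0 , e = ∧⁻ {not (k ≡ᶠ 0#)} u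
    in k , ≢ᶠ⁻ k≢0 , ≡ᵛ⁻ e

  inSpan⁺ : ∀ {a b w} → Span a b w → T (inSpan a b w)
  inSpan⁺ {a} {b} {w} (l , m , e) = anyF⁺ (λ l → anyF λ m → w ≡ᵛ ((l ⊛ a) ⊕ (m ⊛ b))) l
    (anyF⁺ (λ m → w ≡ᵛ ((l ⊛ a) ⊕ (m ⊛ b))) m (≡ᵛ⁺ e))

  inSpan⁻ : ∀ {a b w} → T (inSpan a b w) → Span a b w
  inSpan⁻ {a} {b} {w} t =
    let l , u = anyF⁻ (λ l → anyF λ m → w ≡ᵛ ((l ⊛ a) ⊕ (m ⊛ b))) t
        m , e = anyF⁻ (λ m → w ≡ᵛ ((l ⊛ a) ⊕ (m ⊛ b))) u
    in l , m , ≡ᵛ⁻ e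

  private
    dependency : V → V → Carrier → Carrier → Bool
    dependency a b l m = not ((l ≡ᶠ 0#) ∧ (m ≡ᶠ 0#)) ∧ (((l ⊛ a) ⊕ (m ⊛ b)) ≡ᵛ zeroV)

  indep⁺ : ∀ {a b} → Indep a b → T (indep a b)
  indep⁺ {a} {b} ab = not⁺ λ t →
    let l , u = anyF⁻ (λ l → anyF (dependency a b l)) t
        m , d = anyF⁻ (dependency a b l) u
        n , e = ∧⁻ {not ((l ≡ᶠ 0#) ∧ (m ≡ᶠ 0#))} d
        l≡0 , m≡0 = ab l m (≡ᵛ⁻ e)
    in not⁻ n (≡ᶠ⁺ l≡0 ∧⁺ ≡ᶠ⁺ m≡0)

  indep⁻ : ∀ {a b} → T (indep a b) → Indep a b
  indep⁻ {a} {b} t l m e with l ≟ 0# | m ≟ 0#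
  ... | yes l≡0 | yes m≡0 = l≡0 , m≡0
  ... | yes _   | no m≢0  = ⊥-elim (not⁻ t (anyF⁺ (λ l → anyF (dependency a b l)) l (anyF⁺ (dependency a b l) m
                              (not⁺ (λ z → m≢0 (≡ᶠ⁻ (proj₂ (∧⁻ {l ≡ᶠ 0#} z)))) ∧⁺ ≡ᵛ⁺ e))))
  ... | no l≢0  | _       = ⊥-elim (not⁻ t (anyF⁺ (λ l → anyF (dependency a b l)) l (anyF⁺ (dependency a b l) m
                              (not⁺ (λ z → l≢0 (≡ᶠ⁻ (proj₁ (∧⁻ {l ≡ᶠ 0#} z)))) ∧⁺ ≡ᵛ⁺ e))))

  sameLine⁺ : ∀ {a b u v} → Same a b u v → T (sameLine a b u v)
  sameLine⁺ (ab , uv , (au , av) , (ua , ub)) =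
    indep⁺ ab ∧⁺ indep⁺ uv ∧⁺ inSpan⁺ au ∧⁺ inSpan⁺ av ∧⁺ inSpan⁺ ua ∧⁺ inSpan⁺ ub

  sameLine⁻ : ∀ {a b u v} → T (sameLine a b u v) → Same a b u v
  sameLine⁻ {a} {b} {u} {v} t =
    let ab , t₁ = ∧⁻ {indep a b} t
        uv , t₂ = ∧⁻ {indep u v} t₁
        au , t₃ = ∧⁻ {inSpan a b u} t₂
        av , t₄ = ∧⁻ {inSpan a b v} t₃
        ua , ub = ∧⁻ {inSpan u v a} t₄
    in indep⁻ ab , indep⁻ uv , (inSpan⁻ au , inSpan⁻ av) , (inSpan⁻ ua , inSpan⁻ ub)

  Contains : V → V → V → Set
  Contains c u v = c · u ≡ 0# × c · v ≡ 0#

  lineInPlane⁺ : ∀ {c u v} → Contains c u v → T (lineInPlane c u v)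
  lineInPlane⁺ (cu , cv) = ≡ᶠ⁺ cu ∧⁺ ≡ᶠ⁺ cv

  lineInPlane⁻ : ∀ {c u v} → T (lineInPlane c u v) → Contains c u v
  lineInPlane⁻ {c} {u} t = let cu , cv = ∧⁻ {onPlane c u} t in ≡ᶠ⁻ cu , ≡ᶠ⁻ cv

  sum4-cong : ∀ {f g : V} → f ≐ g → sum4 f ≡ sum4 g
  sum4-cong e = cong₂ _+_ (e _) (cong₂ _+_ (e _) (cong₂ _+_ (e _) (e _)))

  ·-congʳ : ∀ c {x y} → x ≐ y → c · x ≡ c · y
  ·-congʳ c e = sum4-cong λ i → cong (c i *_) (e i)

  ·-congˡ : ∀ {c d} x → c ≐ d → c · x ≡ d · x
  ·-congˡ x e = sum4-cong λ i → cong (_* x i) (e i)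

  ·-linearʳ : ∀ c l x m y → c · ((l ⊛ x) ⊕ (m ⊛ y)) ≡ l * (c · x) + m * (c · y)
  ·-linearʳ c l x m y = by-ring 14 (λ c₀ c₁ c₂ c₃ l x₀ x₁ x₂ x₃ m y₀ y₁ y₂ y₃ →
      c₀ :* (l :* x₀ :+ m :* y₀) :+ (c₁ :* (l :* x₁ :+ m :* y₁) :+ (c₂ :* (l :* x₂ :+ m :* y₂) :+ c₃ :* (l :* x₃ :+ m :* y₃))) ,
      l :* (c₀ :* x₀ :+ (c₁ :* x₁ :+ (c₂ :* x₂ :+ c₃ :* x₃))) :+ m :* (c₀ :* y₀ :+ (c₁ :* y₁ :+ (c₂ :* y₂ :+ c₃ :* y₃)))) refl
    (c _) (c _) (c _) (c _) l (x _) (x _) (x _) (x _) m (y _) (y _) (y _) (y _)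

  ·-scaleʳ : ∀ c l x → c · (l ⊛ x) ≡ l * (c · x)
  ·-scaleʳ c l x = by-ring 9 (λ c₀ c₁ c₂ c₃ l x₀ x₁ x₂ x₃ →
      c₀ :* (l :* x₀) :+ (c₁ :* (l :* x₁) :+ (c₂ :* (l :* x₂) :+ c₃ :* (l :* x₃))) ,
      l :* (c₀ :* x₀ :+ (c₁ :* x₁ :+ (c₂ :* x₂ :+ c₃ :* x₃)))) refl
    (c _) (c _) (c _) (c _) l (x _) (x _) (x _) (x _)

  ·-comm : ∀ c x → c · x ≡ x · c
  ·-comm c x = sum4-cong {λ i → c i * x i} λ i → *-comm (c i) (x i)

  ·-scaleˡ : ∀ l c x → (l ⊛ c) · x ≡ l * (c · x)
  ·-scaleˡ l c x = trans (·-comm (l ⊛ c) x) (trans (·-scaleʳ x l c) (cong (l *_) (·-comm x c)))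

  zero-· : ∀ x → zeroV · x ≡ 0#
  zero-· x = by-ring 4 (λ a b c d → :0 :* a :+ (:0 :* b :+ (:0 :* c :+ :0 :* d)) , :0) refl (x 0F) (x 1F) (x 2F) (x 3F)

  -- Planes are covectors and transform contravariantly: this is the composite of the functional `c`
  -- with `M`, so its points are those that `M` maps into the plane `c`.
  pull : V → Mat → V
  pull c M j = sum4 λ i → c i * M i j

  pull-· : ∀ c M x → pull c M · x ≡ c · apply M x
  pull-· c M x = begin
    sum4 (λ j → sum4 (λ i → c i * M i j) * x j)  ≡⟨ sum4-cong {λ j → pull c M j * x j} {λ j → sum4 λ i → c i * (M i j * x j)} (λ j → distribute (λ i → c i) (λ i → M i j) (x j)) ⟩
    sum4 (λ j → sum4 (λ i → c i * (M i j * x j)))  ≡⟨ exchange (λ i j → c i * (M i j * x j)) ⟩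
    sum4 (λ i → sum4 (λ j → c i * (M i j * x j)))  ≡⟨ sum4-cong {λ i → sum4 λ j → c i * (M i j * x j)} (λ i → factor (c i) (λ j → M i j * x j)) ⟩
    sum4 (λ i → c i * sum4 (λ j → M i j * x j))  ∎
    where
    open ≡-Reasoning
    distribute : ∀ c m x → sum4 (λ i → c i * m i) * x ≡ sum4 (λ i → c i * (m i * x))
    distribute c m x = by-ring 9 (λ a b c d e f g h x →
      (a :* e :+ (b :* f :+ (c :* g :+ d :* h))) :* x ,
      a :* (e :* x) :+ (b :* (f :* x) :+ (c :* (g :* x) :+ d :* (h :* x)))) refl
      (c _) (c _) (c _) (c _) (m _) (m _) (m _) (m _) x
    factor : ∀ k f → sum4 (λ j → k * f j) ≡ k * sum4 f
    factor k f = by-ring 5 (λ k a b c d → k :* a :+ (k :* b :+ (k :* c :+ k :* d)) , k :* (a :+ (b :+ (c :+ d)))) refl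
      k (f _) (f _) (f _) (f _)
    plus : ∀ f g → sum4 (λ j → f j + g j) ≡ sum4 f + sum4 g
    plus f g = by-ring 8 (λ a b c d e f g h →
      (a :+ e) :+ ((b :+ f) :+ ((c :+ g) :+ (d :+ h))) , (a :+ (b :+ (c :+ d))) :+ (e :+ (f :+ (g :+ h)))) refl
      (f _) (f _) (f _) (f _) (g _) (g _) (g _) (g _)
    exchange : ∀ (f : Mat) → sum4 (λ j → sum4 (λ i → f i j)) ≡ sum4 (λ i → sum4 (λ j → f i j))
    exchange f = trans (plus f₀ (λ j → f₁ j + (f₂ j + f₃ j))) (cong (sum4 f₀ +_)
      (trans (plus f₁ (λ j → f₂ j + f₃ j)) (cong (sum4 f₁ +_) (plus f₂ f₃))))
      where
      f₀ f₁ f₂ f₃ : V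
      f₀ = f zero
      f₁ = f 1F
      f₂ = f 2F
      f₃ = f 3F

  pull-zero : ∀ c M → c ≐ zeroV → pull c M ≐ zeroV
  pull-zero c M e j = trans (·-congˡ (λ i → M i j) e) (zero-· λ i → M i j)

  apply-cong : ∀ M {x y} → x ≐ y → apply M x ≐ apply M y
  apply-cong M e i = ·-congʳ (M i) e

  apply-linear : ∀ M l x m y → apply M ((l ⊛ x) ⊕ (m ⊛ y)) ≐ (l ⊛ apply M x) ⊕ (m ⊛ apply M y)
  apply-linear M l x m y i = ·-linearʳ (M i) l x m y

  apply-scale : ∀ M l x → apply M (l ⊛ x) ≐ l ⊛ apply M x
  apply-scale M l x i = ·-scaleʳ (M i) l x

  apply-∙ : ∀ M N x → apply (M ∙ N) x ≐ apply M (apply N x)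
  apply-∙ M N x i = pull-· (M i) N x

  apply-idMat : ∀ x → apply idMat x ≐ x
  apply-idMat x = ∀₄
    (by-ring 4 (λ a b c d → :1 :* a :+ (:0 :* b :+ (:0 :* c :+ :0 :* d)) , a) refl (x _) (x _) (x _) (x _))
    (by-ring 4 (λ a b c d → :0 :* a :+ (:1 :* b :+ (:0 :* c :+ :0 :* d)) , b) refl (x _) (x _) (x _) (x _))
    (by-ring 4 (λ a b c d → :0 :* a :+ (:0 :* b :+ (:1 :* c :+ :0 :* d)) , c) refl (x _) (x _) (x _) (x _))
    (by-ring 4 (λ a b c d → :0 :* a :+ (:0 :* b :+ (:0 :* c :+ :1 :* d)) , d) refl (x _) (x _) (x _) (x _))

  combine : ∀ l m l₁ m₁ l₂ m₂ a b → l * (l₁ * a + m₁ * b) + m * (l₂ * a + m₂ * b) ≡ (l * l₁ + m * l₂) * a + (l * m₁ + m * m₂) * b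
  combine = by-ring 8 (λ l m l₁ m₁ l₂ m₂ a b →
    l :* (l₁ :* a :+ m₁ :* b) :+ m :* (l₂ :* a :+ m₂ :* b) , (l :* l₁ :+ m :* l₂) :* a :+ (l :* m₁ :+ m :* m₂) :* b) refl

  span-trans : ∀ {a b u v w} → Span u v w → Sub a b u v → Span a b w
  span-trans {a} {b} (l , m , e) ((l₁ , m₁ , e₁) , (l₂ , m₂ , e₂)) =
    l * l₁ + m * l₂ , l * m₁ + m * m₂ , λ i →
      trans (e i) (trans (cong₂ (λ x y → l * x + m * y) (e₁ i) (e₂ i)) (combine l m l₁ m₁ l₂ m₂ (a i) (b i)))

  span-respˡ : ∀ {a b w w′} → w ≐ w′ → Span a b w′ → Span a b w
  span-respˡ e (l , m , f) = l , m , λ i → trans (e i) (f i)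

  sub-trans : ∀ {a b u v x y} → Sub a b u v → Sub u v x y → Sub a b x y
  sub-trans s (x , y) = span-trans x s , span-trans y s

  span-fst : ∀ {a b} → Span a b a
  span-fst {a} {b} = 1# , 0# , λ i → by-ring 2 (λ a b → a , :1 :* a :+ :0 :* b) refl (a i) (b i)

  span-snd : ∀ {a b} → Span a b b
  span-snd {a} {b} = 0# , 1# , λ i → by-ring 2 (λ a b → b , :0 :* a :+ :1 :* b) refl (a i) (b i)

  span-⊛ : ∀ {a b w} k → Span a b w → Span a b (k ⊛ w)
  span-⊛ {a} {b} k (l , m , e) = k * l , k * m , λ i → trans (cong (k *_) (e i))
    (by-ring 5 (λ i l a m b → i :* (l :* a :+ m :* b) , i :* l :* a :+ i :* m :* b) refl k l (a i) m (b i))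

  span-apply : ∀ M {u v w} → Span u v w → Span (apply M u) (apply M v) (apply M w)
  span-apply M {u} {v} (l , m , e) = l , m , λ i → trans (apply-cong M e i) (apply-linear M l u m v i)

  sub-apply : ∀ M {u v x y} → Sub u v x y → Sub (apply M u) (apply M v) (apply M x) (apply M y)
  sub-apply M (x , y) = span-apply M x , span-apply M y

  contains-span : ∀ c {u v w} → Contains c u v → Span u v w → c · w ≡ 0#
  contains-span c {u} {v} {w} (cu , cv) (l , m , e) = begin
    c · w  ≡⟨ ·-congʳ c e ⟩
    c · ((l ⊛ u) ⊕ (m ⊛ v))  ≡⟨ ·-linearʳ c l u m v ⟩
    l * (c · u) + m * (c · v)  ≡⟨ cong₂ (λ x y → l * x + m * y) cu cv ⟩
    l * 0# + m * 0#  ≡⟨ by-ring 2 (λ l m → l :* :0 :+ m :* :0 , :0) refl l m ⟩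
    0#  ∎
    where open ≡-Reasoning

  contains-sub : ∀ c {u v x y} → Contains c u v → Sub u v x y → Contains c x y
  contains-sub c cuv (x , y) = contains-span c cuv x , contains-span c cuv y

  -- Independent vectors in the span of u′, v′ are a basis of it: their coefficient determinant is invertible.
  same-by-indep : ∀ {u v u′ v′} → Indep u v → Sub u′ v′ u v → Same u v u′ v′
  same-by-indep {u} {v} {u′} {v′} uv sub@((a , b , eu) , (c , d , ev)) = uv , u′v′ , (u′∈ , v′∈) , sub
    where
    open ≡-Reasoning
    Δ : Carrier
    Δ = a * d - b * c
    eliminate : ∀ x y i → x * u i + y * v i ≡ (x * a + y * c) * u′ i + (x * b + y * d) * v′ i
    eliminate x y i = trans (cong₂ (λ s t → x * s + y * t) (eu i) (ev i)) (combine x y a b c d (u′ i) (v′ i))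
    Δu′ : ∀ i → d * u i + - b * v i ≡ Δ * u′ i
    Δu′ i = trans (eliminate d (- b) i)
      (by-ring 6 (λ a b c d u v → (d :* a :+ :- b :* c) :* u :+ (d :* b :+ :- b :* d) :* v , (a :* d :- b :* c) :* u) refl a b c d (u′ i) (v′ i))
    Δv′ : ∀ i → - c * u i + a * v i ≡ Δ * v′ i
    Δv′ i = trans (eliminate (- c) a i)
      (by-ring 6 (λ a b c d u v → (:- c :* a :+ a :* c) :* u :+ (:- c :* b :+ a :* d) :* v , (a :* d :- b :* c) :* v) refl a b c d (u′ i) (v′ i))
    -- If the determinant vanished, `Δu′` and `Δv′` would be linear relations between `u` and `v`.
    -- Independence makes their coefficients zero, so `a = b = 0` and hence `u = 0`, against
    -- independence.
    Δ≢0 : Δ ≢ 0#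
    Δ≢0 Δ≡0 = 1≢0 (proj₁ (uv 1# 0# λ i → begin
      1# * u i + 0# * v i  ≡⟨ by-ring 2 (λ u v → :1 :* u :+ :0 :* v , u) refl (u i) (v i) ⟩
      u i  ≡⟨ eu i ⟩
      a * u′ i + b * v′ i  ≡⟨ cong₂ (λ a b → a * u′ i + b * v′ i) a≡0 b≡0 ⟩
      0# * u′ i + 0# * v′ i  ≡⟨ by-ring 2 (λ a c → :0 :* a :+ :0 :* c , :0) refl (u′ i) (v′ i) ⟩
      0#  ∎))
      where
      a≡0 : a ≡ 0#
      a≡0 = proj₂ (uv (- c) a λ i → trans (Δv′ i) (x≡0⇒xy≡0 (v′ i) Δ≡0))
      b≡0 : b ≡ 0#
      b≡0 = trans (by-ring 1 (λ b → b , :- (:- b)) refl b)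
        (trans (cong -_ (proj₂ (uv d (- b) λ i → trans (Δu′ i) (x≡0⇒xy≡0 (u′ i) Δ≡0)))) (by-ring 0 (:- :0 , :0) refl))
    ι : Carrier
    ι = proj₁ (inverse Δ Δ≢0)
    invert : ∀ x y {s t z} → x * s + y * t ≡ Δ * z → z ≡ ι * x * s + ι * y * t
    invert x y {s} {t} {z} e = begin
      z  ≡⟨ inverse-cancelˡ (proj₂ (inverse Δ Δ≢0)) z ⟨
      ι * (Δ * z)  ≡⟨ cong (ι *_) e ⟨
      ι * (x * s + y * t)  ≡⟨ by-ring 5 (λ i x y s t → i :* (x :* s :+ y :* t) , i :* x :* s :+ i :* y :* t) refl ι x y s t ⟩
      ι * x * s + ι * y * t  ∎
    u′∈ : Span u v u′
    u′∈ = ι * d , ι * - b , λ i → invert d (- b) (Δu′ i)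
    v′∈ : Span u v v′
    v′∈ = ι * - c , ι * a , λ i → invert (- c) a (Δv′ i)
    u′v′ : Indep u′ v′
    u′v′ l m e = cancel (by-ring 6 (λ l m a b c d → (l :* d :- m :* c) :* a :+ (m :* a :- l :* b) :* c , (a :* d :- b :* c) :* l) refl l m a b c d)
               , cancel (by-ring 6 (λ l m a b c d → (l :* d :- m :* c) :* b :+ (m :* a :- l :* b) :* d , (a :* d :- b :* c) :* m) refl l m a b c d)
      where
      xy : l * d - m * c ≡ 0# × m * a - l * b ≡ 0#
      xy = uv _ _ λ i → begin
        (l * d - m * c) * u i + (m * a - l * b) * v i  ≡⟨ by-ring 8 (λ l m a b c d u v → (l :* d :- m :* c) :* u :+ (m :* a :- l :* b) :* v ,
                                                                l :* (d :* u :+ :- b :* v) :+ m :* (:- c :* u :+ a :* v)) refl l m a b c d (u i) (v i) ⟩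
        l * (d * u i + - b * v i) + m * (- c * u i + a * v i) ≡⟨ cong₂ (λ s t → l * s + m * t) (Δu′ i) (Δv′ i) ⟩
        l * (Δ * u′ i) + m * (Δ * v′ i)  ≡⟨ by-ring 5 (λ l m D u v → l :* (D :* u) :+ m :* (D :* v) , D :* (l :* u :+ m :* v)) refl l m Δ (u′ i) (v′ i) ⟩
        Δ * (l * u′ i + m * v′ i)  ≡⟨ cong (Δ *_) (e i) ⟩
        Δ * 0#  ≡⟨ zeroʳ Δ ⟩
        0#  ∎
      cancel : ∀ {s t z} → (l * d - m * c) * s + (m * a - l * b) * t ≡ Δ * z → z ≡ 0#
      cancel {s} {t} {z} h = *-cancel-0 Δ≢0 (trans (sym h) (trans (cong₂ (λ x y → x * s + y * t) (proj₁ xy) (proj₂ xy))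
        (by-ring 2 (λ s t → :0 :* s :+ :0 :* t , :0) refl s t)))

  same-sym : ∀ {a b u v} → Same a b u v → Same u v a b
  same-sym (ab , uv , s , t) = uv , ab , t , s

  same-trans : ∀ {a b u v x y} → Same a b u v → Same u v x y → Same a b x y
  same-trans (ab , _ , s , t) (_ , xy , s′ , t′) = ab , xy , sub-trans s s′ , sub-trans t′ t

  same-swap : ∀ {u v} → Indep u v → Same u v v u
  same-swap uv = same-by-indep uv (span-snd , span-fst)

-- Canonical representatives of planes and lines.

module CanonicalForms {q : ℕ} (𝔽 : FiniteField q) where
  open FieldTheory 𝔽
  open LinearAlgebra 𝔽

  record Normalized (c : V) : Set where
    constructor normal
    field
      pivot  : Fin 4
      is-1   : c pivot ≡ 1#
      before : ∀ k → k Fin.< pivot → c k ≡ 0#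

  normalized⁺ : ∀ {c} → Normalized c → T (normalized c)
  normalized⁺ {c} (normal i e b) with c zero ≟ 0# | c (suc zero) ≟ 0# | c (suc (suc zero)) ≟ 0#
  normalized⁺ (normal zero e b) | no _  | _ | _ = ≡ᶠ⁺ e
  normalized⁺ (normal zero e b) | yes z | _ | _ = ⊥-elim (1≢0 (trans (sym e) z))
  normalized⁺ (normal (suc i) e b) | no n | _ | _ = ⊥-elim (n (b zero (ℕ.s≤s ℕ.z≤n)))
  normalized⁺ (normal (suc zero) e b) | yes _ | no _ | _ = ≡ᶠ⁺ e
  normalized⁺ (normal (suc zero) e b) | yes _ | yes z | _ = ⊥-elim (1≢0 (trans (sym e) z))
  normalized⁺ (normal (suc (suc i)) e b) | yes _ | no n | _ = ⊥-elim (n (b (suc zero) (ℕ.s≤s (ℕ.s≤s ℕ.z≤n))))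
  normalized⁺ (normal (suc (suc zero)) e b) | yes _ | yes _ | no _ = ≡ᶠ⁺ e
  normalized⁺ (normal (suc (suc zero)) e b) | yes _ | yes _ | yes z = ⊥-elim (1≢0 (trans (sym e) z))
  normalized⁺ (normal (suc (suc (suc zero))) e b) | yes _ | yes _ | no n = ⊥-elim (n (b (suc (suc zero)) (ℕ.s≤s (ℕ.s≤s (ℕ.s≤s ℕ.z≤n)))))
  normalized⁺ (normal (suc (suc (suc zero))) e b) | yes _ | yes _ | yes _ = ≡ᶠ⁺ e

  normalized⁻ : ∀ {c} → T (normalized c) → Normalized c
  normalized⁻ {c} t with c zero ≟ 0#
  ... | no _ = normal zero (≡ᶠ⁻ t) λ _ ()
  ... | yes z₀ with c (suc zero) ≟ 0#
  ... | no _ = normal (suc zero) (≡ᶠ⁻ t) λ { zero _ → z₀ ; (suc _) (ℕ.s≤s ()) }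
  ... | yes z₁ with c (suc (suc zero)) ≟ 0#
  ... | no _ = normal (suc (suc zero)) (≡ᶠ⁻ t) λ { zero _ → z₀ ; (suc zero) _ → z₁ ; (suc (suc _)) (ℕ.s≤s (ℕ.s≤s ())) }
  ... | yes z₂ = normal (suc (suc (suc zero))) (≡ᶠ⁻ t)
    λ { zero _ → z₀ ; (suc zero) _ → z₁ ; (suc (suc zero)) _ → z₂ ; (suc (suc (suc _))) (ℕ.s≤s (ℕ.s≤s (ℕ.s≤s ()))) }

  ∝-zero : ∀ {c c′} → c′ ∝ c → ∀ i → c i ≡ 0# → c′ i ≡ 0#
  ∝-zero (k , _ , e) i z = trans (e i) (trans (cong (k *_) z) (zeroʳ k))

  ∝-sym : ∀ {x y} → x ∝ y → y ∝ x
  ∝-sym {x} {y} (k , k≢0 , e) = let i , ki = inverse k k≢0 in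
    i , inverse-nonzero ki , λ n → sym (trans (cong (i *_) (e n)) (inverse-cancelˡ ki (y n)))

  ∝-trans : ∀ {x y z} → x ∝ y → y ∝ z → x ∝ z
  ∝-trans {z = z} (k , k≢0 , e) (l , l≢0 , f) = k * l , *-nonzero k≢0 l≢0 ,
    λ n → trans (e n) (trans (cong (k *_) (f n)) (sym (*-assoc k l (z n))))

  ≐⇒∝ : ∀ {x y} → x ≐ y → x ∝ y
  ≐⇒∝ {x} {y} e = 1# , 1≢0 , λ n → trans (e n) (sym (*-identityˡ (y n)))

  normalized-unique : ∀ {c c′} → Normalized c → Normalized c′ → c′ ∝ c → c′ ≐ c
  normalized-unique {c} {c′} (normal i e b) (normal i′ e′ b′) p@(k , _ , f) with ℕ.<-cmp (toℕ i) (toℕ i′)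
  ... | tri< i<i′ _ _ = ⊥-elim (1≢0 (trans (sym e) (∝-zero (∝-sym {c′} {c} p) i (b′ i i<i′))))
  ... | tri> _ _ i′<i = ⊥-elim (1≢0 (trans (sym e′) (∝-zero p i′ (b i′ i′<i))))
  ... | tri≈ _ i≡i′ _ with refl ← toℕ-injective i≡i′ = λ n → trans (f n) (trans (cong (_* c n) k≡1) (*-identityˡ (c n)))
    where
    k≡1 : k ≡ 1#
    k≡1 = trans (sym (*-identityʳ k)) (trans (cong (k *_) (sym e)) (trans (sym (f i)) e′))

  normalize : ∀ {c} → ¬ (c ≐ zeroV) → ∃ λ c′ → Normalized c′ × c′ ∝ c
  normalize {c} c≢0 with first (λ i → ¬? (c i ≟ 0#))
  ... | inj₁ none = ⊥-elim (c≢0 λ i → decidable-stable (c i ≟ 0#) (none i))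
  ... | inj₂ (i , ci≢0 , before) =
    let k , ck = inverse (c i) ci≢0 in
    k ⊛ c , normal i (trans (*-comm k (c i)) ck) (λ n n<i → trans (cong (k *_) (decidable-stable (c n ≟ 0#) (before n n<i))) (zeroʳ k)) ,
    k , inverse-nonzero ck , λ n → refl

  record Rref (u v : V) : Set where
    constructor echelon
    field
      i j  : Fin 4
      i<j  : i Fin.< j
      ui≡1 : u i ≡ 1#
      vi≡0 : v i ≡ 0#
      vj≡1 : v j ≡ 1#
      uj≡0 : u j ≡ 0#
      u-before : ∀ k → k Fin.< i → u k ≡ 0#
      v-before : ∀ k → k Fin.< j → v k ≡ 0#

  rref⁺ : ∀ {u v} → Rref u v → T (rref u v)
  rref⁺ {u} {v} (echelon i j i<j ui vi vj uj ub vb) =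
    T-any⁺ (λ i → anyFin λ j → rrefAt i j u v) i (T-any⁺ (λ j → rrefAt i j u v) j
      (ℕ.<⇒<ᵇ i<j ∧⁺ ≡ᶠ⁺ ui ∧⁺ ≡ᶠ⁺ vi ∧⁺ ≡ᶠ⁺ vj ∧⁺ ≡ᶠ⁺ uj ∧⁺ T-all⁺ _ λ k → implies (ub k) ∧⁺ implies (vb k)))
    where
    implies : ∀ {m n x} → (m ℕ.< n → x ≡ 0#) → T (not (m ℕ.<ᵇ n) ∨ (x ≡ᶠ 0#))
    implies {m} {n} f with m ℕ.<ᵇ n in e
    ... | false = tt
    ... | true  = ≡ᶠ⁺ (f (ℕ.<ᵇ⇒< m n (subst T (sym e) tt)))

  rref⁻ : ∀ {u v} → T (rref u v) → Rref u v
  rref⁻ {u} {v} t =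
    let i , t₁ = T-any⁻ (λ i → anyFin λ j → rrefAt i j u v) t
        j , t₂ = T-any⁻ (λ j → rrefAt i j u v) t₁
        i<j , t₃ = ∧⁻ {toℕ i ℕ.<ᵇ toℕ j} t₂
        ui , t₄ = ∧⁻ {u i ≡ᶠ 1#} t₃
        vi , t₅ = ∧⁻ {v i ≡ᶠ 0#} t₄
        vj , t₆ = ∧⁻ {v j ≡ᶠ 1#} t₅
        uj , t₇ = ∧⁻ {u j ≡ᶠ 0#} t₆
        before = T-all⁻ (λ k → (not (toℕ k ℕ.<ᵇ toℕ i) ∨ (u k ≡ᶠ 0#)) ∧ (not (toℕ k ℕ.<ᵇ toℕ j) ∨ (v k ≡ᶠ 0#))) t₇
    in echelon i j (ℕ.<ᵇ⇒< _ _ i<j) (≡ᶠ⁻ ui) (≡ᶠ⁻ vi) (≡ᶠ⁻ vj) (≡ᶠ⁻ uj)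
         (λ k k<i → implied k<i (proj₁ (∧⁻ {not (toℕ k ℕ.<ᵇ toℕ i) ∨ (u k ≡ᶠ 0#)} (before k))))
         (λ k k<j → implied k<j (proj₂ (∧⁻ {not (toℕ k ℕ.<ᵇ toℕ i) ∨ (u k ≡ᶠ 0#)} (before k))))
    where
    implied : ∀ {m n x} → m ℕ.< n → T (not (m ℕ.<ᵇ n) ∨ (x ≡ᶠ 0#)) → x ≡ 0#
    implied {m} {n} m<n t with m ℕ.<ᵇ n in e
    ... | false = ⊥-elim (subst T e (ℕ.<⇒<ᵇ m<n))
    ... | true  = ≡ᶠ⁻ t

  private
    combine≡0 : ∀ {l m x y} → x ≡ 0# → y ≡ 0# → l * x + m * y ≡ 0#
    combine≡0 {l} {m} x≡0 y≡0 = trans (cong₂ (λ x y → l * x + m * y) x≡0 y≡0)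
      (by-ring 2 (λ l m → l :* :0 :+ m :* :0 , :0) refl l m)

    combine≡0ˡ : ∀ {l m x y} → l ≡ 0# → y ≡ 0# → l * x + m * y ≡ 0#
    combine≡0ˡ {l} {m} {x} l≡0 y≡0 = trans (cong₂ (λ l y → l * x + m * y) l≡0 y≡0)
      (by-ring 2 (λ x m → :0 :* x :+ m :* :0 , :0) refl x m)

    combine-fst : ∀ {l m x y} → x ≡ 1# → y ≡ 0# → l * x + m * y ≡ l
    combine-fst {l} {m} x≡1 y≡0 = trans (cong₂ (λ x y → l * x + m * y) x≡1 y≡0)
      (by-ring 2 (λ l m → l :* :1 :+ m :* :0 , l) refl l m)

    combine-snd : ∀ {l m x y} → x ≡ 0# → y ≡ 1# → l * x + m * y ≡ m
    combine-snd {l} {m} x≡0 y≡1 = trans (cong₂ (λ x y → l * x + m * y) x≡0 y≡1)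
      (by-ring 2 (λ l m → l :* :0 :+ m :* :1 , m) refl l m)

  rref-indep : ∀ {u v} → Rref u v → Indep u v
  rref-indep (echelon i j _ ui vi vj uj _ _) l m e =
    trans (sym (combine-fst ui vi)) (e i) , trans (sym (combine-snd uj vj)) (e j)

  -- If one form had an earlier first pivot, one of its vectors would be nonzero where the whole
  -- span of the other form vanishes. With equal first pivots, `v` and `v′` have no component along
  -- the first vector, and the same argument applies to the second pivot. The coefficients are then
  -- read off at the two pivots.
  rref-unique : ∀ {u v u′ v′} → Rref u v → Rref u′ v′ → Sub u v u′ v′ → Sub u′ v′ u v → u′ ≐ u × v′ ≐ v
  rref-unique {u} {v} {u′} {v′} (echelon i j i<j ui vi vj uj ub vb) (echelon i′ j′ i<j′ ui′ vi′ vj′ uj′ ub′ vb′)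
    s@((l , m , e) , (l′ , m′ , e′)) s′ with ℕ.<-cmp (toℕ i) (toℕ i′)
  ... | tri< i<i′ _ _ = let (l , m , e) , _ = s′ in
    ⊥-elim (1≢0 (trans (sym ui) (trans (e i) (combine≡0 (ub′ i i<i′) (vb′ i (ℕ.<-trans i<i′ i<j′))))))
  ... | tri> _ _ i′<i =
    ⊥-elim (1≢0 (trans (sym ui′) (trans (e i′) (combine≡0 (ub i′ i′<i) (vb i′ (ℕ.<-trans i′<i i<j))))))
  ... | tri≈ _ i≡i′ _ with refl ← toℕ-injective i≡i′ | ℕ.<-cmp (toℕ j) (toℕ j′)
  ... | tri< j<j′ _ _ = let _ , (l , m , e) = s′ in
    ⊥-elim (1≢0 (trans (sym vj) (trans (e j) (combine≡0ˡ (trans (sym (combine-fst ui′ vi′)) (trans (sym (e i)) vi)) (vb′ j j<j′)))))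
  ... | tri> _ _ j′<j =
    ⊥-elim (1≢0 (trans (sym vj′) (trans (e′ j′) (combine≡0ˡ (trans (sym (combine-fst ui vi)) (trans (sym (e′ i)) vi′)) (vb j′ j′<j)))))
  ... | tri≈ _ j≡j′ _ with refl ← toℕ-injective j≡j′ =
    (λ n → trans (e n) (trans (cong₂ (λ l m → l * u n + m * v n)
        (trans (sym (combine-fst ui vi)) (trans (sym (e i)) ui′)) (trans (sym (combine-snd uj vj)) (trans (sym (e j)) uj′)))
        (by-ring 2 (λ u v → :1 :* u :+ :0 :* v , u) refl (u n) (v n)))) ,
    (λ n → trans (e′ n) (trans (cong₂ (λ l m → l * u n + m * v n)
        (trans (sym (combine-fst ui vi)) (trans (sym (e′ i)) vi′)) (trans (sym (combine-snd uj vj)) (trans (sym (e′ j)) vj′)))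
        (by-ring 2 (λ u v → :0 :* u :+ :1 :* v , v) refl (u n) (v n))))

  private
    eliminate : ∀ {u v} i → Indep u v → u i ≢ 0# → ∃₂ λ u′ v′ →
      Same u v u′ v′ × u′ i ≡ 1# × v′ i ≡ 0# × (∀ k → u k ≡ 0# → v k ≡ 0# → u′ k ≡ 0# × v′ k ≡ 0#)
    eliminate {u} {v} i uv ui≢0 =
      u′ , v′ , same-by-indep uv
        ((u i , 0# , λ n → sym (begin
            u i * (x * u n) + 0# * v′ n  ≡⟨ by-ring 4 (λ a x b c → a :* (x :* b) :+ :0 :* c , a :* x :* b) refl (u i) x (u n) (v′ n) ⟩
            u i * x * u n  ≡⟨ cong (_* u n) ux ⟩
            1# * u n  ≡⟨ *-identityˡ (u n) ⟩
            u n  ∎)) ,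
         (v i , 1# , λ n → by-ring 3 (λ v w u → v , w :* u :+ :1 :* (v :- w :* u)) refl (v n) (v i) (u′ n))) ,
      xu , trans (cong (λ z → v i - v i * z) xu) (by-ring 1 (λ v → v :- v :* :1 , :0) refl (v i)) ,
      λ k uk vk → trans (cong (x *_) uk) (zeroʳ x) ,
        trans (cong₂ (λ a b → a - v i * (x * b)) vk uk) (by-ring 2 (λ v x → :0 :- v :* (x :* :0) , :0) refl (v i) x)
      where
      open ≡-Reasoning
      x : Carrier
      x = proj₁ (inverse (u i) ui≢0)
      ux : u i * x ≡ 1#
      ux = proj₂ (inverse (u i) ui≢0)
      u′ v′ : V
      u′ n = x * u n
      v′ n = v n - v i * u′ n
      xu : x * u i ≡ 1#
      xu = trans (*-comm x (u i)) ux

    zero-both : ∀ x y → ¬ ¬ (x ≡ 0# × y ≡ 0#) → x ≡ 0# × y ≡ 0#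
    zero-both x y = decidable-stable ((x ≟ 0#) ×-dec (y ≟ 0#))

    first-pivot : ∀ {u v} → Indep u v → ∃₂ λ u′ v′ → ∃ λ i →
      Same u v u′ v′ × u′ i ≡ 1# × v′ i ≡ 0# × (∀ k → k Fin.< i → u′ k ≡ 0# × v′ k ≡ 0#)
    first-pivot {u} {v} uv with first (λ i → ¬? ((u i ≟ 0#) ×-dec (v i ≟ 0#)))
    ... | inj₁ none = ⊥-elim (1≢0 (proj₁ (uv 1# 0# λ i → let ui , vi = zero-both (u i) (v i) (none i) in combine≡0 ui vi)))
    ... | inj₂ (i , nz , before) with u i ≟ 0#
    ... | no ui≢0 =
      let u′ , v′ , s , ui , vi , z = eliminate i uv ui≢0
      in u′ , v′ , i , s , ui , vi , λ k k<i → let uk , vk = zero-both (u k) (v k) (before k k<i) in z k uk vk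
    ... | yes ui≡0 =
      let swap = same-swap uv
          u′ , v′ , s , ui , vi , z = eliminate i (proj₁ (proj₂ swap)) λ vi≡0 → nz (ui≡0 , vi≡0)
      in u′ , v′ , i , same-trans swap s , ui , vi , λ k k<i → let uk , vk = zero-both (u k) (v k) (before k k<i) in z k vk uk

  -- Elimination at the first coordinate where the two vectors do not both vanish gives the first
  -- pivot. The second vector is then normalized, and the first one is cleared at the new pivot.
  rref-exists : ∀ {u v} → Indep u v → ∃₂ λ u′ v′ → Rref u′ v′ × Same u v u′ v′
  rref-exists uv =
    let u , v , i , s@(_ , uv′ , _) , ui , vi , before = first-pivot uv
        v₀ , normal j vj vb , (k , k≢0 , e) = normalize {v} λ z → 1≢0 (proj₂ (uv′ 0# 1# λ n →
          trans (cong (λ y → 0# * u n + 1# * y) (z n)) (by-ring 1 (λ u → :0 :* u :+ :1 :* :0 , :0) refl (u n))))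
        v₀i = trans (e i) (trans (cong (k *_) vi) (zeroʳ k))
        v₀b = λ n n<i → trans (e n) (trans (cong (k *_) (proj₂ (before n n<i))) (zeroʳ k))
        -- The vector `v₀` vanishes at `i` and before it, so its pivot lies beyond `i`.
        i<j = ℕ.≤∧≢⇒< (ℕ.≮⇒≥ λ j<i → 1≢0 (trans (sym vj) (v₀b j j<i)))
                (λ i≡j → 1≢0 (trans (sym vj) (trans (cong v₀ (sym (toℕ-injective i≡j))) v₀i)))
        κ , kκ = inverse k k≢0
        u₀ = λ n → u n - u j * v₀ n
    in u₀ , v₀ , echelon i j i<j
         (trans (cong₂ (λ x y → x - u j * y) ui v₀i) (by-ring 1 (λ y → :1 :- y :* :0 , :1) refl (u j)))
         v₀i vj
         (trans (cong (λ y → u j - u j * y) vj) (by-ring 1 (λ y → y :- y :* :1 , :0) refl (u j)))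
         (λ n n<i → trans (cong₂ (λ x y → x - u j * y) (proj₁ (before n n<i)) (v₀b n n<i)) (by-ring 1 (λ y → :0 :- y :* :0 , :0) refl (u j)))
         vb ,
       same-trans s (same-by-indep uv′
         ((1# , u j , λ n → by-ring 3 (λ u w v → u , :1 :* (u :- w :* v) :+ w :* v) refl (u n) (u j) (v₀ n)) ,
          (0# , κ , λ n → trans (sym (inverse-cancelˡ kκ (v n))) (trans (cong (κ *_) (sym (e n)))
            (by-ring 3 (λ k v u → k :* v , :0 :* u :+ k :* v) refl κ (v₀ n) (u₀ n))))))

  -- Counting requires decidable propositional equality, which coordinate tuples have and functions
  -- do not.
  Tuple : Set
  Tuple = Carrier × (Carrier × (Carrier × Carrier))

  toV : Tuple → V
  toV (a , b , c , d) = vec a b c d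

  fromV : V → Tuple
  fromV v = v zero , v (suc zero) , v (suc (suc zero)) , v (suc (suc (suc zero)))

  toV-fromV : ∀ v → toV (fromV v) ≐ v
  toV-fromV v = ∀₄ refl refl refl refl

  fromV-cong : ∀ {u v} → u ≐ v → fromV u ≡ fromV v
  fromV-cong e = cong₂ _,_ (e zero) (cong₂ _,_ (e (suc zero)) (cong₂ _,_ (e (suc (suc zero))) (e (suc (suc (suc zero))))))

  opaque
    unfolding 𝓕

    𝓥 : Summation Tuple
    𝓥 = 𝓕 ×-summation 𝓕 ×-summation 𝓕 ×-summation 𝓕

    ∑≡countV : ∀ f → Summation.∑ 𝓥 (λ t → f (toV t)) ≡ countV f
    ∑≡countV f = refl

    𝓥² : Summation (Tuple × Tuple)
    𝓥² = 𝓥 ×-summation 𝓥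

    ∑≡countV² : ∀ f → Summation.∑ 𝓥² (λ (s , t) → f (toV s) (toV t)) ≡ countV² f
    ∑≡countV² f = refl

    𝓟 : Summation (Maybe Carrier)
    𝓟 = Maybe-summation 𝓕

    ∑≡countPt : ∀ f → Summation.∑ 𝓟 f ≡ countPt f
    ∑≡countPt f = refl

    ∑𝓟 : ∀ f → Summation.∑ 𝓟 f ≡ f nothing ℕ.+ 𝓕.∑ (λ t → f (just t))
    ∑𝓟 f = refl

  module 𝓥 = Summation 𝓥
  module 𝓥² = Summation 𝓥²
  module 𝓟 = Summation 𝓟

  𝓟-witness : ∀ p → 𝓟.card p ≢ 0 → ∃ λ s → T (p s)
  𝓟-witness p n with p nothing in e
  ... | true  = nothing , subst T (sym e) tt
  ... | false with anyF (λ t → p (just t)) in e′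
  ... | true  = let t , pt = anyF⁻ (λ t → p (just t)) (subst T (sym e′) tt) in just t , pt
  ... | false = ⊥-elim (n (𝓟.card-empty λ where
      nothing  q → subst T e q
      (just t) q → subst T e′ (anyF⁺ (λ t → p (just t)) t q)))

-- Third symmetric powers and their action on the cubic.

-- The formulas are stated over bare operations because they are used twice: at the field, and at
-- polynomial expressions, where the same formulas generate the identities handed to `by-ring`.
module Entries {A : Set} (_⊞_ _⊠_ : A → A → A) (⊟_ : A → A) (I : A) where
  tuple : A → A → A → A → Fin 4 → A
  tuple a b c d zero = a
  tuple a b c d 1F = b
  tuple a b c d 2F = c
  tuple a b c d 3F = d

  ∑₄ : (Fin 4 → A) → A
  ∑₄ f = f zero ⊞ (f 1F ⊞ (f 2F ⊞ f 3F))

  private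
    twice thrice : A → A
    twice x = (I ⊞ I) ⊠ x
    thrice x = (I ⊞ (I ⊞ I)) ⊠ x

  -- The Veronese map, that is, the cubic parametrized by homogeneous coordinates; P(∞) is the value
  -- at (1 : 0).
  point : A → A → Fin 4 → A
  point x y = tuple (x ⊠ (x ⊠ x)) ((x ⊠ x) ⊠ y) (x ⊠ (y ⊠ y)) (y ⊠ (y ⊠ y))

  -- The value of this covector on the point with homogeneous coordinates (X, Y) is the cube of
  -- `X y - x Y`, which exhibits the triple contact.
  osculating : A → A → Fin 4 → A
  osculating x y = tuple (y ⊠ (y ⊠ y)) (⊟ thrice (x ⊠ (y ⊠ y))) (thrice ((x ⊠ x) ⊠ y)) (⊟ (x ⊠ (x ⊠ x)))

  -- the third symmetric power of the matrix with rows (a, b) and (c, d)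
  cubicMatrix : A → A → A → A → Fin 4 → Fin 4 → A
  cubicMatrix a b c d zero = tuple (a ⊠ (a ⊠ a)) (thrice ((a ⊠ a) ⊠ b)) (thrice (a ⊠ (b ⊠ b))) (b ⊠ (b ⊠ b))
  cubicMatrix a b c d 1F = tuple ((a ⊠ a) ⊠ c) (twice ((a ⊠ b) ⊠ c) ⊞ ((a ⊠ a) ⊠ d)) (twice ((a ⊠ b) ⊠ d) ⊞ ((b ⊠ b) ⊠ c)) ((b ⊠ b) ⊠ d)
  cubicMatrix a b c d 2F = tuple (a ⊠ (c ⊠ c)) (twice ((a ⊠ c) ⊠ d) ⊞ (b ⊠ (c ⊠ c))) (twice ((b ⊠ c) ⊠ d) ⊞ (a ⊠ (d ⊠ d))) (b ⊠ (d ⊠ d))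
  cubicMatrix a b c d 3F = tuple (c ⊠ (c ⊠ c)) (thrice ((c ⊠ c) ⊠ d)) (thrice (c ⊠ (d ⊠ d))) (d ⊠ (d ⊠ d))

module TwistedCubic {q : ℕ} (𝔽 : FiniteField q) where
  open FieldTheory 𝔽
  open LinearAlgebra 𝔽
  open CanonicalForms 𝔽
  open Entries _+_ _*_ -_ 1# public using (point; osculating; cubicMatrix)
  module E {n} = Entries {Expression n} _:+_ _:*_ :-_ :1

  -- The inverse `δ` of the determinant is carried as data. Products and inverses are then
  -- polynomial in the fields, and their laws are ring identities.
  record GL₂ : Set where
    field
      a b c d δ : Carrier
      det : (a * d - b * c) * δ ≡ 1#

  S³ : GL₂ → Mat
  S³ g = cubicMatrix a b c d where open GL₂ g

  act : GL₂ → V → V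
  act g = apply (S³ g)

  cubicMatrix-cong : ∀ {a b c d a′ b′ c′ d′} → a ≡ a′ → b ≡ b′ → c ≡ c′ → d ≡ d′ →
    ∀ i j → cubicMatrix a b c d i j ≡ cubicMatrix a′ b′ c′ d′ i j
  cubicMatrix-cong refl refl refl refl i j = refl

  cubicMatrix-point : ∀ a b c d x y → apply (cubicMatrix a b c d) (point x y) ≐ point (a * x + b * y) (c * x + d * y)
  cubicMatrix-point a b c d x y = ∀₄
    (by-ring 6 (eq zero) refl a b c d x y) (by-ring 6 (eq 1F) refl a b c d x y)
    (by-ring 6 (eq 2F) refl a b c d x y) (by-ring 6 (eq 3F) refl a b c d x y)
    where
    eq : Fin 4 → (a b c d x y : Expression 6) → Expression 6 × Expression 6
    eq i a b c d x y = E.∑₄ (λ j → E.cubicMatrix a b c d i j :* E.point x y j) , E.point (a :* x :+ b :* y) (c :* x :+ d :* y) i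

  -- Pairing with a point gives the cube of a 2 by 2 determinant, and a linear substitution
  -- multiplies that determinant by its own.
  cubicMatrix-osculating : ∀ a b c d x y → pull (osculating (a * x + b * y) (c * x + d * y)) (cubicMatrix a b c d) ≐
    ((a * d - b * c) * ((a * d - b * c) * (a * d - b * c))) ⊛ osculating x y
  cubicMatrix-osculating a b c d x y = ∀₄
    (by-ring 6 (eq zero) refl a b c d x y) (by-ring 6 (eq 1F) refl a b c d x y)
    (by-ring 6 (eq 2F) refl a b c d x y) (by-ring 6 (eq 3F) refl a b c d x y)
    where
    eq : Fin 4 → (a b c d x y : Expression 6) → Expression 6 × Expression 6
    eq j a b c d x y = E.∑₄ (λ i → E.osculating (a :* x :+ b :* y) (c :* x :+ d :* y) i :* E.cubicMatrix a b c d i j) ,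
      (let Δ = a :* d :- b :* c in Δ :* (Δ :* Δ)) :* E.osculating x y j

  cubicMatrix-∙ : ∀ a b c d a′ b′ c′ d′ i j → (cubicMatrix a b c d ∙ cubicMatrix a′ b′ c′ d′) i j ≡
    cubicMatrix (a * a′ + b * c′) (a * b′ + b * d′) (c * a′ + d * c′) (c * b′ + d * d′) i j
  cubicMatrix-∙ a b c d a′ b′ c′ d′ = ∀₄
    (∀₄ (by-ring 8 (eq 0F 0F) refl a b c d a′ b′ c′ d′) (by-ring 8 (eq 0F 1F) refl a b c d a′ b′ c′ d′)
        (by-ring 8 (eq 0F 2F) refl a b c d a′ b′ c′ d′) (by-ring 8 (eq 0F 3F) refl a b c d a′ b′ c′ d′))
    (∀₄ (by-ring 8 (eq 1F 0F) refl a b c d a′ b′ c′ d′) (by-ring 8 (eq 1F 1F) refl a b c d a′ b′ c′ d′)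
        (by-ring 8 (eq 1F 2F) refl a b c d a′ b′ c′ d′) (by-ring 8 (eq 1F 3F) refl a b c d a′ b′ c′ d′))
    (∀₄ (by-ring 8 (eq 2F 0F) refl a b c d a′ b′ c′ d′) (by-ring 8 (eq 2F 1F) refl a b c d a′ b′ c′ d′)
        (by-ring 8 (eq 2F 2F) refl a b c d a′ b′ c′ d′) (by-ring 8 (eq 2F 3F) refl a b c d a′ b′ c′ d′))
    (∀₄ (by-ring 8 (eq 3F 0F) refl a b c d a′ b′ c′ d′) (by-ring 8 (eq 3F 1F) refl a b c d a′ b′ c′ d′)
        (by-ring 8 (eq 3F 2F) refl a b c d a′ b′ c′ d′) (by-ring 8 (eq 3F 3F) refl a b c d a′ b′ c′ d′))
    where
    eq : Fin 4 → Fin 4 → (a b c d a′ b′ c′ d′ : Expression 8) → Expression 8 × Expression 8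
    eq i j a b c d a′ b′ c′ d′ = E.∑₄ (λ k → E.cubicMatrix a b c d i k :* E.cubicMatrix a′ b′ c′ d′ k j) ,
      E.cubicMatrix (a :* a′ :+ b :* c′) (a :* b′ :+ b :* d′) (c :* a′ :+ d :* c′) (c :* b′ :+ d :* d′) i j

  cubicMatrix-id : ∀ i j → cubicMatrix 1# 0# 0# 1# i j ≡ idMat i j
  cubicMatrix-id = ∀₄
    (∀₄ (by-ring 0 (M 0F 0F , :1) refl) (by-ring 0 (M 0F 1F , :0) refl) (by-ring 0 (M 0F 2F , :0) refl) (by-ring 0 (M 0F 3F , :0) refl))
    (∀₄ (by-ring 0 (M 1F 0F , :0) refl) (by-ring 0 (M 1F 1F , :1) refl) (by-ring 0 (M 1F 2F , :0) refl) (by-ring 0 (M 1F 3F , :0) refl))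
    (∀₄ (by-ring 0 (M 2F 0F , :0) refl) (by-ring 0 (M 2F 1F , :0) refl) (by-ring 0 (M 2F 2F , :1) refl) (by-ring 0 (M 2F 3F , :0) refl))
    (∀₄ (by-ring 0 (M 3F 0F , :0) refl) (by-ring 0 (M 3F 1F , :0) refl) (by-ring 0 (M 3F 2F , :0) refl) (by-ring 0 (M 3F 3F , :1) refl))
    where
    M : Fin 4 → Fin 4 → Expression 0
    M = E.cubicMatrix :1 :0 :0 :1

  infixl 7 _⋆_

  _⋆_ : GL₂ → GL₂ → GL₂
  g ⋆ h = record
    { a = g.a * h.a + g.b * h.c ; b = g.a * h.b + g.b * h.d
    ; c = g.c * h.a + g.d * h.c ; d = g.c * h.b + g.d * h.d
    ; δ = g.δ * h.δ
    ; det = trans (by-ring 10 (λ a b c d x a′ b′ c′ d′ x′ →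
        ((a :* a′ :+ b :* c′) :* (c :* b′ :+ d :* d′) :- (a :* b′ :+ b :* d′) :* (c :* a′ :+ d :* c′)) :* (x :* x′) ,
        (a :* d :- b :* c) :* x :* ((a′ :* d′ :- b′ :* c′) :* x′)) refl g.a g.b g.c g.d g.δ h.a h.b h.c h.d h.δ)
        (trans (cong₂ _*_ g.det h.det) (*-identityˡ 1#))
    }
    where
    module g = GL₂ g
    module h = GL₂ h

  infix 9 _⁻¹

  _⁻¹ : GL₂ → GL₂
  g ⁻¹ = record
    { a = d * δ ; b = - (b * δ) ; c = - (c * δ) ; d = a * δ ; δ = a * d - b * c
    ; det = trans (by-ring 5 (λ a b c d x → (d :* x :* (a :* x) :- :- (b :* x) :* (:- (c :* x))) :* (a :* d :- b :* c) ,
                                (a :* d :- b :* c) :* x :* ((a :* d :- b :* c) :* x)) refl a b c d δ)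
                  (trans (cong₂ _*_ det det) (*-identityˡ 1#))
    }
    where open GL₂ g

  S³-⋆ : ∀ g h i j → (S³ g ∙ S³ h) i j ≡ S³ (g ⋆ h) i j
  S³-⋆ g h = cubicMatrix-∙ (GL₂.a g) (GL₂.b g) (GL₂.c g) (GL₂.d g) (GL₂.a h) (GL₂.b h) (GL₂.c h) (GL₂.d h)

  S³-inverseʳ : ∀ g i j → (S³ g ∙ S³ (g ⁻¹)) i j ≡ idMat i j
  S³-inverseʳ g i j = trans (S³-⋆ g (g ⁻¹) i j) (trans (cubicMatrix-cong
      (trans (by-ring 5 (λ a b c d x → a :* (d :* x) :+ b :* (:- (c :* x)) , (a :* d :- b :* c) :* x) refl a b c d δ) det)
      (by-ring 5 (λ a b c d x → a :* (:- (b :* x)) :+ b :* (a :* x) , :0) refl a b c d δ)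
      (by-ring 5 (λ a b c d x → c :* (d :* x) :+ d :* (:- (c :* x)) , :0) refl a b c d δ)
      (trans (by-ring 5 (λ a b c d x → c :* (:- (b :* x)) :+ d :* (a :* x) , (a :* d :- b :* c) :* x) refl a b c d δ) det) i j)
    (cubicMatrix-id i j))
    where open GL₂ g

  S³-inverseˡ : ∀ g i j → (S³ (g ⁻¹) ∙ S³ g) i j ≡ idMat i j
  S³-inverseˡ g i j = trans (S³-⋆ (g ⁻¹) g i j) (trans (cubicMatrix-cong
      (trans (by-ring 5 (λ a b c d x → d :* x :* a :+ :- (b :* x) :* c , (a :* d :- b :* c) :* x) refl a b c d δ) det)
      (by-ring 5 (λ a b c d x → d :* x :* b :+ :- (b :* x) :* d , :0) refl a b c d δ)
      (by-ring 5 (λ a b c d x → :- (c :* x) :* a :+ a :* x :* c , :0) refl a b c d δ)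
      (trans (by-ring 5 (λ a b c d x → :- (c :* x) :* b :+ a :* x :* d , (a :* d :- b :* c) :* x) refl a b c d δ) det) i j)
    (cubicMatrix-id i j))
    where open GL₂ g

  apply-≐ : ∀ {M N : Mat} x → (∀ i j → M i j ≡ N i j) → apply M x ≐ apply N x
  apply-≐ x e i = ·-congˡ x (e i)

  act-⋆ : ∀ g h x → act (g ⋆ h) x ≐ act g (act h x)
  act-⋆ g h x i = trans (sym (apply-≐ x (S³-⋆ g h) i)) (apply-∙ (S³ g) (S³ h) x i)

  act-inverseʳ : ∀ g x → act g (act (g ⁻¹) x) ≐ x
  act-inverseʳ g x i = trans (sym (apply-∙ (S³ g) (S³ (g ⁻¹)) x i)) (trans (apply-≐ x (S³-inverseʳ g) i) (apply-idMat x i))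

  act-inverseˡ : ∀ g x → act (g ⁻¹) (act g x) ≐ x
  act-inverseˡ g x i = trans (sym (apply-∙ (S³ (g ⁻¹)) (S³ g) x i)) (trans (apply-≐ x (S³-inverseˡ g) i) (apply-idMat x i))

  X Y : Maybe Carrier → Carrier
  X nothing  = 1#
  X (just t) = t
  Y nothing  = 0#
  Y (just t) = 1#

  hom-nonzero : ∀ s → ¬ (X s ≡ 0# × Y s ≡ 0#)
  hom-nonzero nothing  (e , _) = 1≢0 e
  hom-nonzero (just t) (_ , e) = 1≢0 e

  ratio : ∀ x y → ¬ (x ≡ 0# × y ≡ 0#) → ∃₂ λ s k → k ≢ 0# × x ≡ k * X s × y ≡ k * Y s
  ratio x y nz with y ≟ 0#
  ... | yes y≡0 = nothing , x , (λ x≡0 → nz (x≡0 , y≡0)) , sym (*-identityʳ x) , trans y≡0 (sym (zeroʳ x))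
  ... | no  y≢0 = let i , yi = inverse y y≢0 in just (i * x) , y , y≢0 ,
    sym (inverse-cancelʳ yi x) , sym (*-identityʳ y)

  cubicPt-hom : ∀ s → cubicPt s ≐ point (X s) (Y s)
  cubicPt-hom nothing = ∀₄ (by-ring 0 (:1 , :1 :* (:1 :* :1)) refl) (by-ring 0 (:0 , :1 :* :1 :* :0) refl)
    (by-ring 0 (:0 , :1 :* (:0 :* :0)) refl) (by-ring 0 (:0 , :0 :* (:0 :* :0)) refl)
  cubicPt-hom (just t) = ∀₄ refl (by-ring 1 (λ t → t :* t , t :* t :* :1) refl t)
    (by-ring 1 (λ t → t , t :* (:1 :* :1)) refl t) (by-ring 0 (:1 , :1 :* (:1 :* :1)) refl)

  oscPlane : Maybe Carrier → V
  oscPlane nothing  = vec 0# 0# 0# 1#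
  oscPlane (just t) = osc t

  oscPlane-hom : ∀ s → oscPlane s ∝ osculating (X s) (Y s)
  -- At infinity the homogeneous formula gives (0, 0, 0, -1), whence the factor -1.
  oscPlane-hom nothing = - 1# , (λ e → 1≢0 (trans (by-ring 0 (:1 , :- (:- :1)) refl) (trans (cong -_ e) (by-ring 0 (:- :0 , :0) refl)))) ,
    ∀₄ (by-ring 0 (:0 , :- :1 :* (:0 :* (:0 :* :0))) refl) (by-ring 0 (:0 , :- :1 :* (:- (:3 :* (:1 :* (:0 :* :0))))) refl)
       (by-ring 0 (:0 , :- :1 :* (:3 :* (:1 :* :1 :* :0))) refl) (by-ring 0 (:1 , :- :1 :* (:- (:1 :* (:1 :* :1)))) refl)
  oscPlane-hom (just t) = 1# , 1≢0 ,
    ∀₄ (by-ring 1 (λ t → :1 , :1 :* (:1 :* (:1 :* :1))) refl t) (by-ring 1 (λ t → :- (:3 :* t) , :1 :* (:- (:3 :* (t :* (:1 :* :1))))) refl t)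
       (by-ring 1 (λ t → :3 :* (t :* t) , :1 :* (:3 :* (t :* t :* :1))) refl t) (by-ring 1 (λ t → :- (t :* (t :* t)) , :1 :* (:- (t :* (t :* t)))) refl t)

  point-scale : ∀ k x y → point (k * x) (k * y) ≐ (k * (k * k)) ⊛ point x y
  point-scale k x y = ∀₄ (by-ring 3 (eq zero) refl k x y) (by-ring 3 (eq 1F) refl k x y)
    (by-ring 3 (eq 2F) refl k x y) (by-ring 3 (eq 3F) refl k x y)
    where
    eq : Fin 4 → (k x y : Expression 3) → Expression 3 × Expression 3
    eq i k x y = E.point (k :* x) (k :* y) i , k :* (k :* k) :* E.point x y i

  osculating-scale : ∀ k x y → osculating (k * x) (k * y) ≐ (k * (k * k)) ⊛ osculating x y
  osculating-scale k x y = ∀₄ (by-ring 3 (eq zero) refl k x y) (by-ring 3 (eq 1F) refl k x y)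
    (by-ring 3 (eq 2F) refl k x y) (by-ring 3 (eq 3F) refl k x y)
    where
    eq : Fin 4 → (k x y : Expression 3) → Expression 3 × Expression 3
    eq i k x y = E.osculating (k :* x) (k :* y) i , k :* (k :* k) :* E.osculating x y i

  point-injective : ∀ s t → cubicPt s ∝ cubicPt t → s ≡ t
  point-injective nothing nothing _ = refl
  point-injective nothing (just t) (k , k≢0 , e) = ⊥-elim (k≢0 (trans (sym (*-identityʳ k)) (sym (e 3F))))
  point-injective (just s) nothing (k , k≢0 , e) = ⊥-elim (1≢0 (trans (e 3F) (zeroʳ k)))
  point-injective (just s) (just t) (k , k≢0 , e) = cong just (begin
    s  ≡⟨ e 2F ⟩
    k * t  ≡⟨ cong (_* t) (trans (sym (*-identityʳ k)) (sym (e 3F))) ⟩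
    1# * t  ≡⟨ *-identityˡ t ⟩
    t  ∎)
    where open ≡-Reasoning

  module _ (g : GL₂) where
    open GL₂ g

    private
      image : ∀ s → ∃₂ λ t k → k ≢ 0# × a * X s + b * Y s ≡ k * X t × c * X s + d * Y s ≡ k * Y t
      image s = ratio _ _ λ (e , f) → hom-nonzero s
        ( trans (trans (sym (*-identityʳ (X s))) (cong (X s *_) (sym det)))
            (trans (by-ring 7 (λ a b c d i x y → x :* ((a :* d :- b :* c) :* i) , i :* (d :* (a :* x :+ b :* y) :- b :* (c :* x :+ d :* y))) refl a b c d δ (X s) (Y s))
              (trans (cong₂ (λ u v → δ * (d * u - b * v)) e f) (by-ring 3 (λ i d b → i :* (d :* :0 :- b :* :0) , :0) refl δ d b)))
        , trans (trans (sym (*-identityʳ (Y s))) (cong (Y s *_) (sym det)))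
            (trans (by-ring 7 (λ a b c d i x y → y :* ((a :* d :- b :* c) :* i) , i :* (a :* (c :* x :+ d :* y) :- c :* (a :* x :+ b :* y))) refl a b c d δ (X s) (Y s))
              (trans (cong₂ (λ u v → δ * (a * v - c * u)) e f) (by-ring 3 (λ i d b → i :* (d :* :0 :- b :* :0) , :0) refl δ a c))) )

    -- The Möbius transformation (a s + b) / (c s + d) of the projective line.
    move : Maybe Carrier → Maybe Carrier
    move s = proj₁ (image s)

    act-cubicPt : ∀ s → act g (cubicPt s) ∝ cubicPt (move s)
    act-cubicPt s = let t , k , k≢0 , e , f = image s in
      k * (k * k) , *-nonzero k≢0 (*-nonzero k≢0 k≢0) , λ i → begin
        act g (cubicPt s) i  ≡⟨ apply-cong (S³ g) (cubicPt-hom s) i ⟩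
        act g (point (X s) (Y s)) i  ≡⟨ cubicMatrix-point a b c d (X s) (Y s) i ⟩
        point (a * X s + b * Y s) (c * X s + d * Y s) i  ≡⟨ cong₂ (λ x y → point x y i) e f ⟩
        point (k * X t) (k * Y t) i  ≡⟨ point-scale k (X t) (Y t) i ⟩
        k * (k * k) * point (X t) (Y t) i  ≡⟨ cong (k * (k * k) *_) (cubicPt-hom t i) ⟨
        k * (k * k) * cubicPt t i  ∎
      where open ≡-Reasoning

    oscPlane-move : ∀ s → oscPlane (move s) ∝ osculating (a * X s + b * Y s) (c * X s + d * Y s)
    oscPlane-move s = let t , k , k≢0 , e , f = image s in
      ∝-trans {oscPlane t} (oscPlane-hom t) (∝-sym {osculating (a * X s + b * Y s) (c * X s + d * Y s)}
        (k * (k * k) , *-nonzero k≢0 (*-nonzero k≢0 k≢0) , λ i →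
          trans (cong₂ (λ x y → osculating x y i) e f) (osculating-scale k (X t) (Y t) i)))

  pull-∝ : ∀ {c c′} M → c ∝ c′ → pull c M ∝ pull c′ M
  pull-∝ {c} {c′} M (k , k≢0 , e) = k , k≢0 , λ j →
    trans (·-congˡ (λ i → M i j) e) (·-scaleˡ k c′ (λ i → M i j))

  act-scale⁻ : ∀ g {x y} → act g x ∝ y → x ∝ act (g ⁻¹) y
  act-scale⁻ g {x} {y} (k , k≢0 , e) = k , k≢0 , λ i →
    trans (sym (act-inverseˡ g x i)) (trans (apply-cong (S³ (g ⁻¹)) e i) (apply-scale (S³ (g ⁻¹)) k y i))

  -- Fractions need not be composed: the matrices are inverse to each other, and a point of the
  -- cubic determines its parameter even when it is known only up to a scalar.
  move-inverseˡ : ∀ g s → move (g ⁻¹) (move g s) ≡ s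
  move-inverseˡ g s = sym (point-injective s _ (∝-trans {cubicPt s} {act (g ⁻¹) (cubicPt (move g s))}
    (act-scale⁻ g (act-cubicPt g s)) (act-cubicPt (g ⁻¹) (move g s))))

  act-scale⁻′ : ∀ g {x y} → act (g ⁻¹) x ∝ y → x ∝ act g y
  act-scale⁻′ g {x} {y} (k , k≢0 , e) = k , k≢0 , λ i →
    trans (sym (act-inverseʳ g x i)) (trans (apply-cong (S³ g) e i) (apply-scale (S³ g) k y i))

  move-inverseʳ : ∀ g s → move g (move (g ⁻¹) s) ≡ s
  move-inverseʳ g s = sym (point-injective s _ (∝-trans {cubicPt s} {act g (cubicPt (move (g ⁻¹) s))}
    (act-scale⁻′ g (act-cubicPt (g ⁻¹) s)) (act-cubicPt g (move (g ⁻¹) s))))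

  S³∈G : ∀ g → InG (S³ g)
  S³∈G g = (S³ (g ⁻¹) , S³-inverseʳ g , S³-inverseˡ g) ,
    (λ s → move g s , projEq⁺ (act-cubicPt g s)) ,
    (λ t → move (g ⁻¹) t , projEq⁺ (subst (λ s → act g (cubicPt (move (g ⁻¹) t)) ∝ cubicPt s) (move-inverseʳ g t) (act-cubicPt g (move (g ⁻¹) t))))

  pull-oscPlane : ∀ g s → pull (oscPlane (move g s)) (S³ g) ∝ oscPlane s
  pull-oscPlane g s =
    ∝-trans {pull (oscPlane (move g s)) (S³ g)} (pull-∝ {oscPlane (move g s)} (S³ g) (oscPlane-move g s))
      (∝-trans {z = oscPlane s} (Δ * (Δ * Δ) , *-nonzero Δ≢0 (*-nonzero Δ≢0 Δ≢0) , cubicMatrix-osculating a b c d (X s) (Y s))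
        (∝-sym {oscPlane s} (oscPlane-hom s)))
    where
    open GL₂ g
    Δ : Carrier
    Δ = a * d - b * c
    Δ≢0 : Δ ≢ 0#
    Δ≢0 e = 1≢0 (trans (sym det) (x≡0⇒xy≡0 δ e))

  pull-pull : ∀ c M N → pull (pull c M) N ≐ pull c (M ∙ N)
  pull-pull c M N j = pull-· c M (λ k → N k j)

  pull-inverseˡ : ∀ g c → pull (pull c (S³ (g ⁻¹))) (S³ g) ≐ c
  pull-inverseˡ g c j = trans (pull-pull c (S³ (g ⁻¹)) (S³ g) j)
    (trans (sum4-cong λ i → cong (c i *_) (S³-inverseˡ g i j)) (pull-id j))
    where
    pull-id : pull c idMat ≐ c
    pull-id = ∀₄
      (by-ring 4 (λ a b c d → a :* :1 :+ (b :* :0 :+ (c :* :0 :+ d :* :0)) , a) refl (c _) (c _) (c _) (c _))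
      (by-ring 4 (λ a b c d → a :* :0 :+ (b :* :1 :+ (c :* :0 :+ d :* :0)) , b) refl (c _) (c _) (c _) (c _))
      (by-ring 4 (λ a b c d → a :* :0 :+ (b :* :0 :+ (c :* :1 :+ d :* :0)) , c) refl (c _) (c _) (c _) (c _))
      (by-ring 4 (λ a b c d → a :* :0 :+ (b :* :0 :+ (c :* :0 :+ d :* :1)) , d) refl (c _) (c _) (c _) (c _))

  pull-inverseʳ : ∀ g c → pull (pull c (S³ g)) (S³ (g ⁻¹)) ≐ c
  pull-inverseʳ g c j = trans (pull-pull c (S³ g) (S³ (g ⁻¹)) j)
    (trans (sum4-cong λ i → cong (c i *_) (trans (S³-inverseʳ g i j) (sym (S³-inverseˡ g i j))))
      (trans (sym (pull-pull c (S³ (g ⁻¹)) (S³ g) j)) (pull-inverseˡ g c j)))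

  isΓ⁺ : ∀ {c} s → c ∝ oscPlane s → T (isΓ c)
  isΓ⁺ {c} nothing p  = Equivalence.from (T-∨ {anyF (λ t → projEq c (osc t))}) (inj₂ (projEq⁺ p))
  isΓ⁺ {c} (just t) p = Equivalence.from T-∨ (inj₁ (anyF⁺ (λ t → projEq c (osc t)) t (projEq⁺ p)))

  isΓ⁻ : ∀ {c} → T (isΓ c) → ∃ λ s → c ∝ oscPlane s
  isΓ⁻ {c} t with Equivalence.to (T-∨ {anyF (λ t → projEq c (osc t))}) t
  ... | inj₂ p = nothing , projEq⁻ {c} p
  ... | inj₁ p = let t , e = anyF⁻ (λ t → projEq c (osc t)) p in just t , projEq⁻ e

  isΓ-∝ : ∀ {c d} → c ∝ d → T (isΓ d) → T (isΓ c)
  isΓ-∝ {c} {d} cd t = let s , p = isΓ⁻ {d} t in isΓ⁺ {c} s (∝-trans {c} cd p)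

  isΓ-pull⁺ : ∀ g c → T (isΓ c) → T (isΓ (pull c (S³ g)))
  isΓ-pull⁺ g c t = let s , p = isΓ⁻ {c} t in
    isΓ⁺ (move (g ⁻¹) s) (∝-trans {pull c (S³ g)} (pull-∝ {c} (S³ g) (subst (λ s → c ∝ oscPlane s) (sym (move-inverseʳ g s)) p))
      (pull-oscPlane g (move (g ⁻¹) s)))

  isΓ-pull : ∀ g c → isΓ (pull c (S³ g)) ≡ isΓ c
  isΓ-pull g c = bool-ext
    (λ t → isΓ-∝ {c} (≐⇒∝ λ i → sym (pull-inverseʳ g c i)) (isΓ-pull⁺ (g ⁻¹) (pull c (S³ g)) t))
    (isΓ-pull⁺ g c)

  ∝-· : ∀ {c d} x → c ∝ d → d · x ≡ 0# → c · x ≡ 0#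
  ∝-· {c} {d} x (k , _ , e) dx = trans (·-congˡ x e) (trans (·-scaleˡ k d x) (trans (cong (k *_) dx) (zeroʳ k)))

  ·-∝ : ∀ c {x y} → x ∝ y → c · y ≡ 0# → c · x ≡ 0#
  ·-∝ c {x} {y} (k , _ , e) cy = trans (·-congʳ c e) (trans (·-scaleʳ c k y) (trans (cong (k *_) cy) (zeroʳ k)))

  pointsOfC≡ : ∀ c → pointsOfC c ≡ 𝓟.card (λ s → onPlane c (cubicPt s))
  pointsOfC≡ c = sym (∑≡countPt _)

  pointsOfC-∝ : ∀ {c d} → c ∝ d → pointsOfC c ≡ pointsOfC d
  pointsOfC-∝ {c} {d} p = trans (pointsOfC≡ c) (trans (𝓟.card-cong
    (λ s t → ≡ᶠ⁺ (∝-· {d} (cubicPt s) (∝-sym {c} p) (≡ᶠ⁻ t))) (λ s t → ≡ᶠ⁺ (∝-· {c} (cubicPt s) p (≡ᶠ⁻ t)))) (sym (pointsOfC≡ d)))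

  ∑-move : ∀ g f → 𝓟.∑ f ≡ 𝓟.∑ (λ s → f (move g s))
  ∑-move g = ∑-reindex 𝓟 𝓟 (move g) (move (g ⁻¹)) (move-inverseˡ g) (move-inverseʳ g)

  onPlane-move : ∀ g c s → onPlane c (cubicPt (move g s)) ≡ onPlane (pull c (S³ g)) (cubicPt s)
  onPlane-move g c s = bool-ext
    (λ t → ≡ᶠ⁺ (trans (pull-· c (S³ g) (cubicPt s)) (·-∝ c (act-cubicPt g s) (≡ᶠ⁻ t))))
    (λ t → ≡ᶠ⁺ (·-∝ c (∝-sym {act g (cubicPt s)} (act-cubicPt g s)) (trans (sym (pull-· c (S³ g) (cubicPt s))) (≡ᶠ⁻ t))))

  pointsOfC-pull : ∀ g c → pointsOfC (pull c (S³ g)) ≡ pointsOfC c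
  pointsOfC-pull g c = begin
    pointsOfC (pull c (S³ g))  ≡⟨ pointsOfC≡ (pull c (S³ g)) ⟩
    𝓟.card (λ s → onPlane (pull c (S³ g)) (cubicPt s))  ≡⟨ 𝓟.∑-cong (λ s → cong ind (onPlane-move g c s)) ⟨
    𝓟.card (λ s → onPlane c (cubicPt (move g s)))  ≡⟨ ∑-move g _ ⟨
    𝓟.card (λ s → onPlane c (cubicPt s))  ≡⟨ pointsOfC≡ c ⟨
    pointsOfC c  ∎
    where open ≡-Reasoning

  -- Each plane type depends only on the number of points on the cubic and on whether the plane is
  -- osculating, so the invariance of these two data settles all five types at once.
  typeByCount : PlaneType → ℕ → Bool → Bool
  typeByCount Γ-plane  n γ = γ
  typeByCount 0C-plane n γ = n ℕ.≡ᵇ 0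
  typeByCount 2C-plane n γ = n ℕ.≡ᵇ 2
  typeByCount 3C-plane n γ = n ℕ.≡ᵇ 3
  typeByCount 1̄C-plane n γ = (n ℕ.≡ᵇ 1) ∧ not γ

  hasType-byCount : ∀ π c {n γ} → pointsOfC c ≡ n → isΓ c ≡ γ → hasType π c ≡ typeByCount π n γ
  hasType-byCount Γ-plane  c refl refl = refl
  hasType-byCount 0C-plane c refl refl = refl
  hasType-byCount 2C-plane c refl refl = refl
  hasType-byCount 3C-plane c refl refl = refl
  hasType-byCount 1̄C-plane c refl refl = refl

  hasType-cong : ∀ π {c d} → pointsOfC c ≡ pointsOfC d → isΓ c ≡ isΓ d → hasType π c ≡ hasType π d
  hasType-cong π {c} {d} e f = trans (hasType-byCount π c e f) (sym (hasType-byCount π d refl refl))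

  hasType-pull : ∀ π g c → hasType π (pull c (S³ g)) ≡ hasType π c
  hasType-pull π g c = hasType-cong π {pull c (S³ g)} {c} (pointsOfC-pull g c) (isΓ-pull g c)

  hasType-∝ : ∀ π {c d} → c ∝ d → hasType π c ≡ hasType π d
  hasType-∝ π {c} {d} p = hasType-cong π {c} {d} (pointsOfC-∝ p) (bool-ext (isΓ-∝ {d} {c} (∝-sym {c} p)) (isΓ-∝ {c} p))

-- Planes through P(∞) and the pencil of planes on a standard line.

module Pencils {q : ℕ} (𝔽 : FiniteField q) (odd : q ℕ.% 2 ≡ 1) where
  open FieldTheory 𝔽
  open Squares 𝔽 odd
  open LinearAlgebra 𝔽
  open CanonicalForms 𝔽
  open TwistedCubic 𝔽

  e₀ : V
  e₀ = cubicPt nothing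

  dir : Carrier → Carrier → V
  dir a b = vec 0# b a 1#

  ·-e₀ : ∀ c → c · e₀ ≡ c 0F
  ·-e₀ c = by-ring 4 (λ a b c d → a :* :1 :+ (b :* :0 :+ (c :* :0 :+ d :* :0)) , a) refl (c _) (c _) (c _) (c _)

  ·-dir : ∀ c a b → c · dir a b ≡ c 1F * b + c 2F * a + c 3F
  ·-dir c a b = by-ring 6 (λ w x y z a b → w :* :0 :+ (x :* b :+ (y :* a :+ z :* :1)) , x :* b :+ y :* a :+ z) refl
    (c _) (c _) (c _) (c _) a b

  disc : V → Carrier
  disc c = c 2F * c 2F - 4# * (c 1F * c 3F)

  -- For a plane through P(∞) the other points of the cubic are the roots of c₁t² + c₂t + c₃.
  quadratic : V → Carrier → Carrier
  quadratic c t = c 1F * (t * t) + c 2F * t + c 3F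

  ·-cubicPt : ∀ c t → c 0F ≡ 0# → c · cubicPt (just t) ≡ quadratic c t
  ·-cubicPt c t c₀ = trans
    (by-ring 5 (λ w x y z t → w :* (t :* (t :* t)) :+ (x :* (t :* t) :+ (y :* t :+ z :* :1)) , w :* (t :* (t :* t)) :+ (x :* (t :* t) :+ y :* t :+ z)) refl (c _) (c _) (c _) (c _) t)
    (trans (cong (_+ quadratic c t) (x≡0⇒xy≡0 _ c₀)) (+-identityˡ _))

  complete-square : ∀ c t → (2# * c 1F * t + c 2F) * (2# * c 1F * t + c 2F) - disc c ≡ 4# * c 1F * quadratic c t
  complete-square c t = by-ring 4 (λ x y z t → (:2 :* x :* t :+ y) :* (:2 :* x :* t :+ y) :- (y :* y :- :4 :* (x :* z)) ,
    :4 :* x :* (x :* (t :* t) :+ y :* t :+ z)) refl (c _) (c _) (c _) t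

  module _ {α : Carrier} (α≢0 : α ≢ 0#) (β : Carrier) where
    private
      i : Carrier
      i = proj₁ (inverse α α≢0)

    affine⁻¹ : Carrier → Carrier
    affine⁻¹ z = i * (z - β)

    affine-inverseʳ : ∀ z → α * affine⁻¹ z + β ≡ z
    affine-inverseʳ z = trans (cong (_+ β) (inverse-cancelʳ (proj₂ (inverse α α≢0)) (z - β)))
      (by-ring 2 (λ z y → z :- y :+ y , z) refl z β)

    affine-injective : ∀ {s t} → α * s + β ≡ α * t + β → s ≡ t
    affine-injective {s} {t} e = *-cancelˡ α≢0 (trans (cancel s) (trans (cong (_- β) e) (sym (cancel t))))
      where
      cancel : ∀ s → α * s ≡ α * s + β - β
      cancel s = by-ring 3 (λ x s y → x :* s , x :* s :+ y :- y) refl α s β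

    affine-inverseˡ : ∀ s → affine⁻¹ (α * s + β) ≡ s
    affine-inverseˡ s = affine-injective (affine-inverseʳ (α * s + β))

    card-affine : ∀ p → card (λ s → p (α * s + β)) ≡ card p
    card-affine p = sym (∑-reindex 𝓕 𝓕 (λ s → α * s + β) affine⁻¹ affine-inverseˡ affine-inverseʳ (λ z → ind (p z)))

  pointsOfC-∞ : ∀ c → c 0F ≡ 0# → pointsOfC c ≡ suc (card (λ t → quadratic c t ≡ᶠ 0#))
  pointsOfC-∞ c c₀ = trans (pointsOfC≡ c) (trans (∑𝓟 _) (cong₂ ℕ._+_ (ind-true (≡ᶠ⁺ (trans (·-e₀ c) c₀)))
    (𝓕.card-cong (λ t e → ≡ᶠ⁺ (trans (sym (·-cubicPt c t c₀)) (≡ᶠ⁻ e))) (λ t e → ≡ᶠ⁺ (trans (·-cubicPt c t c₀) (≡ᶠ⁻ e))))))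

  quadratic-roots : ∀ c → c 1F ≢ 0# → card (λ t → quadratic c t ≡ᶠ 0#) ≡ roots (disc c)
  quadratic-roots c c₁ = trans (𝓕.card-cong
      (λ t e → ≡ᶠ⁺ (-≡0⇒≡ (trans (complete-square c t) (trans (cong (4# * c 1F *_) (≡ᶠ⁻ e)) (zeroʳ _)))))
      (λ t e → ≡ᶠ⁺ (*-cancel-0 (*-nonzero 4≢0 c₁) (trans (sym (complete-square c t)) (≡⇒-≡0 (≡ᶠ⁻ e))))))
    (card-affine (*-nonzero 2≢0 c₁) (c 2F) (λ z → (z * z) ≡ᶠ disc c))

  linear-root : ∀ c → c 1F ≡ 0# → c 2F ≢ 0# → card (λ t → quadratic c t ≡ᶠ 0#) ≡ 1
  linear-root c c₁ c₂ = trans (𝓕.card-cong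
      (λ t e → ≡ᶠ⁺ (trans (sym (linear t)) (≡ᶠ⁻ e))) (λ t e → ≡ᶠ⁺ (trans (linear t) (≡ᶠ⁻ e))))
    (trans (card-affine c₂ (c 3F) (λ z → z ≡ᶠ 0#)) card-0)
    where
    linear : ∀ t → quadratic c t ≡ c 2F * t + c 3F
    linear t = trans (cong (λ x → x * (t * t) + c 2F * t + c 3F) c₁) (by-ring 3 (λ y z t → :0 :* (t :* t) :+ y :* t :+ z , y :* t :+ z) refl (c _) (c _) t)

  -- A finite osculating plane has nonzero first coordinate and misses P(∞), so the only osculating
  -- plane through P(∞) is its own.
  Γ-at-∞ : ∀ c → c 0F ≡ 0# → T (isΓ c) → c 1F ≡ 0# × c 2F ≡ 0#
  Γ-at-∞ c c₀ t with isΓ⁻ {c} t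
  ... | nothing , k , _ , e = trans (e 1F) (zeroʳ k) , trans (e 2F) (zeroʳ k)
  ... | just _ , k , k≢0 , e = ⊥-elim (k≢0 (trans (sym (*-identityʳ k)) (trans (sym (e 0F)) c₀)))

  -- For a plane through P(∞) with `c₁ ≠ 0`: the quadratic has 1, 2 or 0 roots according to its
  -- discriminant, and P(∞) adds one more point of the cubic.
  typeBySign : PlaneType → Bool → Bool → Bool → Bool
  typeBySign Γ-plane  zero? square? nonsquare? = false
  typeBySign 0C-plane zero? square? nonsquare? = false
  typeBySign 2C-plane zero? square? nonsquare? = zero?
  typeBySign 3C-plane zero? square? nonsquare? = square?
  typeBySign 1̄C-plane zero? square? nonsquare? = nonsquare?

  typeOf : PlaneType → Carrier → Bool
  typeOf π d = typeBySign π (d ≡ᶠ 0#) (inClass square d) (inClass nonsquare d)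

  -- For the planes with `c₀ = c₁ = 0` and `c₂ ≠ 0`: they contain the tangent at P(∞) and meet the
  -- cubic in one further point.
  type-tangent : PlaneType → Bool
  type-tangent π = typeByCount π 2 false

  -- Three tests and a number of roots occur in only three combinations; listing these makes the
  -- comparison of types a finite table.
  data Sign : Bool → Bool → Bool → ℕ → Set where
    is-zero      : Sign true  false false 1
    is-square    : Sign false true  false 2
    is-nonsquare : Sign false false true  0

  sign : ∀ d → Sign (d ≡ᶠ 0#) (inClass square d) (inClass nonsquare d) (roots d)
  sign d with d ≟ 0# | isSquare d in e | roots-formula d
  ... | yes refl | false | _ = ⊥-elim (subst T e (isSquare⁺ 0# (zeroʳ 0#)))
  ... | yes refl | true  | r = subst (Sign true false false) (sym r) is-zero
  ... | no _ | true  | r = subst (Sign false true false) (sym r) is-square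
  ... | no _ | false | r = subst (Sign false false true) (sym r) is-nonsquare

  hasType-∞ : ∀ π c → c 0F ≡ 0# → c 1F ≢ 0# → hasType π c ≡ typeOf π (disc c)
  hasType-∞ π c c₀ c₁ = trans
    (hasType-byCount π c (trans (pointsOfC-∞ c c₀) (cong suc (quadratic-roots c c₁))) (bool-ext (λ t → c₁ (proj₁ (Γ-at-∞ c c₀ t))) λ ()))
    (table π (sign (disc c)))
    where
    table : ∀ π {z s n r} → Sign z s n r → typeByCount π (suc r) false ≡ typeBySign π z s n
    table Γ-plane  _ = refl
    table 0C-plane _ = refl
    table 2C-plane is-zero = refl
    table 2C-plane is-square = refl
    table 2C-plane is-nonsquare = refl
    table 3C-plane is-zero = refl
    table 3C-plane is-square = refl
    table 3C-plane is-nonsquare = refl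
    table 1̄C-plane is-zero = refl
    table 1̄C-plane is-square = refl
    table 1̄C-plane is-nonsquare = refl

  hasType-∞-tangent : ∀ π c → c 0F ≡ 0# → c 1F ≡ 0# → c 2F ≢ 0# → hasType π c ≡ type-tangent π
  hasType-∞-tangent π c c₀ c₁ c₂ =
    hasType-byCount π c (trans (pointsOfC-∞ c c₀) (cong suc (linear-root c c₁ c₂))) (bool-ext (λ t → c₂ (proj₂ (Γ-at-∞ c c₀ t))) λ ())

  base-indep : ∀ a b → Indep e₀ (dir a b)
  base-indep a b l m e =
    trans (by-ring 2 (λ l m → l , l :* :1 :+ m :* :0) refl l m) (e 0F) ,
    trans (by-ring 2 (λ l m → m , l :* :0 :+ m :* :1) refl l m) (e 3F)

  Based : GL₂ → Carrier → Carrier → V → V → Set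
  Based g a b u v = Same (act g e₀) (act g (dir a b)) u v

  module _ (a b : Carrier) where
    -- The pencil of planes through the line, each by one representative; the last coordinate is
    -- forced by incidence with `dir a b`. The value at `nothing` is the member containing the
    -- tangent at P(∞).
    φ : Maybe Carrier → V
    φ nothing  = vec 0# 0# 1# (- a)
    φ (just k) = vec 0# 1# k (- (b + k * a))

    φ-contains : ∀ k → Contains (φ k) e₀ (dir a b)
    φ-contains nothing  = ·-e₀ (φ nothing) , trans (·-dir (φ nothing) a b) (by-ring 2 (λ a b → :0 :* b :+ :1 :* a :+ :- a , :0) refl a b)
    φ-contains (just k) = ·-e₀ (φ (just k)) , trans (·-dir (φ (just k)) a b) (by-ring 3 (λ a b k → :1 :* b :+ k :* a :+ :- (b :+ k :* a) , :0) refl a b k)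

    φ-nonzero : ∀ k → ¬ (φ k ≐ zeroV)
    φ-nonzero nothing  e = 1≢0 (e 2F)
    φ-nonzero (just k) e = 1≢0 (e 1F)

    φ-injective : ∀ k k′ → φ k ∝ φ k′ → k ≡ k′
    φ-injective nothing nothing _ = refl
    φ-injective nothing (just k) (x , x≢0 , e) = ⊥-elim (x≢0 (trans (sym (*-identityʳ x)) (sym (e 1F))))
    φ-injective (just k) nothing (x , x≢0 , e) = ⊥-elim (1≢0 (trans (e 1F) (zeroʳ x)))
    φ-injective (just k) (just k′) (x , x≢0 , e) = cong just (trans (e 2F)
      (trans (cong (_* k′) (trans (sym (*-identityʳ x)) (sym (e 1F)))) (*-identityˡ k′)))

    φ-covers : ∀ c → ¬ (c ≐ zeroV) → Contains c e₀ (dir a b) → ∃ λ k → c ∝ φ k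
    φ-covers c c≢0 (ce , cd) = cover (c 1F ≟ 0#) (c 2F ≟ 0#)
      where
      c₀ : c 0F ≡ 0#
      c₀ = trans (sym (·-e₀ c)) ce
      c₃ : ∀ {x y} → c 1F ≡ x → c 2F ≡ y → c 3F ≡ - (x * b + y * a)
      c₃ refl refl = trans (by-ring 2 (λ z s → z , s :+ z :- s) refl (c 3F) (c 1F * b + c 2F * a))
        (trans (cong (_- (c 1F * b + c 2F * a)) (trans (sym (·-dir c a b)) cd)) (+-identityˡ _))
      cover : Dec (c 1F ≡ 0#) → Dec (c 2F ≡ 0#) → ∃ λ k → c ∝ φ k
      cover (no c₁≢0) _ = just k , c 1F , c₁≢0 , ∀₄ (trans c₀ (sym (zeroʳ _))) (sym (*-identityʳ _)) c₂
        (trans (c₃ refl c₂) (by-ring 4 (λ x k a b → :- (x :* b :+ x :* k :* a) , x :* :- (b :+ k :* a)) refl (c 1F) k a b))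
        where
        i k : Carrier
        i = proj₁ (inverse (c 1F) c₁≢0)
        k = i * c 2F
        c₂ : c 2F ≡ c 1F * k
        c₂ = sym (inverse-cancelʳ (proj₂ (inverse (c 1F) c₁≢0)) (c 2F))
      cover (yes c₁≡0) (no c₂≢0) = nothing , c 2F , c₂≢0 , ∀₄ (trans c₀ (sym (zeroʳ _))) (trans c₁≡0 (sym (zeroʳ _))) (sym (*-identityʳ _))
        (trans (c₃ c₁≡0 refl) (by-ring 3 (λ y a b → :- (:0 :* b :+ y :* a) , y :* :- a) refl (c 2F) a b))
      cover (yes c₁≡0) (yes c₂≡0) = ⊥-elim (c≢0 (∀₄ c₀ c₁≡0 c₂≡0
        (trans (c₃ c₁≡0 c₂≡0) (by-ring 2 (λ a b → :- (:0 :* b :+ :0 :* a) , :0) refl a b))))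

    -- The square is completed in the pencil parameter `k`. The idle factor `1#` gives the linear
    -- form the shape that `card-affine` expects.
    disc-φ : ∀ k → disc (φ (just k)) ≡ (1# * k + 2# * a) * (1# * k + 2# * a) - 4# * (a * a - b)
    disc-φ k = by-ring 3 (λ a b k → k :* k :- :4 :* (:1 :* (:- (b :+ k :* a))) , (:1 :* k :+ :2 :* a) :* (:1 :* k :+ :2 :* a) :- :4 :* (a :* a :- b)) refl a b k

    module _ (g : GL₂) {u v : V} (based : Based g a b u v) where
      private
        contains-pull : ∀ c → Contains c u v → Contains (pull c (S³ g)) e₀ (dir a b)
        contains-pull c cuv =
          let _ , _ , _ , s = based
              x , y = contains-sub c cuv s
          in trans (pull-· c (S³ g) e₀) x , trans (pull-· c (S³ g) (dir a b)) y

        pull-contains : ∀ c → Contains (pull c (S³ g)) e₀ (dir a b) → Contains c u v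
        pull-contains c (x , y) =
          let _ , _ , s , _ = based
          in contains-sub c (trans (sym (pull-· c (S³ g) e₀)) x , trans (sym (pull-· c (S³ g) (dir a b))) y) s

      -- Pulling back along `g` preserves types and carries the planes on the given line to those on
      -- the standard one. A normalized covector represents its plane uniquely, and so does a value
      -- of `φ`, whence proportionality is a bijection between the two.
      planesThrough≡ : ∀ π → planesThrough π u v ≡ 𝓟.card (λ k → hasType π (φ k))
      planesThrough≡ π = trans (sym (∑≡countV (λ c → ind (normalized c ∧ lineInPlane c u v ∧ hasType π c))))
        (card-bijection 𝓥 𝓟 (λ t k → projEq (pull (toV t) (S³ g)) (φ k)) to from)
        where
        plane : Tuple → Bool
        plane t = normalized (toV t) ∧ lineInPlane (toV t) u v ∧ hasType π (toV t)
        to : ∀ t → T (plane t) → Σ (Maybe Carrier) λ k → T (hasType π (φ k)) ×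
          T (projEq (pull (toV t) (S³ g)) (φ k)) × (∀ k′ → T (hasType π (φ k′)) → T (projEq (pull (toV t) (S³ g)) (φ k′)) → k′ ≡ k)
        to t p =
          let c = toV t
              n , r = ∧⁻ {normalized c} p
              l , h = ∧⁻ {lineInPlane c u v} r
              normal i ci≡1 _ = normalized⁻ {c} n
              c′≢0 = λ z → 1≢0 (trans (sym ci≡1) (trans (sym (pull-inverseʳ g c i)) (pull-zero (pull c (S³ g)) (S³ (g ⁻¹)) z i)))
              k , e = φ-covers (pull c (S³ g)) c′≢0 (contains-pull c (lineInPlane⁻ {c} {u} {v} l))
          in k , subst T (trans (sym (hasType-pull π g c)) (hasType-∝ π e)) h , projEq⁺ e ,
             λ k′ _ e′ → φ-injective k′ k (∝-trans {φ k′} (∝-sym {pull c (S³ g)} (projEq⁻ e′)) e)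
        from : ∀ k → T (hasType π (φ k)) → Σ Tuple λ t → T (plane t) ×
          T (projEq (pull (toV t) (S³ g)) (φ k)) × (∀ t′ → T (plane t′) → T (projEq (pull (toV t′) (S³ g)) (φ k)) → t′ ≡ t)
        from k h =
          let d = pull (φ k) (S³ (g ⁻¹))
              d≢0 = λ z → φ-nonzero k λ i → trans (sym (pull-inverseˡ g (φ k) i)) (pull-zero d (S³ g) z i)
              c , n , c∝d = normalize {d} d≢0
              t = fromV c
              t≐c = toV-fromV c
              ct∝d = ∝-trans {toV t} (≐⇒∝ t≐c) c∝d
              e = ∝-trans {pull (toV t) (S³ g)} (pull-∝ {toV t} (S³ g) ct∝d) (≐⇒∝ (pull-inverseˡ g (φ k)))
              nt = normal-resp t≐c n
          in t ,
             (normalized⁺ nt ∧⁺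
              lineInPlane⁺ {toV t} {u} {v} (pull-contains (toV t) (∝-· {pull (toV t) (S³ g)} {φ k} e₀ e (proj₁ (φ-contains k)) , ∝-· {pull (toV t) (S³ g)} {φ k} (dir a b) e (proj₂ (φ-contains k)))) ∧⁺
              subst T (trans (sym (hasType-∝ π e)) (hasType-pull π g (toV t))) h) ,
             projEq⁺ e ,
             λ t′ p e′ → fromV-cong (normalized-unique {toV t} {toV t′} nt (normalized⁻ (proj₁ (∧⁻ {normalized (toV t′)} p)))
               (∝-trans {toV t′} (≐⇒∝ λ i → sym (pull-inverseʳ g (toV t′) i))
                 (∝-trans {pull (pull (toV t′) (S³ g)) (S³ (g ⁻¹))} (pull-∝ {pull (toV t′) (S³ g)} (S³ (g ⁻¹))
                     (∝-trans {pull (toV t′) (S³ g)} (projEq⁻ e′) (∝-sym {pull (toV t) (S³ g)} e)))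
                   (≐⇒∝ (pull-inverseʳ g (toV t))))))
          where
          normal-resp : ∀ {c c′} → c′ ≐ c → Normalized c → Normalized c′
          normal-resp e (normal i x b) = normal i (trans (e i) x) λ k k<i → trans (e k) (b k k<i)

      planesThrough-formula : ∀ π → planesThrough π u v ≡ ind (type-tangent π) ℕ.+ card (λ z → typeOf π (z * z - 4# * (a * a - b)))
      planesThrough-formula π = begin
        planesThrough π u v  ≡⟨ planesThrough≡ π ⟩
        𝓟.card (λ k → hasType π (φ k))  ≡⟨ ∑𝓟 _ ⟩
        ind (hasType π (φ nothing)) ℕ.+ card (λ k → hasType π (φ (just k)))
          ≡⟨ cong₂ ℕ._+_ (cong ind (hasType-∞-tangent π (φ nothing) refl refl 1≢0))
               (𝓕.∑-cong λ k → cong ind (trans (hasType-∞ π (φ (just k)) refl 1≢0) (cong (typeOf π) (disc-φ k)))) ⟩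
        ind (type-tangent π) ℕ.+ card (λ k → typeOf π ((1# * k + 2# * a) * (1# * k + 2# * a) - 4# * (a * a - b)))
          ≡⟨ cong (ind (type-tangent π) ℕ.+_) (card-affine 1≢0 (2# * a) (λ z → typeOf π (z * z - 4# * (a * a - b)))) ⟩
        ind (type-tangent π) ℕ.+ card (λ z → typeOf π (z * z - 4# * (a * a - b)))  ∎
        where open ≡-Reasoning

-- Lines through one point of the cubic, in standard position.

module Lines {q : ℕ} (𝔽 : FiniteField q) (odd : q ℕ.% 2 ≡ 1) where
  open FieldTheory 𝔽
  open Squares 𝔽 odd
  open LinearAlgebra 𝔽
  open CanonicalForms 𝔽
  open TwistedCubic 𝔽
  open Pencils 𝔽 odd

  move-unique : ∀ g s t → act g (cubicPt s) ∝ cubicPt t → move g s ≡ t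
  move-unique g s t p = point-injective (move g s) t (∝-trans {cubicPt (move g s)} (∝-sym {act g (cubicPt s)} (act-cubicPt g s)) p)

  Span-∝ : ∀ {u v x y} → x ∝ y → Span u v y → Span u v x
  Span-∝ {x = x} (k , k≢0 , e) s = span-respˡ e (span-⊛ k s)

  Span-act⁻ : ∀ g {u v w} → Span (act g u) (act g v) (act g w) → Span u v w
  Span-act⁻ g {u} {v} {w} (l , m , e) = l , m , λ i → begin
    w i  ≡⟨ act-inverseˡ g w i ⟨
    act (g ⁻¹) (act g w) i  ≡⟨ apply-cong (S³ (g ⁻¹)) e i ⟩
    act (g ⁻¹) ((l ⊛ act g u) ⊕ (m ⊛ act g v)) i  ≡⟨ apply-linear (S³ (g ⁻¹)) l (act g u) m (act g v) i ⟩
    l * act (g ⁻¹) (act g u) i + m * act (g ⁻¹) (act g v) i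
      ≡⟨ cong₂ (λ x y → l * x + m * y) (act-inverseˡ g u i) (act-inverseˡ g v i) ⟩
    l * u i + m * v i  ∎
    where open ≡-Reasoning

  indep-act : ∀ g {u v} → Indep u v → Indep (act g u) (act g v)
  indep-act g {u} {v} uv l m e = uv l m λ i → begin
    l * u i + m * v i
      ≡⟨ cong₂ (λ x y → l * x + m * y) (act-inverseˡ g u i) (act-inverseˡ g v i) ⟨
    l * act (g ⁻¹) (act g u) i + m * act (g ⁻¹) (act g v) i
      ≡⟨ apply-linear (S³ (g ⁻¹)) l (act g u) m (act g v) i ⟨
    act (g ⁻¹) ((l ⊛ act g u) ⊕ (m ⊛ act g v)) i  ≡⟨ apply-cong (S³ (g ⁻¹)) e i ⟩
    act (g ⁻¹) zeroV i  ≡⟨ apply-zero i ⟩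
    0#  ∎
    where
    open ≡-Reasoning
    apply-zero : apply (S³ (g ⁻¹)) zeroV ≐ zeroV
    apply-zero i = trans (·-comm (S³ (g ⁻¹) i) zeroV) (zero-· (S³ (g ⁻¹) i))

  act-e₀ : ∀ g → act g e₀ ≐ point (GL₂.a g) (GL₂.c g)
  act-e₀ g i = trans (·-e₀ (S³ g i)) (∀₄ {λ i → S³ g i 0F ≡ point (GL₂.a g) (GL₂.c g) i} refl refl refl refl i)

  -- Only the first column of `g` matters, since it gives the image of P(∞); the second column
  -- completes it to determinant 1 or -1.
  frame : ∀ s → ∃ λ g → move g nothing ≡ s
  frame s = let g , e = at s in g , move-unique g nothing s (≐⇒∝ λ i →
      trans (act-e₀ g i) (trans (cong₂ (λ x y → point x y i) (proj₁ e) (proj₂ e)) (sym (cubicPt-hom s i))))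
    where
    at : ∀ s → ∃ λ g → GL₂.a g ≡ X s × GL₂.c g ≡ Y s
    at nothing = record { a = 1# ; b = 0# ; c = 0# ; d = 1# ; δ = 1#
      ; det = by-ring 0 ((:1 :* :1 :- :0 :* :0) :* :1 , :1) refl } , refl , refl
    at (just t) = record { a = t ; b = 1# ; c = 1# ; d = 0# ; δ = - 1#
      ; det = by-ring 1 (λ t → (t :* :0 :- :1 :* :1) :* :- :1 , :1) refl t } , refl , refl

  base-span : ∀ {a b w} → Span e₀ (dir a b) w → w 3F ≡ 1# → w 2F ≡ a × w 1F ≡ b
  base-span {a} {b} {w} (l , m , e) w₃ = component a (e 2F) , component b (e 1F)
    where
    m≡1 : m ≡ 1#
    m≡1 = trans (by-ring 2 (λ l m → m , l :* :0 :+ m :* :1) refl l m) (trans (sym (e 3F)) w₃)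
    component : ∀ {x} y → x ≡ l * 0# + m * y → x ≡ y
    component y e = trans e (trans (cong (λ m → l * 0# + m * y) m≡1) (by-ring 2 (λ l y → l :* :0 :+ :1 :* y , y) refl l y))

  -- Last coordinate 1 fixes the vector of the line up to multiples of `e₀`, so a finite point P(t)
  -- on it has `t = a` and `t² = b`, which means D = 0.
  point-on-base : ∀ {a b} s → a * a - b ≢ 0# → Span e₀ (dir a b) (cubicPt s) → s ≡ nothing
  point-on-base nothing _ _ = refl
  point-on-base {a} {b} (just t) D≢0 p = let t≡a , t²≡b = base-span {a} {b} {cubicPt (just t)} p refl in
    ⊥-elim (D≢0 (≡⇒-≡0 (trans (cong (λ x → x * x) (sym t≡a)) t²≡b)))

  record IsUnΓ (u v : V) : Set where
    field
      independent : Indep u v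
      one-point   : 𝓟.card (λ s → inSpan u v (cubicPt s)) ≡ 1
      no-Γ        : ∀ s → ¬ Contains (oscPlane s) u v

  UnΓ⁻ : ∀ {u v} → T (UnΓ u v) → IsUnΓ u v
  UnΓ⁻ {u} {v} t =
    let i , t₁ = ∧⁻ {indep u v} t
        c , t₂ = ∧⁻ {countPt (λ s → ind (inSpan u v (cubicPt s))) ℕ.≡ᵇ 1} t₁
        o , p = ∧⁻ {not (anyF (λ t → lineInPlane (osc t) u v))} t₂
    in record
      { independent = indep⁻ i
      ; one-point = trans (∑≡countPt _) (ℕ.≡ᵇ⇒≡ (countPt (λ s → ind (inSpan u v (cubicPt s)))) 1 c)
      ; no-Γ = λ { nothing q → not⁻ p (lineInPlane⁺ {oscPlane nothing} {u} {v} q)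
                 ; (just s) q → not⁻ o (anyF⁺ (λ t → lineInPlane (osc t) u v) s (lineInPlane⁺ {oscPlane (just s)} {u} {v} q)) }
      }

  UnΓ⁺ : ∀ {u v} → IsUnΓ u v → T (UnΓ u v)
  UnΓ⁺ {u} {v} r = indep⁺ independent ∧⁺ ℕ.≡⇒≡ᵇ (countPt (λ s → ind (inSpan u v (cubicPt s)))) 1 (trans (sym (∑≡countPt _)) one-point) ∧⁺
    not⁺ (λ t → let s , p = anyF⁻ (λ t → lineInPlane (osc t) u v) t in no-Γ (just s) (lineInPlane⁻ {osc s} {u} {v} p)) ∧⁺
    not⁺ (λ p → no-Γ nothing (lineInPlane⁻ {oscPlane nothing} {u} {v} p))
    where open IsUnΓ r

  point-on-based : ∀ {g a b u v} s → Based g a b u v → a * a - b ≢ 0# → Span u v (cubicPt s) → s ≡ move g nothing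
  point-on-based {g} {a} {b} {u} {v} s (_ , _ , sub , _) D≢0 p =
    trans (sym (move-inverseʳ g s)) (cong (move g) (point-on-base (move (g ⁻¹) s) D≢0 (Span-act⁻ g
      (Span-∝ {x = act g (cubicPt (move (g ⁻¹) s))} (subst (λ t → act g (cubicPt (move (g ⁻¹) s)) ∝ cubicPt t) (move-inverseʳ g s) (act-cubicPt g (move (g ⁻¹) s)))
        (span-trans p sub)))))

  base-point : ∀ {g a b u v} → Based g a b u v → Span u v (cubicPt (move g nothing))
  base-point {g} (_ , _ , _ , (p , _)) = Span-∝ (∝-sym {act g e₀} (act-cubicPt g nothing)) p

  Based⇒UnΓ : ∀ {g a b u v} → Based g a b u v → a * a - b ≢ 0# → IsUnΓ u v
  Based⇒UnΓ {g} {a} {b} {u} {v} based@(_ , uv , sub , sub′) D≢0 = record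
    { independent = uv
    ; one-point = 𝓟.card-point (move g nothing) (inSpan⁺ (base-point {g} {a} {b} based))
        (λ s p → point-on-based {g} {a} {b} {u} {v} s based D≢0 (inSpan⁻ {u} {v} p))
    ; no-Γ = λ s p → no-Γ′ (move (g ⁻¹) s) (subst (λ s → Contains (oscPlane s) u v) (sym (move-inverseʳ g s)) p)
    }
    where
    no-Γ′ : ∀ s → ¬ Contains (oscPlane (move g s)) u v
    no-Γ′ s p =
      let x , y = contains-sub (oscPlane (move g s)) p sub′
          c = pull (oscPlane (move g s)) (S³ g)
          c∝ = ∝-sym {c} (pull-oscPlane g s)
      in base s (∝-· e₀ c∝ (trans (pull-· (oscPlane (move g s)) (S³ g) e₀) x) ,
                 ∝-· (dir a b) c∝ (trans (pull-· (oscPlane (move g s)) (S³ g) (dir a b)) y))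
      where
      base : ∀ s → ¬ Contains (oscPlane s) e₀ (dir a b)
      base nothing (_ , y) = 1≢0 (trans (by-ring 2 (λ a b → :1 , :0 :* b :+ :0 :* a :+ :1) refl a b) (trans (sym (·-dir (oscPlane nothing) a b)) y))
      base (just t) (x , _) = 1≢0 (trans (sym (·-e₀ (oscPlane (just t)))) x)

  direction-along : ∀ {u v} → Span u v e₀ → ∀ w → Span u v w → w 3F ≢ 0# → ∃₂ λ a b → Span u v (dir a b)
  direction-along e₀-in w s w₃ = let i , wi = inverse (w 3F) w₃ in i * w 2F , i * w 1F ,
    span-trans {u = e₀} {v = w} (- (i * w 0F) , i , ∀₄
      (by-ring 2 (λ i w → :0 , :- (i :* w) :* :1 :+ i :* w) refl i (w 0F))
      (by-ring 3 (λ i w x → i :* x , :- (i :* w) :* :0 :+ i :* x) refl i (w 0F) (w 1F))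
      (by-ring 3 (λ i w x → i :* x , :- (i :* w) :* :0 :+ i :* x) refl i (w 0F) (w 2F))
      (trans (sym wi) (by-ring 3 (λ i w x → x :* i , :- (i :* w) :* :0 :+ i :* x) refl i (w 0F) (w 3F))))
    (e₀-in , s)

  direction-of : ∀ u v → Span u v e₀ → ¬ (u 3F ≡ 0# × v 3F ≡ 0#) → ∃₂ λ a b → Span u v (dir a b)
  direction-of u v e₀-in n with u 3F ≟ 0# | v 3F ≟ 0#
  ... | yes x | yes y = ⊥-elim (n (x , y))
  ... | no u₃ | _     = direction-along e₀-in u span-fst u₃
  ... | yes _ | no v₃ = direction-along e₀-in v span-snd v₃

  -- After moving back by `g`, the line contains P(∞) and is not inside the osculating plane
  -- `x₃ = 0`, so it has a direction with last coordinate 1. If D were 0, then `b = a²` and P(a)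
  -- would be a second point of the cubic on the line.
  UnΓ⇒Based : ∀ g {u v} → IsUnΓ u v → Span u v (cubicPt (move g nothing)) → ∃₂ λ a b → Based g a b u v × a * a - b ≢ 0#
  UnΓ⇒Based g {u} {v} r p = a , b , based , D≢0
    where
    open IsUnΓ r
    u′ v′ : V
    u′ = act (g ⁻¹) u
    v′ = act (g ⁻¹) v
    Γ-plane-at : V
    Γ-plane-at = oscPlane (move g nothing)
    on-Γ : ∀ x → act (g ⁻¹) x 3F ≡ 0# → Γ-plane-at · x ≡ 0#
    on-Γ x x₃ = trans (·-congʳ Γ-plane-at (λ i → sym (act-inverseʳ g x i)))
      (trans (sym (pull-· Γ-plane-at (S³ g) (act (g ⁻¹) x)))
        (∝-· {pull Γ-plane-at (S³ g)} (act (g ⁻¹) x) (pull-oscPlane g nothing)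
          (trans (by-ring 4 (λ a b c d → :0 :* a :+ (:0 :* b :+ (:0 :* c :+ :1 :* d)) , d) refl
            (act (g ⁻¹) x 0F) (act (g ⁻¹) x 1F) (act (g ⁻¹) x 2F) (act (g ⁻¹) x 3F)) x₃)))
    off-Γ : ¬ (u′ 3F ≡ 0# × v′ 3F ≡ 0#)
    off-Γ (x , y) = no-Γ (move g nothing) (on-Γ u x , on-Γ v y)
    e₀-in : Span u′ v′ e₀
    e₀-in = Span-∝ (act-scale⁻ g {e₀} (act-cubicPt g nothing)) (span-apply (S³ (g ⁻¹)) p)
    direction : ∃₂ λ a b → Span u′ v′ (dir a b)
    direction = direction-of u′ v′ e₀-in off-Γ
    a b : Carrier
    a = proj₁ direction
    b = proj₁ (proj₂ direction)
    dir-in : Span u′ v′ (dir a b)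
    dir-in = proj₂ (proj₂ direction)
    act-back : ∀ {x} → Span u′ v′ x → Span u v (act g x)
    act-back {x} s = span-trans (span-apply (S³ g) s)
      ((1# , 0# , λ n → trans (act-inverseʳ g u n) (by-ring 2 (λ u v → u , :1 :* u :+ :0 :* v) refl (u n) (v n))) ,
       (0# , 1# , λ n → trans (act-inverseʳ g v n) (by-ring 2 (λ u v → v , :0 :* u :+ :1 :* v) refl (u n) (v n))))
    based : Based g a b u v
    based = same-by-indep (indep-act g (base-indep a b)) (act-back e₀-in , act-back dir-in)
    D≢0 : a * a - b ≢ 0#
    D≢0 D≡0 = case (trans (sym (move-inverseˡ g (just a))) (trans (cong (move (g ⁻¹)) same) (move-inverseˡ g nothing)))
      where
      case : ¬ (just a ≡ nothing)
      case ()
      conic : cubicPt (just a) ≐ ((a * (a * a)) ⊛ e₀) ⊕ (1# ⊛ dir a b)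
      conic = ∀₄
        (by-ring 1 (λ a → a :* (a :* a) , a :* (a :* a) :* :1 :+ :1 :* :0) refl a)
        (trans (-≡0⇒≡ D≡0) (by-ring 2 (λ a b → b , a :* (a :* a) :* :0 :+ :1 :* b) refl a b))
        (by-ring 1 (λ a → a , a :* (a :* a) :* :0 :+ :1 :* a) refl a)
        (by-ring 1 (λ a → :1 , a :* (a :* a) :* :0 :+ :1 :* :1) refl a)
      second : Span u v (cubicPt (move g (just a)))
      second = Span-∝ (∝-sym {act g (cubicPt (just a))} (act-cubicPt g (just a)))
        (act-back (span-trans {u = e₀} {v = dir a b} (a * (a * a) , 1# , conic) (e₀-in , dir-in)))
      same : move g (just a) ≡ move g nothing
      same = 𝓟.card≡1⇒unique (λ s → inSpan u v (cubicPt s)) one-point (inSpan⁺ second) (inSpan⁺ p)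

  somePoint : ∀ {u v} → IsUnΓ u v → ∃ λ s → Span u v (cubicPt s)
  somePoint {u} {v} r =
    let s , p = 𝓟-witness (λ s → inSpan u v (cubicPt s)) (λ e → ℕ.1+n≢0 (trans (sym (IsUnΓ.one-point r)) e))
    in s , inSpan⁻ {u} {v} {cubicPt s} p

  UnΓ-frame : ∀ {u v} → IsUnΓ u v → ∃ λ g → ∃₂ λ a b → Based g a b u v × a * a - b ≢ 0#
  UnΓ-frame {u} {v} r =
    let s , p = somePoint r
        g , e = frame s
    in g , UnΓ⇒Based g r (subst (λ s → Span u v (cubicPt s)) (sym e) p)

  -- The orbits are told apart by the number of 2_C-planes through their lines.
  number-of-2C : Class → ℕ
  number-of-2C nonsquare = 1
  number-of-2C square    = 3

  -- Testing a number of planes keeps the set Boolean and free of the choice of frame, on which D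
  -- depends.
  O : Class → LineSet
  O j u v = UnΓ u v ∧ (planesThrough 2C-plane u v ℕ.≡ᵇ number-of-2C j)

  O⇒UnΓ : ∀ j {u v} → T (O j u v) → IsUnΓ u v
  O⇒UnΓ j {u} {v} t = UnΓ⁻ {u} {v} (proj₁ (∧⁻ {UnΓ u v} {planesThrough 2C-plane u v ℕ.≡ᵇ number-of-2C j} t))

  O⇒number-of-2C : ∀ j {u v} → T (O j u v) → planesThrough 2C-plane u v ≡ number-of-2C j
  O⇒number-of-2C j {u} {v} t =
    ℕ.≡ᵇ⇒≡ (planesThrough 2C-plane u v) (number-of-2C j) (proj₂ (∧⁻ {UnΓ u v} {planesThrough 2C-plane u v ℕ.≡ᵇ number-of-2C j} t))

  number-of-2C-injective : ∀ i j → number-of-2C i ≡ number-of-2C j → i ≡ j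
  number-of-2C-injective nonsquare nonsquare _ = refl
  number-of-2C-injective square square _ = refl

  -- The member of the pencil containing the tangent at P(∞) always counts; each other one
  -- corresponds to a square root of 4D, of which there are none or two.
  planes-2C : ∀ {g a b u v} j → Based g a b u v → T (inClass j (a * a - b)) → planesThrough 2C-plane u v ≡ number-of-2C j
  planes-2C {g} {a} {b} j based t = trans (planesThrough-formula a b g based 2C-plane)
    (trans (cong suc (card-shift-0 (4# * (a * a - b)))) (roots-class j (inClass-scale⁺ j 2≢0 t)))
    where
    roots-class : ∀ j {d} → T (inClass j d) → suc (roots d) ≡ number-of-2C j
    roots-class nonsquare t = cong suc (roots-nonsquare t)
    roots-class square t = cong suc (roots-square t)

  O⁺ : ∀ {g a b u v} j → Based g a b u v → T (inClass j (a * a - b)) → T (O j u v)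
  O⁺ {g} {a} {b} {u} {v} j based t = UnΓ⁺ {u} {v} (Based⇒UnΓ {g} {a} {b} {u} {v} based (inClass⇒≢0 j t)) ∧⁺ ℕ.≡⇒≡ᵇ (planesThrough 2C-plane u v) (number-of-2C j) (planes-2C {g} {a} {b} {u} {v} j based t)

  -- D lies in some class, whose number of planes is known, and the two classes have different
  -- numbers.
  O-class : ∀ {g a b u v} j → Based g a b u v → a * a - b ≢ 0# → T (O j u v) → T (inClass j (a * a - b))
  O-class {g} {a} {b} {u} {v} j based D≢0 t =
    let i , c = classify D≢0
        n = O⇒number-of-2C j {u} {v} t
    in subst (λ j → T (inClass j (a * a - b))) (number-of-2C-injective i j (trans (sym (planes-2C {g} {a} {b} {u} {v} i based c)) n)) c

  O-based : ∀ g {u v} j → T (O j u v) → Span u v (cubicPt (move g nothing)) → ∃₂ λ a b → Based g a b u v × T (inClass j (a * a - b))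
  O-based g {u} {v} j t p =
    let a , b , based , D≢0 = UnΓ⇒Based g {u} {v} (O⇒UnΓ j {u} {v} t) p
    in a , b , based , O-class {g} {a} {b} {u} {v} j based D≢0 t

  O-frame : ∀ {u v} j → T (O j u v) → ∃ λ g → ∃₂ λ a b → Based g a b u v × T (inClass j (a * a - b))
  O-frame {u} {v} j t =
    let g , a , b , based , D≢0 = UnΓ-frame {u} {v} (O⇒UnΓ j {u} {v} t)
    in g , a , b , based , O-class {g} {a} {b} {u} {v} j based D≢0 t

  UnΓ⇒O : ∀ {u v} → T (UnΓ u v) → ∃ λ j → T (O j u v)
  UnΓ⇒O {u} {v} t =
    let g , a , b , based , D≢0 = UnΓ-frame {u} {v} (UnΓ⁻ {u} {v} t)
        j , c = classify D≢0
    in j , O⁺ {g} {a} {b} {u} {v} j based c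

  O-disjoint : ∀ i j {u v} → T (O i u v) → T (O j u v) → i ≡ j
  O-disjoint i j {u} {v} s t = number-of-2C-injective i j
    (trans (sym (O⇒number-of-2C i {u} {v} s)) (O⇒number-of-2C j {u} {v} t))

-- Lines in a plane, sorted by their point on the cubic.

module Incidences {q : ℕ} (𝔽 : FiniteField q) (odd : q ℕ.% 2 ≡ 1) where
  open FieldTheory 𝔽
  open Squares 𝔽 odd
  open LinearAlgebra 𝔽
  open CanonicalForms 𝔽
  open TwistedCubic 𝔽
  open Pencils 𝔽 odd
  open Lines 𝔽 odd

  𝓕² : Summation (Carrier × Carrier)
  𝓕² = 𝓕 ×-summation 𝓕

  module 𝓕² = Summation 𝓕²

  baseCount : Class → V → ℕ
  baseCount j c = 𝓕².card λ (a , b) → inClass j (a * a - b) ∧ onPlane c (dir a b)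

  module _ {c : V} where
    private
      on-dir⁻ : ∀ {a b} → T (onPlane c (dir a b)) → c 1F * b + c 2F * a + c 3F ≡ 0#
      on-dir⁻ {a} {b} t = trans (sym (·-dir c a b)) (≡ᶠ⁻ t)

      on-dir⁺ : ∀ {a b} → c 1F * b + c 2F * a + c 3F ≡ 0# → T (onPlane c (dir a b))
      on-dir⁺ {a} {b} e = ≡ᶠ⁺ (trans (·-dir c a b) e)

    -- Incidence determines `b` from `a`, and for `z = 2 c₁ a + c₂` it turns `z² - disc c` into
    -- `(2 c₁)²` times `a² - b`. The square factor does not affect the class.
    baseCount-quadratic : ∀ j → c 1F ≢ 0# → baseCount j c ≡ shifted j (disc c)
    baseCount-quadratic j c₁ = card-bijection 𝓕² 𝓕 (λ (a , b) z → z ≡ᶠ (α * a + c 2F))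
      (λ (a , b) t → let k , o = ∧⁻ {inClass j (a * a - b)} t in
        α * a + c 2F , subst (λ d → T (inClass j d)) (sym (D≡ a b (on-dir⁻ o))) (inClass-scale⁺ j α≢0 k) , ≡ᶠ⁺ refl , λ _ _ e → ≡ᶠ⁻ e)
      λ z t →
        let a = affine⁻¹ α≢0 (c 2F) z
            b = i * - (c 2F * a + c 3F)
            a≡ = affine-inverseʳ α≢0 (c 2F) z
            o = trans (cong (λ x → x + c 2F * a + c 3F) (inverse-cancelʳ (proj₂ (inverse (c 1F) c₁)) (- (c 2F * a + c 3F))))
              (by-ring 3 (λ y z a → :- (y :* a :+ z) :+ y :* a :+ z , :0) refl (c 2F) (c 3F) a)
        in (a , b) ,
           (inClass-scale⁻ j α≢0 (subst (λ d → T (inClass j d)) (trans (cong (λ z → z * z - disc c) (sym a≡)) (D≡ a b o)) t) ∧⁺ on-dir⁺ {a} {b} o) ,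
           ≡ᶠ⁺ (sym a≡) ,
           λ (a′ , b′) t′ e →
             let a′≡a = affine-injective α≢0 (c 2F) (trans (sym (≡ᶠ⁻ e)) (sym a≡))
                 o′ = on-dir⁻ {a′} {b′} (proj₂ (∧⁻ {inClass j (a′ * a′ - b′)} t′))
             in cong₂ _,_ a′≡a (*-cancelˡ c₁ (trans (isolate a′ b′ o′) (trans (cong (λ a → - (c 2F * a + c 3F)) a′≡a) (sym (isolate a b o)))))
      where
      open ≡-Reasoning
      α i : Carrier
      α = 2# * c 1F
      i = proj₁ (inverse (c 1F) c₁)
      α≢0 : α ≢ 0#
      α≢0 = *-nonzero 2≢0 c₁
      isolate : ∀ a b → c 1F * b + c 2F * a + c 3F ≡ 0# → c 1F * b ≡ - (c 2F * a + c 3F)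
      isolate a b e = trans (by-ring 5 (λ x y z a b → x :* b , (x :* b :+ y :* a :+ z) :- (y :* a :+ z)) refl (c 1F) (c 2F) (c 3F) a b)
        (trans (cong (_- (c 2F * a + c 3F)) e) (+-identityˡ _))
      D≡ : ∀ a b → c 1F * b + c 2F * a + c 3F ≡ 0# → (α * a + c 2F) * (α * a + c 2F) - disc c ≡ α * α * (a * a - b)
      D≡ a b e = begin
        (α * a + c 2F) * (α * a + c 2F) - disc c  ≡⟨ complete-square c a ⟩
        4# * c 1F * quadratic c a
          ≡⟨ by-ring 5 (λ x y z a b → :4 :* x :* (x :* (a :* a) :+ y :* a :+ z) ,
               :2 :* x :* (:2 :* x) :* (a :* a :- b) :+ :4 :* x :* (x :* b :+ y :* a :+ z)) refl (c 1F) (c 2F) (c 3F) a b ⟩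
        α * α * (a * a - b) + 4# * c 1F * (c 1F * b + c 2F * a + c 3F)  ≡⟨ cong (λ e → α * α * (a * a - b) + 4# * c 1F * e) e ⟩
        α * α * (a * a - b) + 4# * c 1F * 0#  ≡⟨ by-ring 2 (λ s t → s :+ t :* :0 , s) refl _ (4# * c 1F) ⟩
        α * α * (a * a - b)  ∎

    -- With `c₁ = 0` incidence fixes `a` and leaves `b` free, so `a² - b` takes every value exactly
    -- once.
    baseCount-tangent : ∀ j → c 1F ≡ 0# → c 2F ≢ 0# → baseCount j c ≡ card (inClass j)
    baseCount-tangent j c₁ c₂ = card-bijection 𝓕² 𝓕 (λ (a , b) d → d ≡ᶠ (a * a - b))
      (λ (a , b) t → a * a - b , proj₁ (∧⁻ {inClass j (a * a - b)} t) , ≡ᶠ⁺ refl , λ _ _ e → ≡ᶠ⁻ e)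
      λ d t →
        let a = affine⁻¹ c₂ (c 3F) 0#
            D = by-ring 2 (λ a d → a :* a :- (a :* a :- d) , d) refl a d
        in (a , a * a - d) ,
           (subst (λ d → T (inClass j d)) (sym D) t ∧⁺ on-dir⁺ {a} {a * a - d} (trans (linear a (a * a - d)) (affine-inverseʳ c₂ (c 3F) 0#))) ,
           ≡ᶠ⁺ (sym D) ,
           λ (a′ , b′) t′ e →
             let o′ = on-dir⁻ {a′} {b′} (proj₂ (∧⁻ {inClass j (a′ * a′ - b′)} t′))
                 a′≡a = affine-injective c₂ (c 3F) (trans (sym (linear a′ b′)) (trans o′ (sym (affine-inverseʳ c₂ (c 3F) 0#))))
             in cong₂ _,_ a′≡a (trans (by-ring 2 (λ a b → b , a :* a :- (a :* a :- b)) refl a′ b′)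
                  (cong₂ (λ a d → a * a - d) a′≡a (sym (≡ᶠ⁻ e))))
      where
      linear : ∀ a b → c 1F * b + c 2F * a + c 3F ≡ c 2F * a + c 3F
      linear a b = trans (cong (λ x → x * b + c 2F * a + c 3F) c₁) (by-ring 4 (λ y z a b → :0 :* b :+ y :* a :+ z , y :* a :+ z) refl (c 2F) (c 3F) a b)

  baseCount-zero : ∀ j c → c ≐ zeroV → baseCount j c ≡ q ℕ.* card (inClass j)
  baseCount-zero j c c≐0 = begin
    baseCount j c  ≡⟨ 𝓕².card-cong (λ (a , b) t → proj₁ (∧⁻ {inClass j (a * a - b)} t))
                                                                      (λ (a , b) t → t ∧⁺ ≡ᶠ⁺ (trans (·-congˡ (dir a b) c≐0) (zero-· (dir a b)))) ⟩
    𝓕.∑ (λ a → card λ b → inClass j (a * a - b))  ≡⟨ 𝓕.∑-cong (λ a → ∑-reindex 𝓕 𝓕 (λ b → a * a - b) (λ b → a * a - b) (involutive a) (involutive a) (λ d → ind (inClass j d))) ⟨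
    𝓕.∑ (λ a → card (inClass j))  ≡⟨ 𝓕.∑-cong (λ _ → sym (ℕ.+-identityʳ _)) ⟩
    𝓕.∑ (λ a → 1 ℕ.* card (inClass j))  ≡⟨ 𝓕.∑-scaleʳ (card (inClass j)) (λ _ → 1) ⟩
    𝓕.∑ (λ _ → 1) ℕ.* card (inClass j)  ≡⟨ cong (ℕ._* card (inClass j)) ∑1≡q ⟩
    q ℕ.* card (inClass j)  ∎
    where
    open ≡-Reasoning
    involutive : ∀ a b → a * a - (a * a - b) ≡ b
    involutive a b = by-ring 2 (λ a b → a :* a :- (a :* a :- b) , b) refl a b

  selected : Class → V → V → V → Bool
  selected j c u v = rref u v ∧ O j u v ∧ lineInPlane c u v

  selected⁻ : ∀ j c u v → T (selected j c u v) → T (rref u v) × T (O j u v) × Contains c u v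
  selected⁻ j c u v t =
    let r , t′ = ∧⁻ {rref u v} {O j u v ∧ lineInPlane c u v} t
        o , l = ∧⁻ {O j u v} {lineInPlane c u v} t′
    in r , o , lineInPlane⁻ {c} {u} {v} l

  lineCount : Class → V → Maybe Carrier → ℕ
  lineCount j c s = 𝓥².card λ (t , t′) → selected j c (toV t) (toV t′) ∧ inSpan (toV t) (toV t′) (cubicPt s)

  -- Each line of the orbit has exactly one point on the cubic, so summing over the points counts it
  -- once.
  linesIn≡∑ : ∀ j c → linesIn (O j) c ≡ 𝓟.∑ (lineCount j c)
  linesIn≡∑ j c = begin
    linesIn (O j) c  ≡⟨ ∑≡countV² (λ u v → ind (selected j c u v)) ⟨
    𝓥².card (λ (t , t′) → selected j c (toV t) (toV t′))  ≡⟨ 𝓥².∑-cong (λ (t , t′) → spread (toV t) (toV t′)) ⟩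
    𝓥².∑ (λ (t , t′) → 𝓟.card λ s → selected j c (toV t) (toV t′) ∧ inSpan (toV t) (toV t′) (cubicPt s))
                                                                 ≡⟨ 𝓥².∑-swap 𝓟.additive (λ (t , t′) s → ind (selected j c (toV t) (toV t′) ∧ inSpan (toV t) (toV t′) (cubicPt s))) ⟩
    𝓟.∑ (lineCount j c)  ∎
    where
    open ≡-Reasoning
    spread : ∀ u v → ind (selected j c u v) ≡ 𝓟.card (λ s → selected j c u v ∧ inSpan u v (cubicPt s))
    spread u v with selected j c u v in e
    ... | false = sym 𝓟.∑-zero
    ... | true  = sym (IsUnΓ.one-point (O⇒UnΓ j {u} {v} (proj₁ (proj₂ (selected⁻ j c u v (subst T (sym e) tt))))))

  lineCount-off : ∀ j c s → c · cubicPt s ≢ 0# → lineCount j c s ≡ 0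
  lineCount-off j c s n = 𝓥².card-empty λ (t , t′) p →
    let u = toV t
        v = toV t′
        sel , on = ∧⁻ {selected j c u v} {inSpan u v (cubicPt s)} p
        _ , _ , l = selected⁻ j c u v sel
    in n (contains-span c {u} {v} {cubicPt s} l (inSpan⁻ {u} {v} {cubicPt s} on))

  Based-unique : ∀ g {a b a′ b′ u v} → Based g a b u v → Based g a′ b′ u v → (a′ , b′) ≡ (a , b)
  Based-unique g {a} {b} {a′} {b′} (_ , _ , s , _) (_ , _ , _ , (_ , d)) =
    let a≡ , b≡ = base-span {a} {b} {dir a′ b′} (Span-act⁻ g {e₀} {dir a b} {dir a′ b′} (span-trans d s)) refl
    in cong₂ _,_ a≡ b≡

  -- Moving the point to P(∞) parametrizes the lines through it by pairs `(a , b)`. Echelon form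
  -- selects one spanning pair for each line, and a line determines its `a` and `b`, so `sameLine`
  -- is a bijection.
  lineCount-on : ∀ j c g → c · cubicPt (move g nothing) ≡ 0# → lineCount j c (move g nothing) ≡ baseCount j (pull c (S³ g))
  lineCount-on j c g on = card-bijection 𝓥² 𝓕²
    (λ (t , t′) (a , b) → sameLine (act g e₀) (act g (dir a b)) (toV t) (toV t′)) to from
    where
    s₀ : Maybe Carrier
    s₀ = move g nothing
    line : Tuple × Tuple → Bool
    line (t , t′) = selected j c (toV t) (toV t′) ∧ inSpan (toV t) (toV t′) (cubicPt s₀)
    param : Carrier × Carrier → Bool
    param (a , b) = inClass j (a * a - b) ∧ onPlane (pull c (S³ g)) (dir a b)
    on-e₀ : c · act g e₀ ≡ 0#
    on-e₀ = ·-∝ c (act-cubicPt g nothing) on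
    to : ∀ x → T (line x) → Σ (Carrier × Carrier) λ (a , b) → T (param (a , b)) ×
      T (sameLine (act g e₀) (act g (dir a b)) (toV (proj₁ x)) (toV (proj₂ x))) ×
      (∀ y → T (param y) → T (sameLine (act g e₀) (act g (dir (proj₁ y) (proj₂ y))) (toV (proj₁ x)) (toV (proj₂ x))) → y ≡ (a , b))
    to (t , t′) p =
      let u = toV t
          v = toV t′
          sel , sp = ∧⁻ {selected j c u v} {inSpan u v (cubicPt s₀)} p
          _ , o , l = selected⁻ j c u v sel
          a , b , based , k = O-based g {u} {v} j o (inSpan⁻ {u} {v} sp)
          _ , _ , _ , s = based
          _ , d = contains-sub c l s
      in (a , b) , (k ∧⁺ ≡ᶠ⁺ (trans (pull-· c (S³ g) (dir a b)) d)) , sameLine⁺ {act g e₀} {act g (dir a b)} {u} {v} based ,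
         λ (a′ , b′) _ m → Based-unique g {a} {b} {a′} {b′} {u} {v} based (sameLine⁻ {act g e₀} {act g (dir a′ b′)} {u} {v} m)
    from : ∀ y → T (param y) → Σ (Tuple × Tuple) λ x → T (line x) ×
      T (sameLine (act g e₀) (act g (dir (proj₁ y) (proj₂ y))) (toV (proj₁ x)) (toV (proj₂ x))) ×
      (∀ x′ → T (line x′) → T (sameLine (act g e₀) (act g (dir (proj₁ y) (proj₂ y))) (toV (proj₁ x′)) (toV (proj₂ x′))) → x′ ≡ x)
    from (a , b) p = (fromV u , fromV v) , (rref⁺ R ∧⁺ O⁺ {g} {a} {b} {toV (fromV u)} {toV (fromV v)} j based (proj₁ kd) ∧⁺ lineInPlane⁺ {c} {toV (fromV u)} {toV (fromV v)} contained)
          ∧⁺ inSpan⁺ {toV (fromV u)} {toV (fromV v)} (base-point {g} {a} {b} {toV (fromV u)} {toV (fromV v)} based) ,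
        sameLine⁺ {act g e₀} {act g (dir a b)} {toV (fromV u)} {toV (fromV v)} based , unique
      where
      kd : T (inClass j (a * a - b)) × T (onPlane (pull c (S³ g)) (dir a b))
      kd = ∧⁻ {inClass j (a * a - b)} {onPlane (pull c (S³ g)) (dir a b)} p
      form : ∃₂ λ u v → Rref u v × Same (act g e₀) (act g (dir a b)) u v
      form = rref-exists (indep-act g (base-indep a b))
      u v : V
      u = proj₁ form
      v = proj₁ (proj₂ form)
      coordinates : Same u v (toV (fromV u)) (toV (fromV v))
      coordinates = same-by-indep (rref-indep (proj₁ (proj₂ (proj₂ form))))
        (span-respˡ (λ i → sym (toV-fromV u i)) span-fst , span-respˡ (λ i → sym (toV-fromV v i)) span-snd)
      R : Rref (toV (fromV u)) (toV (fromV v))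
      R = let echelon i j i<j ui vi vj uj ub vb = proj₁ (proj₂ (proj₂ form)) in echelon i j i<j
        (trans (toV-fromV u i) ui) (trans (toV-fromV v i) vi) (trans (toV-fromV v j) vj) (trans (toV-fromV u j) uj)
        (λ k l → trans (toV-fromV u k) (ub k l)) (λ k l → trans (toV-fromV v k) (vb k l))
      based : Based g a b (toV (fromV u)) (toV (fromV v))
      based = same-trans (proj₂ (proj₂ (proj₂ form))) coordinates
      contained : Contains c (toV (fromV u)) (toV (fromV v))
      contained = contains-sub c (on-e₀ , trans (sym (pull-· c (S³ g) (dir a b))) (≡ᶠ⁻ (proj₂ kd))) (proj₁ (proj₂ (proj₂ based)))
      unique : ∀ x′ → T (line x′) → T (sameLine (act g e₀) (act g (dir a b)) (toV (proj₁ x′)) (toV (proj₂ x′))) → x′ ≡ (fromV u , fromV v)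
      unique (t , t′) p′ m =
        let x = toV t
            y = toV t′
            r , _ = selected⁻ j c x y (proj₁ (∧⁻ {selected j c x y} {inSpan x y (cubicPt s₀)} p′))
            _ , _ , s , s′ = same-trans (same-sym (sameLine⁻ {act g e₀} {act g (dir a b)} {x} {y} m)) (proj₂ (proj₂ (proj₂ form)))
            eu , ev = rref-unique (proj₁ (proj₂ (proj₂ form))) (rref⁻ {x} {y} r) s′ s
        in cong₂ _,_ (fromV-cong eu) (fromV-cong ev)

-- Numbers of planes, numbers of lines, and orbit sizes.

module Counts {q : ℕ} (𝔽 : FiniteField q) (odd : q ℕ.% 2 ≡ 1) where
  open FieldTheory 𝔽
  open Squares 𝔽 odd
  open LinearAlgebra 𝔽
  open CanonicalForms 𝔽
  open TwistedCubic 𝔽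
  open Pencils 𝔽 odd
  open Lines 𝔽 odd
  open Incidences 𝔽 odd

  -- Twice the number of `z` with `z² - d` in the first class, for `d` in the second class; doubling
  -- avoids division.
  doubled : Class → Class → ℕ
  doubled square    square    = q ℕ.∸ 3
  doubled square    nonsquare = q ℕ.∸ 1
  doubled nonsquare square    = q ℕ.∸ 1
  doubled nonsquare nonsquare = q ℕ.+ 1

  m+n≡q⇒ : ∀ {m n} → m ℕ.+ n ≡ q → m ≡ q ℕ.∸ n
  m+n≡q⇒ {m} {n} e = trans (sym (ℕ.m+n∸n≡m m n)) (cong (ℕ._∸ n) e)

  shifted-doubled : ∀ i j {d} → T (inClass j d) → 2 ℕ.* shifted i d ≡ doubled i j
  shifted-doubled i j {d} t = go i j t
    where
    open ≡-Reasoning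
    S N : ℕ
    S = shifted square d
    N = shifted nonsquare d
    go : ∀ i j → T (inClass j d) → 2 ℕ.* shifted i d ≡ doubled i j
    go square square t = m+n≡q⇒ (begin
      2 ℕ.* S ℕ.+ 3  ≡⟨ ℕ.+-assoc (2 ℕ.* S) 2 1 ⟨
      2 ℕ.* S ℕ.+ 2 ℕ.+ 1  ≡⟨ cong (λ r → 2 ℕ.* S ℕ.+ r ℕ.+ 1) (roots-square t) ⟨
      2 ℕ.* S ℕ.+ roots d ℕ.+ 1  ≡⟨ shifted-square (inClass⇒≢0 square t) ⟩
      q  ∎)
    go square nonsquare t = m+n≡q⇒ (begin
      2 ℕ.* S ℕ.+ 1  ≡⟨ cong (ℕ._+ 1) (ℕ.+-identityʳ (2 ℕ.* S)) ⟨
      2 ℕ.* S ℕ.+ 0 ℕ.+ 1  ≡⟨ cong (λ r → 2 ℕ.* S ℕ.+ r ℕ.+ 1) (roots-nonsquare t) ⟨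
      2 ℕ.* S ℕ.+ roots d ℕ.+ 1  ≡⟨ shifted-square (inClass⇒≢0 nonsquare t) ⟩
      q  ∎)
    -- The hyperbola gives the square values only. The nonsquare values are what remains of the
    -- total `shifted-sum`, doubled so that the known equation for `S` can be cancelled.
    go nonsquare square t = m+n≡q⇒ (ℕ.+-cancelʳ-≡ (2 ℕ.* S ℕ.+ 3) _ _ (begin
      2 ℕ.* N ℕ.+ 1 ℕ.+ (2 ℕ.* S ℕ.+ 3)  ≡⟨ solve 2 (λ n s → con 2 :*′ n :+′ con 1 :+′ (con 2 :*′ s :+′ con 3) := con 2 :*′ (n :+′ (s :+′ con 2))) refl N S ⟩
      2 ℕ.* (N ℕ.+ (S ℕ.+ 2))  ≡⟨ cong (λ r → 2 ℕ.* (N ℕ.+ (S ℕ.+ r))) (roots-square t) ⟨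
      2 ℕ.* (N ℕ.+ (S ℕ.+ roots d))  ≡⟨ cong (2 ℕ.*_) (shifted-sum d) ⟩
      2 ℕ.* q  ≡⟨ cong (q ℕ.+_) (ℕ.+-identityʳ q) ⟩
      q ℕ.+ q  ≡⟨ cong (q ℕ.+_) (shifted-square (inClass⇒≢0 square t)) ⟨
      q ℕ.+ (2 ℕ.* S ℕ.+ roots d ℕ.+ 1)  ≡⟨ cong (λ r → q ℕ.+ (2 ℕ.* S ℕ.+ r ℕ.+ 1)) (roots-square t) ⟩
      q ℕ.+ (2 ℕ.* S ℕ.+ 2 ℕ.+ 1)  ≡⟨ cong (q ℕ.+_) (ℕ.+-assoc (2 ℕ.* S) 2 1) ⟩
      q ℕ.+ (2 ℕ.* S ℕ.+ 3)  ∎))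
      where open +-*-Solver renaming (_:+_ to _:+′_; _:*_ to _:*′_)
    go nonsquare nonsquare t = ℕ.+-cancelʳ-≡ (2 ℕ.* S) _ _ (begin
      2 ℕ.* N ℕ.+ 2 ℕ.* S  ≡⟨ solve 2 (λ n s → con 2 :*′ n :+′ con 2 :*′ s := con 2 :*′ (n :+′ (s :+′ con 0))) refl N S ⟩
      2 ℕ.* (N ℕ.+ (S ℕ.+ 0))  ≡⟨ cong (λ r → 2 ℕ.* (N ℕ.+ (S ℕ.+ r))) (roots-nonsquare t) ⟨
      2 ℕ.* (N ℕ.+ (S ℕ.+ roots d))  ≡⟨ cong (2 ℕ.*_) (shifted-sum d) ⟩
      2 ℕ.* q  ≡⟨ cong (q ℕ.+_) (ℕ.+-identityʳ q) ⟩
      q ℕ.+ q  ≡⟨ cong (q ℕ.+_) (shifted-square (inClass⇒≢0 nonsquare t)) ⟨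
      q ℕ.+ (2 ℕ.* S ℕ.+ roots d ℕ.+ 1)  ≡⟨ cong (λ r → q ℕ.+ (2 ℕ.* S ℕ.+ r ℕ.+ 1)) (roots-nonsquare t) ⟩
      q ℕ.+ (2 ℕ.* S ℕ.+ 0 ℕ.+ 1)  ≡⟨ solve 2 (λ n s → n :+′ (con 2 :*′ s :+′ con 0 :+′ con 1) := n :+′ con 1 :+′ con 2 :*′ s) refl q S ⟩
      q ℕ.+ 1 ℕ.+ 2 ℕ.* S  ∎)
      where open +-*-Solver renaming (_:+_ to _:+′_; _:*_ to _:*′_)

  class-doubled : ∀ j → 2 ℕ.* card (inClass j) ≡ q ℕ.∸ 1
  class-doubled j = m+n≡q⇒ (card-class j)

  planes-empty : ∀ π j → (∀ d → typeOf π d ≡ false) → type-tangent π ≡ false →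
    PiIs π (O j) (λ n → n ≡ 0)
  planes-empty π j e e′ u v t =
    let g , a , b , based , _ = O-frame {u} {v} j t
    in trans (planesThrough-formula a b g {u} {v} based π)
         (cong₂ ℕ._+_ (cong ind e′) (𝓕.card-empty λ z p → subst T (e (z * z - 4# * (a * a - b))) p))

  planes-2C-through : ∀ j → PiIs 2C-plane (O j) (λ n → n ≡ number-of-2C j)
  planes-2C-through j u v t = O⇒number-of-2C j {u} {v} t

  planes-3C-through : ∀ j → PiIs 3C-plane (O j) (λ n → 2 ℕ.* n ≡ doubled square j)
  planes-3C-through j u v t =
    let g , a , b , based , k = O-frame {u} {v} j t
    in trans (cong (2 ℕ.*_) (planesThrough-formula a b g {u} {v} based 3C-plane)) (shifted-doubled square j (inClass-scale⁺ j 2≢0 k))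

  planes-1̄C-through : ∀ j → PiIs 1̄C-plane (O j) (λ n → 2 ℕ.* n ≡ doubled nonsquare j)
  planes-1̄C-through j u v t =
    let g , a , b , based , k = O-frame {u} {v} j t
    in trans (cong (2 ℕ.*_) (planesThrough-formula a b g {u} {v} based 1̄C-plane)) (shifted-doubled nonsquare j (inClass-scale⁺ j 2≢0 k))

  -- This serves the planes all of whose points on the cubic contribute equally; the factor
  -- `pointsOfC c` then accounts for the sum over points.
  linesIn-pointwise : ∀ j c n → (∀ g → c · cubicPt (move g nothing) ≡ 0# → 2 ℕ.* baseCount j (pull c (S³ g)) ≡ n) →
    2 ℕ.* linesIn (O j) c ≡ pointsOfC c ℕ.* n
  linesIn-pointwise j c n f = begin
    2 ℕ.* linesIn (O j) c  ≡⟨ cong (2 ℕ.*_) (linesIn≡∑ j c) ⟩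
    2 ℕ.* 𝓟.∑ (lineCount j c)  ≡⟨ 𝓟.∑-scale 2 (lineCount j c) ⟨
    𝓟.∑ (λ s → 2 ℕ.* lineCount j c s)  ≡⟨ 𝓟.∑-cong at ⟩
    𝓟.∑ (λ s → ind (onPlane c (cubicPt s)) ℕ.* n)  ≡⟨ 𝓟.∑-scaleʳ n (λ s → ind (onPlane c (cubicPt s))) ⟩
    𝓟.card (λ s → onPlane c (cubicPt s)) ℕ.* n  ≡⟨ cong (ℕ._* n) (pointsOfC≡ c) ⟨
    pointsOfC c ℕ.* n  ∎
    where
    open ≡-Reasoning
    at-point : ∀ {s} → Dec (c · cubicPt s ≡ 0#) → ∃ (λ g → move g nothing ≡ s) →
      2 ℕ.* lineCount j c s ≡ ind (onPlane c (cubicPt s)) ℕ.* n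
    at-point {s} (no off) _ = trans (cong (2 ℕ.*_) (lineCount-off j c s off))
      (cong (ℕ._* n) (sym (ind-false {onPlane c (cubicPt s)} λ t → off (≡ᶠ⁻ t))))
    at-point (yes on) (g , refl) = trans (cong (2 ℕ.*_) (lineCount-on j c g on)) (trans (f g on) (trans (sym (ℕ.+-identityʳ n))
      (cong (ℕ._* n) (sym (ind-true {onPlane c (cubicPt (move g nothing))} (≡ᶠ⁺ on))))))
    at : ∀ s → 2 ℕ.* lineCount j c s ≡ ind (onPlane c (cubicPt s)) ℕ.* n
    at s = at-point (c · cubicPt s ≟ 0#) (frame s)

  -- The order of contact with the cubic at P(∞) is 1, 2 or 3.
  data At∞ (c : V) : Set where
    transversal : c 1F ≢ 0# → At∞ c
    tangent     : c 1F ≡ 0# → c 2F ≢ 0# → At∞ c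
    osculating∞ : T (isΓ c) → pointsOfC c ≡ 1 → At∞ c

  at∞ : ∀ c → c 0F ≡ 0# → ¬ (c ≐ zeroV) → At∞ c
  at∞ c c₀ c≢0 with c 1F ≟ 0# | c 2F ≟ 0#
  ... | no c₁  | _      = transversal c₁
  ... | yes c₁ | no c₂  = tangent c₁ c₂
  ... | yes c₁ | yes c₂ = osculating∞
    (isΓ⁺ {c} nothing (c 3F , c₃ , ∀₄ (trans c₀ (sym (zeroʳ _))) (trans c₁ (sym (zeroʳ _))) (trans c₂ (sym (zeroʳ _))) (sym (*-identityʳ _))))
    (trans (pointsOfC-∞ c c₀) (cong suc (𝓕.card-empty λ t e → c₃ (trans (sym (constant t)) (≡ᶠ⁻ e)))))
    where
    c₃ : c 3F ≢ 0#
    c₃ z = c≢0 (∀₄ c₀ c₁ c₂ z)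
    constant : ∀ t → quadratic c t ≡ c 3F
    constant t = trans (cong₂ (λ x y → x * (t * t) + y * t + c 3F) c₁ c₂) (by-ring 2 (λ t z → :0 :* (t :* t) :+ :0 :* t :+ z , z) refl t (c 3F))

  pull-nonzero : ∀ g {c} → Normalized c → ¬ (pull c (S³ g) ≐ zeroV)
  pull-nonzero g {c} (normal i ci≡1 _) z =
    1≢0 (trans (sym ci≡1) (trans (sym (pull-inverseʳ g c i)) (pull-zero (pull c (S³ g)) (S³ (g ⁻¹)) z i)))

  pull-at-∞ : ∀ g c → c · cubicPt (move g nothing) ≡ 0# → pull c (S³ g) 0F ≡ 0#
  pull-at-∞ g c on = trans (sym (·-e₀ (pull c (S³ g)))) (trans (pull-· c (S³ g) e₀) (·-∝ c (act-cubicPt g nothing) on))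

  -- Tangent and osculating planes have only two points and one point of the cubic, so contact is
  -- transversal and the discriminant is a nonzero square.
  baseCount-3C : ∀ j c → T (hasType 3C-plane c) → c 0F ≡ 0# → At∞ c → 2 ℕ.* baseCount j c ≡ doubled j square
  baseCount-3C j c t c₀ (transversal c₁) = trans (cong (2 ℕ.*_) (baseCount-quadratic {c} j c₁))
    (shifted-doubled j square (subst T (hasType-∞ 3C-plane c c₀ c₁) t))
  baseCount-3C j c t c₀ (tangent c₁ c₂) = ⊥-elim (subst T (hasType-∞-tangent 3C-plane c c₀ c₁ c₂) t)
  baseCount-3C j c t c₀ (osculating∞ _ n) = ⊥-elim (subst T (cong (ℕ._≡ᵇ 3) n) t)

  -- Tangency at P(∞) would bring a second point, and the osculating plane is excluded by the type,
  -- which leaves a nonsquare discriminant.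
  baseCount-1̄C : ∀ j c → T (hasType 1̄C-plane c) → c 0F ≡ 0# → At∞ c → 2 ℕ.* baseCount j c ≡ doubled j nonsquare
  baseCount-1̄C j c t c₀ (transversal c₁) = trans (cong (2 ℕ.*_) (baseCount-quadratic {c} j c₁))
    (shifted-doubled j nonsquare (subst T (hasType-∞ 1̄C-plane c c₀ c₁) t))
  baseCount-1̄C j c t c₀ (tangent c₁ c₂) = ⊥-elim (subst T (hasType-∞-tangent 1̄C-plane c c₀ c₁ c₂) t)
  baseCount-1̄C j c t c₀ (osculating∞ γ _) = ⊥-elim (not⁻ (proj₂ (∧⁻ {pointsOfC c ℕ.≡ᵇ 1} {not (isΓ c)} t)) γ)

  lines-3C : ∀ j c → Normalized c → T (hasType 3C-plane c) → 2 ℕ.* linesIn (O j) c ≡ 3 ℕ.* doubled j square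
  lines-3C j c c-normal t = trans
    (linesIn-pointwise j c (doubled j square) λ g on →
      baseCount-3C j (pull c (S³ g)) (subst T (sym (hasType-pull 3C-plane g c)) t) (pull-at-∞ g c on)
        (at∞ (pull c (S³ g)) (pull-at-∞ g c on) (pull-nonzero g c-normal)))
    (cong (ℕ._* doubled j square) (ℕ.≡ᵇ⇒≡ (pointsOfC c) 3 t))

  lines-1̄C : ∀ j c → Normalized c → T (hasType 1̄C-plane c) → 2 ℕ.* linesIn (O j) c ≡ doubled j nonsquare
  lines-1̄C j c c-normal t = trans
    (linesIn-pointwise j c (doubled j nonsquare) λ g on →
      baseCount-1̄C j (pull c (S³ g)) (subst T (sym (hasType-pull 1̄C-plane g c)) t) (pull-at-∞ g c on)
        (at∞ (pull c (S³ g)) (pull-at-∞ g c on) (pull-nonzero g c-normal)))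
    (trans (cong (ℕ._* doubled j nonsquare) (ℕ.≡ᵇ⇒≡ (pointsOfC c) 1 (proj₁ (∧⁻ {pointsOfC c ℕ.≡ᵇ 1} {not (isΓ c)} t))))
           (ℕ.+-identityʳ (doubled j nonsquare)))

  lines-Γ : ∀ j c → T (isΓ c) → linesIn (O j) c ≡ 0
  lines-Γ j c t = trans (sym (∑≡countV² (λ u v → ind (selected j c u v)))) (𝓥².card-empty λ (x , y) p →
    let u = toV x
        v = toV y
        _ , o , cu , cv = selected⁻ j c u v p
        s , c∝ = isΓ⁻ {c} t
    in IsUnΓ.no-Γ (O⇒UnΓ j {u} {v} o) s (∝-· u (∝-sym {c} c∝) cu , ∝-· v (∝-sym {c} c∝) cv))

  lines-0C : ∀ j c → T (hasType 0C-plane c) → linesIn (O j) c ≡ 0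
  lines-0C j c t = trans (linesIn≡∑ j c) (𝓟.∑-vanish λ s → lineCount-off j c s λ e →
    𝓟.card≡0⇒empty (λ s → onPlane c (cubicPt s)) (trans (sym (pointsOfC≡ c)) (ℕ.≡ᵇ⇒≡ (pointsOfC c) 0 t)) s (≡ᶠ⁺ e))

  -- The zero covector is incident with every line and with all `q + 1` points of the cubic, so the
  -- count of lines in a plane, applied to it, counts the whole orbit. At each point `a` is free and
  -- D runs through the class.
  size-doubled : ∀ j → 2 ℕ.* size (O j) ≡ q ℕ.^ 3 ℕ.∸ q
  size-doubled j = begin
    2 ℕ.* size (O j)  ≡⟨ cong (2 ℕ.*_) all-lines ⟩
    2 ℕ.* linesIn (O j) zeroV  ≡⟨ linesIn-pointwise j zeroV (q ℕ.* (q ℕ.∸ 1)) at ⟩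
    pointsOfC zeroV ℕ.* (q ℕ.* (q ℕ.∸ 1))  ≡⟨ cong (ℕ._* (q ℕ.* (q ℕ.∸ 1))) points ⟩
    suc q ℕ.* (q ℕ.* (q ℕ.∸ 1))  ≡⟨ arithmetic q (card (inClass j)) (card-class j) ⟩
    q ℕ.^ 3 ℕ.∸ q  ∎
    where
    open ≡-Reasoning
    all-lines : size (O j) ≡ linesIn (O j) zeroV
    all-lines = trans (sym (∑≡countV² (λ u v → ind (rref u v ∧ O j u v)))) (trans
      (𝓥².card-cong
        (λ (x , y) p → let r , o = ∧⁻ {rref (toV x) (toV y)} {O j (toV x) (toV y)} p in
          r ∧⁺ o ∧⁺ lineInPlane⁺ {zeroV} {toV x} {toV y} (zero-· (toV x) , zero-· (toV y)))
        (λ (x , y) p → let r , o = ∧⁻ {rref (toV x) (toV y)} {O j (toV x) (toV y) ∧ lineInPlane zeroV (toV x) (toV y)} p in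
          r ∧⁺ proj₁ (∧⁻ {O j (toV x) (toV y)} {lineInPlane zeroV (toV x) (toV y)} o)))
      (∑≡countV² (λ u v → ind (selected j zeroV u v))))
    at : ∀ g → zeroV · cubicPt (move g nothing) ≡ 0# → 2 ℕ.* baseCount j (pull zeroV (S³ g)) ≡ q ℕ.* (q ℕ.∸ 1)
    at g _ = begin
      2 ℕ.* baseCount j (pull zeroV (S³ g))  ≡⟨ cong (2 ℕ.*_) (baseCount-zero j (pull zeroV (S³ g)) λ k → zero-· (λ i → S³ g i k)) ⟩
      2 ℕ.* (q ℕ.* card (inClass j))  ≡⟨ solve 2 (λ q c → con 2 :*′ (q :*′ c) := q :*′ (con 2 :*′ c)) refl q (card (inClass j)) ⟩
      q ℕ.* (2 ℕ.* card (inClass j))  ≡⟨ cong (q ℕ.*_) (class-doubled j) ⟩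
      q ℕ.* (q ℕ.∸ 1)  ∎
      where open +-*-Solver renaming (_:+_ to _:+′_; _:*_ to _:*′_)
    points : pointsOfC zeroV ≡ suc q
    points = trans (pointsOfC≡ zeroV) (trans (∑𝓟 _) (cong₂ ℕ._+_ (ind-true (≡ᶠ⁺ (zero-· e₀)))
      (trans (𝓕.∑-cong λ t → ind-true (≡ᶠ⁺ (zero-· (cubicPt (just t))))) ∑1≡q)))
    arithmetic : ∀ q c → 2 ℕ.* c ℕ.+ 1 ≡ q → suc q ℕ.* (q ℕ.* (q ℕ.∸ 1)) ≡ q ℕ.^ 3 ℕ.∸ q
    arithmetic q c refl = begin
      suc n ℕ.* (n ℕ.* (n ℕ.∸ 1))  ≡⟨ cong (λ m → suc n ℕ.* (n ℕ.* m)) (ℕ.m+n∸n≡m (2 ℕ.* c) 1) ⟩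
      suc n ℕ.* (n ℕ.* (2 ℕ.* c))  ≡⟨ ℕ.m+n∸n≡m _ n ⟨
      suc n ℕ.* (n ℕ.* (2 ℕ.* c)) ℕ.+ n ℕ.∸ n  ≡⟨ cong (ℕ._∸ n) (solve 1 (λ m → (con 1 :+′ (m :+′ con 1)) :*′ ((m :+′ con 1) :*′ m) :+′ (m :+′ con 1) := (m :+′ con 1) :^ 3) refl (2 ℕ.* c)) ⟩
      n ℕ.^ 3 ℕ.∸ n  ∎
      where
      open +-*-Solver renaming (_:+_ to _:+′_; _:*_ to _:*′_)
      n : ℕ
      n = 2 ℕ.* c ℕ.+ 1

-- Planes meeting the cubic in exactly two points.

module TangentPlanes {q : ℕ} (𝔽 : FiniteField q) (odd : q ℕ.% 2 ≡ 1) where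
  open FieldTheory 𝔽
  open Squares 𝔽 odd
  open LinearAlgebra 𝔽
  open CanonicalForms 𝔽
  open TwistedCubic 𝔽
  open Pencils 𝔽 odd
  open Lines 𝔽 odd
  open Incidences 𝔽 odd
  open Counts 𝔽 odd

  pull-⋆ : ∀ c g h → pull c (S³ (g ⋆ h)) ≐ pull (pull c (S³ g)) (S³ h)
  pull-⋆ c g h j = trans (sum4-cong {λ i → c i * S³ (g ⋆ h) i j} λ i → cong (c i *_) (sym (S³-⋆ g h i j)))
    (sym (pull-pull c (S³ g) (S³ h) j))

  translation : Carrier → GL₂
  translation r = record { a = 1# ; b = r ; c = 0# ; d = 1# ; δ = 1#
    ; det = by-ring 1 (λ r → (:1 :* :1 :- r :* :0) :* :1 , :1) refl r }

  -- Induces `t ↦ 1/t`, which reverses the coordinates and exchanges P(∞) with P(0).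
  swap : GL₂
  swap = record { a = 0# ; b = 1# ; c = 1# ; d = 0# ; δ = - 1#
    ; det = by-ring 0 ((:0 :* :0 :- :1 :* :1) :* :- :1 , :1) refl }

  module _ (c : V) (r : Carrier) (c₀ : c 0F ≡ 0#) where
    private
      translated : Fin 4 → (w x y z r : Expression 5) → Expression 5
      translated j w x y z r = E.∑₄ λ i → E.tuple w x y z i :* E.cubicMatrix :1 r :0 :1 i j

      drop : ∀ x y → c 0F * x + y ≡ y
      drop x y = trans (cong (_+ y) (x≡0⇒xy≡0 x c₀)) (+-identityˡ y)

    pull-translation₀ : pull c (S³ (translation r)) 0F ≡ 0#
    pull-translation₀ = trans (by-ring 5 (λ w x y z r → translated 0F w x y z r , w) refl (c 0F) (c 1F) (c 2F) (c 3F) r) c₀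

    pull-translation₁ : pull c (S³ (translation r)) 1F ≡ c 1F
    pull-translation₁ = trans (by-ring 5 (λ w x y z r → translated 1F w x y z r , w :* (:3 :* r) :+ x) refl
      (c 0F) (c 1F) (c 2F) (c 3F) r) (drop _ _)

    pull-translation₂ : pull c (S³ (translation r)) 2F ≡ 2# * c 1F * r + c 2F
    pull-translation₂ = trans (by-ring 5 (λ w x y z r → translated 2F w x y z r , w :* (:3 :* (r :* r)) :+ (:2 :* x :* r :+ y)) refl
      (c 0F) (c 1F) (c 2F) (c 3F) r) (drop _ _)

    pull-translation₃ : pull c (S³ (translation r)) 3F ≡ quadratic c r
    pull-translation₃ = trans (by-ring 5 (λ w x y z r → translated 3F w x y z r , w :* (r :* (r :* r)) :+ (x :* (r :* r) :+ y :* r :+ z)) refl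
      (c 0F) (c 1F) (c 2F) (c 3F) r) (drop _ _)

  pull-swap : ∀ c → pull c (S³ swap) ≐ vec (c 3F) (c 2F) (c 1F) (c 0F)
  pull-swap c = ∀₄
    (by-ring 4 (λ w x y z → swapped 0F w x y z , z) refl (c 0F) (c 1F) (c 2F) (c 3F))
    (by-ring 4 (λ w x y z → swapped 1F w x y z , y) refl (c 0F) (c 1F) (c 2F) (c 3F))
    (by-ring 4 (λ w x y z → swapped 2F w x y z , x) refl (c 0F) (c 1F) (c 2F) (c 3F))
    (by-ring 4 (λ w x y z → swapped 3F w x y z , w) refl (c 0F) (c 1F) (c 2F) (c 3F))
    where
    swapped : Fin 4 → (w x y z : Expression 4) → Expression 4
    swapped j w x y z = E.∑₄ λ i → E.tuple w x y z i :* E.cubicMatrix :0 :1 :1 :0 i j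

  -- Such a plane meets the cubic in P(∞) and P(0) only and is tangent at exactly one of them.
  record Standard (d : V) : Set where
    field
      d₀ : d 0F ≡ 0#
      d₃ : d 3F ≡ 0#
      d₁₂ : (d 1F ≡ 0# × d 2F ≢ 0#) ⊎ (d 1F ≢ 0# × d 2F ≡ 0#)

  -- The plane has exactly one finite point on the cubic: the double root `-c₂ / (2 c₁)` in the
  -- transversal case, where the discriminant is 0, and the simple root `-c₃ / c₂` in the tangent
  -- case. Translation brings it to P(0).
  standardize-at-∞ : ∀ c → T (hasType 2C-plane c) → c 0F ≡ 0# → At∞ c → ∃ λ r → Standard (pull c (S³ (translation r)))
  standardize-at-∞ c t c₀ (osculating∞ _ n) = ⊥-elim (subst T (cong (ℕ._≡ᵇ 2) n) t)
  standardize-at-∞ c t c₀ (transversal c₁) = r , record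
    { d₀ = pull-translation₀ c r c₀
    ; d₃ = trans (pull-translation₃ c r c₀) (*-cancel-0 (*-nonzero 4≢0 c₁) (begin
        4# * c 1F * quadratic c r  ≡⟨ complete-square c r ⟨
        (2# * c 1F * r + c 2F) * (2# * c 1F * r + c 2F) - disc c  ≡⟨ cong₂ (λ x y → x * x - y) r≡ (≡ᶠ⁻ (subst T (hasType-∞ 2C-plane c c₀ c₁) t)) ⟩
        0# * 0# - 0#  ≡⟨ by-ring 0 (:0 :* :0 :- :0 , :0) refl ⟩
        0#  ∎))
    ; d₁₂ = inj₂ ((λ z → c₁ (trans (sym (pull-translation₁ c r c₀)) z)) , trans (pull-translation₂ c r c₀) r≡)
    }
    where
    open ≡-Reasoning
    r : Carrier
    r = affine⁻¹ (*-nonzero 2≢0 c₁) (c 2F) 0#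
    r≡ : 2# * c 1F * r + c 2F ≡ 0#
    r≡ = affine-inverseʳ (*-nonzero 2≢0 c₁) (c 2F) 0#
  standardize-at-∞ c t c₀ (tangent c₁ c₂) = r , record
    { d₀ = pull-translation₀ c r c₀
    ; d₃ = trans (pull-translation₃ c r c₀) (trans (cong (λ x → x * (r * r) + c 2F * r + c 3F) c₁)
        (trans (by-ring 3 (λ y z r → :0 :* (r :* r) :+ y :* r :+ z , y :* r :+ z) refl (c 2F) (c 3F) r) (affine-inverseʳ c₂ (c 3F) 0#)))
    ; d₁₂ = inj₁ (trans (pull-translation₁ c r c₀) c₁ , λ z → c₂ (trans (sym (trans (cong (λ x → 2# * x * r + c 2F) c₁)
        (by-ring 2 (λ y r → :2 :* :0 :* r :+ y , y) refl (c 2F) r))) (trans (sym (pull-translation₂ c r c₀)) z)))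
    }
    where
    r : Carrier
    r = affine⁻¹ c₂ (c 3F) 0#

  Standard-resp : ∀ {c d} → d ≐ c → Standard c → Standard d
  Standard-resp e s = record { d₀ = trans (e 0F) d₀ ; d₃ = trans (e 3F) d₃ ; d₁₂ = case d₁₂ }
    where
    open Standard s
    case : _ → _
    case (inj₁ (x , y)) = inj₁ (trans (e 1F) x , λ z → y (trans (sym (e 2F)) z))
    case (inj₂ (x , y)) = inj₂ ((λ z → x (trans (sym (e 1F)) z)) , trans (e 2F) y)

  standardize-at : ∀ c g → Normalized c → T (hasType 2C-plane c) → c · cubicPt (move g nothing) ≡ 0# → ∃ λ h → Standard (pull c (S³ h))
  standardize-at c g c-normal t on =
    let r , std = standardize-at-∞ (pull c (S³ g)) (subst T (sym (hasType-pull 2C-plane g c)) t) (pull-at-∞ g c on)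
                    (at∞ (pull c (S³ g)) (pull-at-∞ g c on) (pull-nonzero g c-normal))
    in g ⋆ translation r , Standard-resp {pull (pull c (S³ g)) (S³ (translation r))} {pull c (S³ (g ⋆ translation r))} (pull-⋆ c g (translation r)) std

  standardize : ∀ c → Normalized c → T (hasType 2C-plane c) → ∃ λ h → Standard (pull c (S³ h))
  standardize c c-normal t = from-point (𝓟-witness (λ s → onPlane c (cubicPt s)) λ e →
      ℕ.1+n≢0 (trans (sym (ℕ.≡ᵇ⇒≡ (pointsOfC c) 2 t)) (trans (pointsOfC≡ c) e)))
    where
    from-frame : ∀ {s} → c · cubicPt s ≡ 0# → ∃ (λ g → move g nothing ≡ s) → ∃ λ h → Standard (pull c (S³ h))
    from-frame on (g , refl) = standardize-at c g c-normal t on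
    from-point : ∃ (λ s → T (onPlane c (cubicPt s))) → ∃ λ h → Standard (pull c (S³ h))
    from-point (s , on) = from-frame {s} (≡ᶠ⁻ on) (frame s)

  move-swap : ∀ g → move (g ⋆ swap) nothing ≡ move g (just 0#)
  move-swap g = move-unique (g ⋆ swap) nothing (move g (just 0#))
    (∝-trans {act (g ⋆ swap) e₀} {act g (cubicPt (just 0#))} {cubicPt (move g (just 0#))}
      (≐⇒∝ {act (g ⋆ swap) e₀} {act g (cubicPt (just 0#))} λ i → trans (act-⋆ g swap e₀ i) (apply-cong (S³ g) {act swap e₀} {cubicPt (just 0#)} swap-e₀ i))
      (act-cubicPt g (just 0#)))
    where
    swap-e₀ : act swap e₀ ≐ cubicPt (just 0#)
    swap-e₀ i = trans (act-e₀ swap i) (sym (cubicPt-hom (just 0#) i))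

  binomial-nonzero : ∀ x y t → (x ≡ 0# × y ≢ 0#) ⊎ (x ≢ 0# × y ≡ 0#) → t ≢ 0# → x * (t * t) + y * t ≢ 0#
  binomial-nonzero x y t (inj₁ (x≡0 , y≢0)) t≢0 e = *-nonzero y≢0 t≢0 (trans (sym (trans (cong (λ x → x * (t * t) + y * t) x≡0)
    (by-ring 2 (λ y t → :0 :* (t :* t) :+ y :* t , y :* t) refl y t))) e)
  binomial-nonzero x y t (inj₂ (x≢0 , y≡0)) t≢0 e = *-nonzero x≢0 (*-nonzero t≢0 t≢0) (trans (sym (trans (cong (λ y → x * (t * t) + y * t) y≡0)
    (by-ring 2 (λ x t → x :* (t :* t) :+ :0 :* t , x :* (t :* t)) refl x t))) e)

  baseCount-double : ∀ j c → c 1F ≢ 0# → c 2F ≡ 0# → c 3F ≡ 0# → baseCount j c ≡ shifted j 0#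
  baseCount-double j c c₁ c₂ c₃ = trans (baseCount-quadratic {c} j c₁) (cong (shifted j) (trans
    (cong₂ (λ y z → y * y - 4# * (c 1F * z)) c₂ c₃) (by-ring 1 (λ x → :0 :* :0 :- :4 :* (x :* :0) , :0) refl (c 1F))))

  -- Only P(∞) and P(0) contribute, and `swap` turns the second into the first while exchanging `c₁`
  -- and `c₂`. The point of tangency yields `card (inClass j)`; at the other the contact is
  -- transversal with discriminant 0, which yields `shifted j 0#`.
  lines-standard : ∀ j c g → Standard (pull c (S³ g)) → linesIn (O j) c ≡ card (inClass j) ℕ.+ shifted j 0#
  lines-standard j c g std = begin
    linesIn (O j) c  ≡⟨ linesIn≡∑ j c ⟩
    𝓟.∑ (lineCount j c)  ≡⟨ ∑-move g (lineCount j c) ⟩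
    𝓟.∑ (λ s → lineCount j c (move g s))  ≡⟨ ∑𝓟 (λ s → lineCount j c (move g s)) ⟩
    lineCount j c (move g nothing) ℕ.+ 𝓕.∑ (λ t → lineCount j c (move g (just t)))
      ≡⟨ cong₂ ℕ._+_ (lineCount-on j c g at-∞) (𝓕.∑-single 0# (λ t → lineCount j c (move g (just t))) λ t t≢0 → lineCount-off j c (move g (just t)) λ e → off t t≢0 e) ⟩
    baseCount j d ℕ.+ lineCount j c (move g (just 0#))  ≡⟨ cong (λ s → baseCount j d ℕ.+ lineCount j c s) swapped ⟨
    baseCount j d ℕ.+ lineCount j c (move (g ⋆ swap) nothing)  ≡⟨ cong (baseCount j d ℕ.+_) (lineCount-on j c (g ⋆ swap) at-0) ⟩
    baseCount j d ℕ.+ baseCount j d′  ≡⟨ total d₁₂ ⟩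
    card (inClass j) ℕ.+ shifted j 0#  ∎
    where
    open ≡-Reasoning
    open Standard std
    d d′ : V
    d = pull c (S³ g)
    d′ = pull c (S³ (g ⋆ swap))
    quadratic-d : ∀ t → c · cubicPt (move g (just t)) ≡ 0# → d 1F * (t * t) + d 2F * t ≡ 0#
    quadratic-d t e = trans (sym (trans (cong (d 1F * (t * t) + d 2F * t +_) d₃) (+-identityʳ _)))
      (trans (sym (·-cubicPt d t d₀)) (≡ᶠ⁻ (subst T (onPlane-move g c (just t)) (≡ᶠ⁺ e))))
    off : ∀ t → t ≢ 0# → c · cubicPt (move g (just t)) ≢ 0#
    off t t≢0 e = binomial-nonzero (d 1F) (d 2F) t d₁₂ t≢0 (quadratic-d t e)
    swapped : move (g ⋆ swap) nothing ≡ move g (just 0#)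
    swapped = move-swap g
    at-∞ : c · cubicPt (move g nothing) ≡ 0#
    at-∞ = ≡ᶠ⁻ (subst T (sym (onPlane-move g c nothing)) (≡ᶠ⁺ (trans (·-e₀ d) d₀)))
    at-0 : c · cubicPt (move (g ⋆ swap) nothing) ≡ 0#
    at-0 = subst (λ s → c · cubicPt s ≡ 0#) (sym swapped) (≡ᶠ⁻ (subst T (sym (onPlane-move g c (just 0#)))
      (≡ᶠ⁺ (trans (·-cubicPt d 0# d₀) (trans (by-ring 3 (λ x y z → x :* (:0 :* :0) :+ y :* :0 :+ z , z) refl (d 1F) (d 2F) (d 3F)) d₃)))))
    d′₁ : d′ 1F ≡ d 2F
    d′₁ = trans (pull-⋆ c g swap 1F) (pull-swap d 1F)
    d′₂ : d′ 2F ≡ d 1F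
    d′₂ = trans (pull-⋆ c g swap 2F) (pull-swap d 2F)
    d′₃ : d′ 3F ≡ 0#
    d′₃ = trans (pull-⋆ c g swap 3F) (trans (pull-swap d 3F) d₀)
    total : (d 1F ≡ 0# × d 2F ≢ 0#) ⊎ (d 1F ≢ 0# × d 2F ≡ 0#) → baseCount j d ℕ.+ baseCount j d′ ≡ card (inClass j) ℕ.+ shifted j 0#
    total (inj₁ (d₁ , d₂)) = cong₂ ℕ._+_ (baseCount-tangent {d} j d₁ d₂)
      (baseCount-double j d′ (λ z → d₂ (trans (sym d′₁) z)) (trans d′₂ d₁) d′₃)
    total (inj₂ (d₁ , d₂)) = trans (cong₂ ℕ._+_ (baseCount-double j d d₁ d₂ d₃)
      (baseCount-tangent {d′} j (trans d′₁ d₂) (λ z → d₁ (trans (sym d′₂) z)))) (ℕ.+-comm (shifted j 0#) (card (inClass j)))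

  lines-2C : ∀ j c → Normalized c → T (hasType 2C-plane c) → 2 ℕ.* linesIn (O j) c ≡ (q ℕ.∸ 1) ℕ.+ 2 ℕ.* shifted j 0#
  lines-2C j c c-normal t = let g , std = standardize c c-normal t in begin
    2 ℕ.* linesIn (O j) c  ≡⟨ cong (2 ℕ.*_) (lines-standard j c g std) ⟩
    2 ℕ.* (card (inClass j) ℕ.+ shifted j 0#)  ≡⟨ ℕ.*-distribˡ-+ 2 (card (inClass j)) (shifted j 0#) ⟩
    2 ℕ.* card (inClass j) ℕ.+ 2 ℕ.* shifted j 0#  ≡⟨ cong (ℕ._+ 2 ℕ.* shifted j 0#) (class-doubled j) ⟩
    (q ℕ.∸ 1) ℕ.+ 2 ℕ.* shifted j 0#  ∎
    where open ≡-Reasoning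

  lines-2C-nonsquare : ∀ c → Normalized c → T (hasType 2C-plane c) → 2 ℕ.* linesIn (O nonsquare) c ≡ q ℕ.∸ 1
  lines-2C-nonsquare c c-normal t = trans (lines-2C nonsquare c c-normal t)
    (trans (cong (λ n → (q ℕ.∸ 1) ℕ.+ 2 ℕ.* n) shifted-nonsquare-0) (ℕ.+-identityʳ (q ℕ.∸ 1)))

  lines-2C-square : ∀ c → Normalized c → T (hasType 2C-plane c) → 2 ℕ.* linesIn (O square) c ≡ 3 ℕ.* (q ℕ.∸ 1)
  lines-2C-square c c-normal t = trans (lines-2C square c c-normal t)
    (cong (λ n → (q ℕ.∸ 1) ℕ.+ 2 ℕ.* n) (m+n≡q⇒ {shifted square 0#} {1} shifted-square-0))

-- Polynomials of small degree as functions on the field.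

module Polynomials {q : ℕ} (𝔽 : FiniteField q) where
  open FieldTheory 𝔽

  eval : ∀ {n} → Vec Carrier n → Carrier → Carrier
  eval []       x = 0#
  eval (c ∷ cs) x = c + x * eval cs x

  -- Synthetic division by `x - r` with the remainder dropped; the coefficients, lowest degree
  -- first, are the Horner values at `r` of the successive tails.
  quotient : ∀ {n} → Carrier → Vec Carrier (suc n) → Vec Carrier n
  quotient r (c ∷ [])         = []
  quotient r (c ∷ cs@(_ ∷ _)) = eval cs r ∷ quotient r cs

  eval-quotient : ∀ {n} r (p : Vec Carrier (suc n)) x → eval p x - eval p r ≡ (x - r) * eval (quotient r p) x
  eval-quotient r (c ∷ []) x = by-ring 3 (λ c x r → c :+ x :* :0 :- (c :+ r :* :0) , (x :- r) :* :0) refl c x r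
  eval-quotient r (c ∷ cs@(_ ∷ _)) x = begin
    c + x * eval cs x - (c + r * eval cs r)
      ≡⟨ by-ring 5 (λ c x r s t → c :+ x :* s :- (c :+ r :* t) , (x :- r) :* t :+ x :* (s :- t)) refl c x r (eval cs x) (eval cs r) ⟩
    (x - r) * eval cs r + x * (eval cs x - eval cs r)
      ≡⟨ cong (λ e → (x - r) * eval cs r + x * e) (eval-quotient r cs x) ⟩
    (x - r) * eval cs r + x * ((x - r) * eval (quotient r cs) x)
      ≡⟨ by-ring 4 (λ x r t s → (x :- r) :* t :+ x :* ((x :- r) :* s) , (x :- r) :* (t :+ x :* s)) refl x r (eval cs r) (eval (quotient r cs) x) ⟩
    (x - r) * (eval cs r + x * eval (quotient r cs) x)  ∎
    where open ≡-Reasoning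

  Zero : ∀ {n} → Vec Carrier n → Set
  Zero = All (_≡ 0#)

  zero-from-quotient : ∀ {n} r (p : Vec Carrier (suc n)) → eval p r ≡ 0# → Zero (quotient r p) → Zero p
  zero-from-quotient r (c ∷ []) e _ = trans (by-ring 2 (λ c r → c , c :+ r :* :0) refl c r) e ∷ []
  zero-from-quotient r (c ∷ cs@(_ ∷ _)) e (e′ ∷ z) =
    trans (by-ring 2 (λ c r → c , c :+ r :* :0) refl c r) (trans (cong (λ s → c + r * s) (sym e′)) e) ∷ zero-from-quotient r cs e′ z

  -- Division by `x - r zero` leaves one coefficient fewer, and since `r` is injective the quotient
  -- vanishes at the remaining points.
  vanishing : ∀ {n} (p : Vec Carrier n) (r : Fin n → Carrier) → (∀ {i j} → r i ≡ r j → i ≡ j) →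
    (∀ i → eval p (r i) ≡ 0#) → Zero p
  vanishing {zero} [] r inj e = []
  vanishing {suc n} p r inj e = zero-from-quotient (r zero) p (e zero)
    (vanishing (quotient (r zero) p) (λ i → r (suc i)) (λ h → suc-inj (inj h)) λ i →
      *-cancel-0 (λ d → case (inj (-≡0⇒≡ d))) (trans (sym (eval-quotient (r zero) p (r (suc i))))
        (trans (cong₂ _-_ (e (suc i)) (e zero)) (-‿inverseʳ 0#))))
    where
    suc-inj : ∀ {i j : Fin n} → Fin.suc i ≡ suc j → i ≡ j
    suc-inj refl = refl
    case : ∀ {i : Fin n} → ¬ (Fin.suc i ≡ zero)
    case ()

  vanishing-everywhere : ∀ {n} → n ℕ.≤ q → (p : Vec Carrier n) → (∀ x → eval p x ≡ 0#) → Zero p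
  vanishing-everywhere n≤q p e = vanishing p (λ i → elt (inject≤ i n≤q))
    (λ h → inject≤-injective n≤q n≤q _ _ (trans (sym (Inverse.strictlyInverseʳ enum _)) (trans (cong (Inverse.from enum) h) (Inverse.strictlyInverseʳ enum _))))
    λ i → e (elt (inject≤ i n≤q))

  quad : Carrier → Carrier → Carrier → Carrier → Carrier
  quad x y z t = x * (t * t) + y * t + z

  quad-+ : ∀ x y z x′ y′ z′ t → quad (x + x′) (y + y′) (z + z′) t ≡ quad x y z t + quad x′ y′ z′ t
  quad-+ = by-ring 7 (λ x y z x′ y′ z′ t → (x :+ x′) :* (t :* t) :+ (y :+ y′) :* t :+ (z :+ z′) ,
    (x :* (t :* t) :+ y :* t :+ z) :+ (x′ :* (t :* t) :+ y′ :* t :+ z′)) refl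

  quad-* : ∀ k x y z t → quad (k * x) (k * y) (k * z) t ≡ k * quad x y z t
  quad-* = by-ring 5 (λ k x y z t → k :* x :* (t :* t) :+ k :* y :* t :+ k :* z , k :* (x :* (t :* t) :+ y :* t :+ z)) refl

  module _ (5≤q : 5 ℕ.≤ q) where
    quartic : ∀ e₀ e₁ e₂ e₃ e₄ → (∀ t → e₀ + t * (e₁ + t * (e₂ + t * (e₃ + t * (e₄ + t * 0#)))) ≡ 0#) →
      e₀ ≡ 0# × e₁ ≡ 0# × e₂ ≡ 0# × e₃ ≡ 0# × e₄ ≡ 0#
    quartic e₀ e₁ e₂ e₃ e₄ h = unpack (vanishing-everywhere 5≤q (e₀ ∷ e₁ ∷ e₂ ∷ e₃ ∷ e₄ ∷ []) h)
      where
      unpack : Zero (e₀ ∷ e₁ ∷ e₂ ∷ e₃ ∷ e₄ ∷ []) → e₀ ≡ 0# × e₁ ≡ 0# × e₂ ≡ 0# × e₃ ≡ 0# × e₄ ≡ 0#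
      unpack (a ∷ b ∷ c ∷ d ∷ e ∷ []) = a , b , c , d , e

    -- Degrees 4 and 3 force the cofactor to be the constant `h₀`, so `u² = p₂ h₀`. If `u` were
    -- nonzero, evaluating at the root of `u t + v`, where the quadratic does not vanish, would give
    -- `h₀ = 0` and hence `u = 0`. So `u` is zero, then `h₀`, then `v`.
    rootless-linear-square : ∀ p₂ p₁ p₀ h₂ h₁ h₀ u v → p₂ ≢ 0# → (∀ t → quad p₂ p₁ p₀ t ≢ 0#) →
      (∀ t → (u * t + v) * (u * t + v) ≡ quad p₂ p₁ p₀ t * quad h₂ h₁ h₀ t) → u ≡ 0# × v ≡ 0#
    rootless-linear-square p₂ p₁ p₀ h₂ h₁ h₀ u v p₂≢0 noroot product = u≡0 , v≡0
      where
      coefficients : p₀ * h₀ - v * v ≡ 0# × p₁ * h₀ + p₀ * h₁ - (1# + 1#) * u * v ≡ 0# ×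
        p₂ * h₀ + p₁ * h₁ + p₀ * h₂ - u * u ≡ 0# × p₂ * h₁ + p₁ * h₂ ≡ 0# × p₂ * h₂ ≡ 0#
      coefficients = quartic (p₀ * h₀ - v * v) (p₁ * h₀ + p₀ * h₁ - (1# + 1#) * u * v) (p₂ * h₀ + p₁ * h₁ + p₀ * h₂ - u * u) (p₂ * h₁ + p₁ * h₂) (p₂ * h₂) λ t → trans
        (by-ring 9 (λ p₂ p₁ p₀ h₂ h₁ h₀ u v t →
          (p₀ :* h₀ :- v :* v) :+ t :* ((p₁ :* h₀ :+ p₀ :* h₁ :- :2 :* u :* v) :+ t :* ((p₂ :* h₀ :+ p₁ :* h₁ :+ p₀ :* h₂ :- u :* u) :+ t :* ((p₂ :* h₁ :+ p₁ :* h₂) :+ t :* (p₂ :* h₂ :+ t :* :0)))) ,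
          (p₂ :* (t :* t) :+ p₁ :* t :+ p₀) :* (h₂ :* (t :* t) :+ h₁ :* t :+ h₀) :- (u :* t :+ v) :* (u :* t :+ v)) refl p₂ p₁ p₀ h₂ h₁ h₀ u v t)
        (≡⇒-≡0 (sym (product t)))
      h₂≡0 : h₂ ≡ 0#
      h₂≡0 = *-cancel-0 p₂≢0 (proj₂ (proj₂ (proj₂ (proj₂ coefficients))))
      h₁≡0 : h₁ ≡ 0#
      h₁≡0 = *-cancel-0 p₂≢0 (trans (by-ring 3 (λ x p h → x , x :+ p :* :0) refl (p₂ * h₁) p₁ h₂)
        (trans (cong (λ h → p₂ * h₁ + p₁ * h) (sym h₂≡0)) (proj₁ (proj₂ (proj₂ (proj₂ coefficients))))))
      u²≡ : u * u ≡ p₂ * h₀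
      u²≡ = sym (-≡0⇒≡ (trans (by-ring 4 (λ x p r u → x :- u :* u , x :+ p :* :0 :+ r :* :0 :- u :* u) refl (p₂ * h₀) p₁ p₀ u)
        (trans (cong₂ (λ x y → p₂ * h₀ + p₁ * x + p₀ * y - u * u) (sym h₁≡0) (sym h₂≡0)) (proj₁ (proj₂ (proj₂ coefficients))))))
      u≡0 : u ≡ 0#
      u≡0 with u ≟ 0#
      ... | yes z = z
      ... | no u≢0 = ⊥-elim (u≢0 (x²≡0⇒x≡0 (trans u²≡ (trans (cong (p₂ *_) h₀≡0) (zeroʳ p₂)))))
        where
        j t₀ : Carrier
        j = proj₁ (inverse u u≢0)
        t₀ = - (v * j)
        root : u * t₀ + v ≡ 0#
        root = trans (by-ring 3 (λ u v j → u :* :- (v :* j) :+ v , v :* :- (u :* j) :+ v) refl u v j)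
          (trans (cong (λ x → v * - x + v) (proj₂ (inverse u u≢0))) (by-ring 1 (λ v → v :* :- :1 :+ v , :0) refl v))
        h₀≡0 : h₀ ≡ 0#
        h₀≡0 = trans (by-ring 2 (λ h t → h , :0 :* (t :* t) :+ :0 :* t :+ h) refl h₀ t₀)
          (trans (cong₂ (λ x y → x * (t₀ * t₀) + y * t₀ + h₀) (sym h₂≡0) (sym h₁≡0))
            (*-cancel-0 (noroot t₀) (trans (sym (product t₀)) (trans (cong (λ x → x * x) root) (zeroʳ 0#)))))
      v≡0 : v ≡ 0#
      v≡0 = x²≡0⇒x≡0 (sym (trans (sym (trans (cong (p₀ *_) h₀≡0) (zeroʳ p₀))) (-≡0⇒≡ (proj₁ coefficients))))
        where
        h₀≡0 : h₀ ≡ 0#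
        h₀≡0 = *-cancel-0 p₂≢0 (trans (sym u²≡) (trans (cong (λ x → x * x) u≡0) (zeroʳ 0#)))

    -- If p has no roots and r² = s p, then p divides r unless p is constant; p ∣ r makes r / p constant.
    rootless-square : ∀ p₂ p₁ p₀ r₂ r₁ r₀ s₂ s₁ s₀ →
      (∀ t → quad p₂ p₁ p₀ t ≢ 0#) →
      (∀ t → quad r₂ r₁ r₀ t * quad r₂ r₁ r₀ t ≡ quad s₂ s₁ s₀ t * quad p₂ p₁ p₀ t) →
      ¬ (∃ λ k → ∀ t → quad r₂ r₁ r₀ t ≡ k * quad p₂ p₁ p₀ t) →
      p₂ ≡ 0# × p₁ ≡ 0# × r₂ ≡ 0#
    rootless-square p₂ p₁ p₀ r₂ r₁ r₀ s₂ s₁ s₀ noroot sq nonconst = p₂≡0 , p₁≡0 , r₂≡0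
      where
      open ≡-Reasoning
      module _ (p₂≢0 : p₂ ≢ 0#) where
        -- With `k = r₂ / p₂` the remainder `L = R - k P` is the linear polynomial `u t + v`. From
        -- `R² = S P` its square is `P (S - 2 k R + k² P)`, and the `h`-coefficients are those of
        -- this cofactor.
        i k m u v h₂ h₁ h₀ : Carrier
        i = proj₁ (inverse p₂ p₂≢0)
        k = r₂ * i
        m = - ((1# + 1#) * k)
        u = r₁ - k * p₁
        v = r₀ - k * p₀
        h₂ = s₂ + (m * r₂ + k * k * p₂)
        h₁ = s₁ + (m * r₁ + k * k * p₁)
        h₀ = s₀ + (m * r₀ + k * k * p₀)
        kp₂ : r₂ ≡ k * p₂
        kp₂ = trans (sym (inverse-cancelʳ (proj₂ (inverse p₂ p₂≢0)) r₂)) (by-ring 3 (λ r p i → p :* (i :* r) , r :* i :* p) refl r₂ p₂ i)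
        remainder : ∀ t → quad r₂ r₁ r₀ t ≡ k * quad p₂ p₁ p₀ t + (u * t + v)
        remainder t = trans (cong (λ x → x * (t * t) + r₁ * t + r₀) kp₂)
          (by-ring 7 (λ p₂ p₁ p₀ r₁ r₀ k t → k :* p₂ :* (t :* t) :+ r₁ :* t :+ r₀ ,
            k :* (p₂ :* (t :* t) :+ p₁ :* t :+ p₀) :+ ((r₁ :- k :* p₁) :* t :+ (r₀ :- k :* p₀))) refl p₂ p₁ p₀ r₁ r₀ k t)
        quad-h : ∀ t → quad h₂ h₁ h₀ t ≡ quad s₂ s₁ s₀ t + (m * quad r₂ r₁ r₀ t + k * k * quad p₂ p₁ p₀ t)
        quad-h t = trans (quad-+ s₂ s₁ s₀ _ _ _ t) (cong (quad s₂ s₁ s₀ t +_)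
          (trans (quad-+ (m * r₂) (m * r₁) (m * r₀) _ _ _ t) (cong₂ _+_ (quad-* m r₂ r₁ r₀ t) (quad-* (k * k) p₂ p₁ p₀ t))))
        product : ∀ t → (u * t + v) * (u * t + v) ≡ quad p₂ p₁ p₀ t * quad h₂ h₁ h₀ t
        product t = begin
          L * L  ≡⟨ by-ring 3 (λ l k p → l :* l , (k :* p :+ l) :* (k :* p :+ l) :+ (:- (:2 :* k) :* (k :* p :+ l) :+ k :* k :* p) :* p) refl L k P ⟩
          (k * P + L) * (k * P + L) + (m * (k * P + L) + k * k * P) * P  ≡⟨ cong (λ R → R * R + (m * R + k * k * P) * P) (remainder t) ⟨
          R * R + (m * R + k * k * P) * P  ≡⟨ cong (_+ (m * R + k * k * P) * P) (sq t) ⟩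
          S * P + (m * R + k * k * P) * P  ≡⟨ by-ring 3 (λ s x p → s :* p :+ x :* p , p :* (s :+ x)) refl S (m * R + k * k * P) P ⟩
          P * (S + (m * R + k * k * P))  ≡⟨ cong (P *_) (quad-h t) ⟨
          P * quad h₂ h₁ h₀ t  ∎
          where
          L P R S : Carrier
          L = u * t + v
          P = quad p₂ p₁ p₀ t
          R = quad r₂ r₁ r₀ t
          S = quad s₂ s₁ s₀ t
        u≡0,v≡0 : u ≡ 0# × v ≡ 0#
        u≡0,v≡0 = rootless-linear-square p₂ p₁ p₀ h₂ h₁ h₀ u v p₂≢0 noroot product
        constant-ratio : ⊥
        constant-ratio = nonconst (k , λ t → trans (remainder t) (trans (cong₂ (λ x y → k * quad p₂ p₁ p₀ t + (x * t + y)) (proj₁ u≡0,v≡0) (proj₂ u≡0,v≡0))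
          (by-ring 2 (λ x t → x :+ (:0 :* t :+ :0) , x) refl (k * quad p₂ p₁ p₀ t) t)))
      p₂≡0 : p₂ ≡ 0#
      p₂≡0 with p₂ ≟ 0#
      ... | yes z = z
      ... | no n  = ⊥-elim (constant-ratio n)
      p₁≡0 : p₁ ≡ 0#
      p₁≡0 with p₁ ≟ 0#
      ... | yes z = z
      ... | no n  = let i , pi = inverse p₁ n in ⊥-elim (noroot (- (p₀ * i)) (begin
        p₂ * (- (p₀ * i) * - (p₀ * i)) + p₁ * - (p₀ * i) + p₀  ≡⟨ cong (λ x → x * (- (p₀ * i) * - (p₀ * i)) + p₁ * - (p₀ * i) + p₀) p₂≡0 ⟩
        0# * (- (p₀ * i) * - (p₀ * i)) + p₁ * - (p₀ * i) + p₀  ≡⟨ by-ring 3 (λ p r i → :0 :* (:- (r :* i) :* :- (r :* i)) :+ p :* :- (r :* i) :+ r , r :* :- (p :* i) :+ r) refl p₁ p₀ i ⟩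
        p₀ * - (p₁ * i) + p₀  ≡⟨ cong (λ x → p₀ * - x + p₀) pi ⟩
        p₀ * - 1# + p₀  ≡⟨ by-ring 1 (λ v → v :* :- :1 :+ v , :0) refl p₀ ⟩
        0#  ∎))
      r₂≡0 : r₂ ≡ 0#
      -- Now `P` is the constant `p₀`, so `S P` has degree at most 2 and the coefficient `r₂²` of
      -- degree 4 in `R²` must vanish.
      r₂≡0 = x²≡0⇒x≡0 (proj₂ (proj₂ (proj₂ (proj₂ (quartic (r₀ * r₀ - s₀ * p₀) ((1# + 1#) * r₁ * r₀ - s₁ * p₀) (r₁ * r₁ + (1# + 1#) * r₂ * r₀ - s₂ * p₀) ((1# + 1#) * r₂ * r₁) (r₂ * r₂) λ t →
        trans (by-ring 8 (λ r₂ r₁ r₀ s₂ s₁ s₀ p t →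
            (r₀ :* r₀ :- s₀ :* p) :+ t :* ((:2 :* r₁ :* r₀ :- s₁ :* p) :+ t :* ((r₁ :* r₁ :+ :2 :* r₂ :* r₀ :- s₂ :* p) :+ t :* (:2 :* r₂ :* r₁ :+ t :* (r₂ :* r₂ :+ t :* :0)))) ,
            (r₂ :* (t :* t) :+ r₁ :* t :+ r₀) :* (r₂ :* (t :* t) :+ r₁ :* t :+ r₀) :- (s₂ :* (t :* t) :+ s₁ :* t :+ s₀) :* (:0 :* (t :* t) :+ :0 :* t :+ p)) refl r₂ r₁ r₀ s₂ s₁ s₀ p₀ t)
          (≡⇒-≡0 (trans (sq t) (cong₂ (λ x y → quad s₂ s₁ s₀ t * (x * (t * t) + y * t + p₀)) p₂≡0 p₁≡0))))))))

-- The group of the cubic and its orbits.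

module Orbits {q : ℕ} (𝔽 : FiniteField q) (odd : q ℕ.% 2 ≡ 1) (5≤q : 5 ℕ.≤ q) where
  open FieldTheory 𝔽
  open Squares 𝔽 odd
  open LinearAlgebra 𝔽
  open CanonicalForms 𝔽
  open TwistedCubic 𝔽
  open Pencils 𝔽 odd
  open Lines 𝔽 odd
  open Polynomials 𝔽

  module _ (N : Mat) (N-∞ : apply N e₀ ∝ e₀)
    (N-finite : ∀ t → ∃ λ v → apply N (cubicPt (just t)) ∝ cubicPt (just v))
    (N-injective : ∀ s t v → apply N (cubicPt (just s)) ∝ cubicPt (just v) → apply N (cubicPt (just t)) ∝ cubicPt (just v) → s ≡ t)
    where
    private
      v l : Carrier → Carrier
      v t = proj₁ (N-finite t)
      l t = proj₁ (proj₂ (N-finite t))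
      l≢0 : ∀ t → l t ≢ 0#
      l≢0 t = proj₁ (proj₂ (proj₂ (N-finite t)))
      image : ∀ t → apply N (cubicPt (just t)) ≐ l t ⊛ cubicPt (just (v t))
      image t = proj₂ (proj₂ (proj₂ (N-finite t)))

      column₀ : ∀ i → N i 0F ≡ proj₁ N-∞ * e₀ i
      column₀ i = trans (sym (·-e₀ (N i))) (proj₂ (proj₂ N-∞) i)

      row : Fin 4 → Carrier → Carrier
      row i t = quad (N i 1F) (N i 2F) (N i 3F) t

      expand : ∀ i t → N i · cubicPt (just t) ≡ N i 0F * (t * (t * t)) + row i t
      expand i t = by-ring 5 (λ w x y z t → w :* (t :* (t :* t)) :+ (x :* (t :* t) :+ (y :* t :+ z :* :1)) , w :* (t :* (t :* t)) :+ (x :* (t :* t) :+ y :* t :+ z)) refl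
        (N i 0F) (N i 1F) (N i 2F) (N i 3F) t

      row≡ : ∀ i t → N i 0F ≡ 0# → row i t ≡ l t * cubicPt (just (v t)) i
      row≡ i t n₀ = trans (sym (trans (cong (_+ row i t) (x≡0⇒xy≡0 (t * (t * t)) n₀)) (+-identityˡ _))) (trans (sym (expand i t)) (image t i))

      N₁₀ : N 1F 0F ≡ 0#
      N₁₀ = trans (column₀ 1F) (zeroʳ _)
      N₂₀ : N 2F 0F ≡ 0#
      N₂₀ = trans (column₀ 2F) (zeroʳ _)
      N₃₀ : N 3F 0F ≡ 0#
      N₃₀ = trans (column₀ 3F) (zeroʳ _)

      row₃ : ∀ t → row 3F t ≡ l t
      row₃ t = trans (row≡ 3F t N₃₀) (*-identityʳ (l t))

      -- Finite points have finite images, so the last coordinate of an image never vanishes.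
      rootless : ∀ t → row 3F t ≢ 0#
      rootless t e = l≢0 t (trans (sym (row₃ t)) e)

      on-conic : ∀ t → row 2F t * row 2F t ≡ row 1F t * row 3F t
      on-conic t = trans (cong₂ _*_ (row≡ 2F t N₂₀) (row≡ 2F t N₂₀))
        (trans (by-ring 2 (λ l v → l :* v :* (l :* v) , l :* (v :* v) :* l) refl (l t) (v t)) (cong₂ _*_ (sym (row≡ 1F t N₁₀)) (sym (row₃ t))))

      -- A constant ratio would be the parameter of every image, so P(0) and P(1) would have the
      -- same image.
      nonconstant : ¬ (∃ λ k → ∀ t → row 2F t ≡ k * row 3F t)
      nonconstant (k , e) = 0≢1 (N-injective 0# 1# k (∝-v 0#) (∝-v 1#))
        where
        v≡k : ∀ t → v t ≡ k
        v≡k t = *-cancelˡ (l≢0 t) (trans (sym (row≡ 2F t N₂₀)) (trans (e t) (trans (cong (k *_) (row₃ t)) (*-comm k (l t)))))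
        ∝-v : ∀ t → apply N (cubicPt (just t)) ∝ cubicPt (just k)
        ∝-v t = subst (λ x → apply N (cubicPt (just t)) ∝ cubicPt (just x)) (v≡k t) (proj₂ (N-finite t))

      shape : N 3F 1F ≡ 0# × N 3F 2F ≡ 0# × N 2F 1F ≡ 0#
      shape = rootless-square 5≤q (N 3F 1F) (N 3F 2F) (N 3F 3F) (N 2F 1F) (N 2F 2F) (N 2F 3F) (N 1F 1F) (N 1F 2F) (N 1F 3F)
        rootless on-conic nonconstant

      κ ι μ ν : Carrier
      κ = N 3F 3F
      row₃-const : ∀ t → row 3F t ≡ κ
      row₃-const t = trans (cong₂ (λ x y → x * (t * t) + y * t + κ) (proj₁ shape) (proj₁ (proj₂ shape)))
        (by-ring 2 (λ k t → :0 :* (t :* t) :+ :0 :* t :+ k , k) refl κ t)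
      κ≢0 : κ ≢ 0#
      κ≢0 e = rootless 0# (trans (row₃-const 0#) e)
      l≡κ : ∀ t → l t ≡ κ
      l≡κ t = trans (sym (row₃ t)) (row₃-const t)
      ι = proj₁ (inverse κ κ≢0)
      μ = ι * N 2F 2F
      ν = ι * N 2F 3F
      rescale : ∀ x → x ≡ κ * (ι * x)
      rescale x = sym (inverse-cancelʳ (proj₂ (inverse κ κ≢0)) x)

      v≡ : ∀ t → v t ≡ μ * t + ν
      v≡ t = *-cancelˡ κ≢0 (begin
        κ * v t  ≡⟨ cong (_* v t) (l≡κ t) ⟨
        l t * v t  ≡⟨ row≡ 2F t N₂₀ ⟨
        N 2F 1F * (t * t) + N 2F 2F * t + N 2F 3F  ≡⟨ cong (λ x → x * (t * t) + N 2F 2F * t + N 2F 3F) (proj₂ (proj₂ shape)) ⟩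
        0# * (t * t) + N 2F 2F * t + N 2F 3F  ≡⟨ cong₂ (λ x y → 0# * (t * t) + x * t + y) (rescale (N 2F 2F)) (rescale (N 2F 3F)) ⟩
        0# * (t * t) + κ * μ * t + κ * ν  ≡⟨ by-ring 4 (λ k m n t → :0 :* (t :* t) :+ k :* m :* t :+ k :* n , k :* (m :* t :+ n)) refl κ μ ν t ⟩
        κ * (μ * t + ν)  ∎)
        where open ≡-Reasoning

      -- The parameter map is already known to be affine, and each coordinate of the image is a
      -- cubic polynomial in `t`; it is compared as a quartic with leading coefficient `0#`.
      coefficients : ∀ i (x₃ x₂ x₁ x₀ : Carrier) →
        (∀ t → κ * cubicPt (just (μ * t + ν)) i ≡ κ * (x₃ * (t * (t * t)) + (x₂ * (t * t) + x₁ * t + x₀))) →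
        N i 0F ≡ κ * x₃ × N i 1F ≡ κ * x₂ × N i 2F ≡ κ * x₁ × N i 3F ≡ κ * x₀
      coefficients i x₃ x₂ x₁ x₀ e =
        let c₀ , c₁ , c₂ , c₃ , _ = quartic 5≤q (N i 3F - κ * x₀) (N i 2F - κ * x₁) (N i 1F - κ * x₂) (N i 0F - κ * x₃) 0# λ t →
              trans (by-ring 10 (λ w x y z k x₃ x₂ x₁ x₀ t →
                  (z :- k :* x₀) :+ t :* ((y :- k :* x₁) :+ t :* ((x :- k :* x₂) :+ t :* ((w :- k :* x₃) :+ t :* (:0 :+ t :* :0)))) ,
                  (w :* (t :* (t :* t)) :+ (x :* (t :* t) :+ y :* t :+ z)) :- k :* (x₃ :* (t :* (t :* t)) :+ (x₂ :* (t :* t) :+ x₁ :* t :+ x₀))) refl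
                  (N i 0F) (N i 1F) (N i 2F) (N i 3F) κ x₃ x₂ x₁ x₀ t)
                (≡⇒-≡0 (trans (sym (expand i t)) (trans (image t i) (trans (cong₂ (λ l v → l * cubicPt (just v) i) (l≡κ t) (v≡ t)) (e t)))))
        in -≡0⇒≡ c₃ , -≡0⇒≡ c₂ , -≡0⇒≡ c₁ , -≡0⇒≡ c₀

      row₀-entries : N 0F 0F ≡ κ * (μ * (μ * μ)) × N 0F 1F ≡ κ * ((1# + (1# + 1#)) * (μ * μ * ν)) ×
        N 0F 2F ≡ κ * ((1# + (1# + 1#)) * (μ * (ν * ν))) × N 0F 3F ≡ κ * (ν * (ν * ν))
      row₀-entries = coefficients 0F (μ * (μ * μ)) ((1# + (1# + 1#)) * (μ * μ * ν)) ((1# + (1# + 1#)) * (μ * (ν * ν))) (ν * (ν * ν)) λ t → by-ring 4 (λ k m n t → let x = m :* t :+ n in k :* (x :* (x :* x)) ,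
        k :* (m :* (m :* m) :* (t :* (t :* t)) :+ (:3 :* (m :* m :* n) :* (t :* t) :+ :3 :* (m :* (n :* n)) :* t :+ n :* (n :* n)))) refl κ μ ν t

      row₁-entries : N 1F 0F ≡ κ * 0# × N 1F 1F ≡ κ * (μ * μ) × N 1F 2F ≡ κ * ((1# + 1#) * (μ * ν)) × N 1F 3F ≡ κ * (ν * ν)
      row₁-entries = coefficients 1F 0# (μ * μ) ((1# + 1#) * (μ * ν)) (ν * ν) λ t → by-ring 4 (λ k m n t → let x = m :* t :+ n in k :* (x :* x) ,
        k :* (:0 :* (t :* (t :* t)) :+ (m :* m :* (t :* t) :+ :2 :* (m :* n) :* t :+ n :* n))) refl κ μ ν t

      -- The corner entry is both `κ μ³` and the nonzero factor by which `N` scales `e₀`.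
      μ≢0 : μ ≢ 0#
      μ≢0 e = proj₁ (proj₂ N-∞) (trans (trans (sym (*-identityʳ _)) (sym (column₀ 0F))) (trans (proj₁ row₀-entries)
        (trans (cong (κ *_) (x≡0⇒xy≡0 (μ * μ) e)) (zeroʳ κ))))

      affine : GL₂
      affine = record { a = μ ; b = ν ; c = 0# ; d = 1# ; δ = proj₁ (inverse μ μ≢0)
        ; det = trans (by-ring 3 (λ m n i → (m :* :1 :- n :* :0) :* i , m :* i) refl μ ν (proj₁ (inverse μ μ≢0))) (proj₂ (inverse μ μ≢0)) }

    fixing-∞ : ∃₂ λ h k → k ≢ 0# × (∀ i j → N i j ≡ k * S³ h i j)
    fixing-∞ = affine , κ , κ≢0 , ∀₄
      (let e₀ , e₁ , e₂ , e₃ = row₀-entries in ∀₄ e₀ e₁ e₂ e₃)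
      (let e₀ , e₁ , e₂ , e₃ = row₁-entries in ∀₄
        (trans e₀ (by-ring 3 (λ k m n → k :* :0 , k :* E.cubicMatrix m n :0 :1 1F 0F) refl κ μ ν))
        (trans e₁ (by-ring 3 (λ k m n → k :* (m :* m) , k :* E.cubicMatrix m n :0 :1 1F 1F) refl κ μ ν))
        (trans e₂ (by-ring 3 (λ k m n → k :* (:2 :* (m :* n)) , k :* E.cubicMatrix m n :0 :1 1F 2F) refl κ μ ν))
        (trans e₃ (by-ring 3 (λ k m n → k :* (n :* n) , k :* E.cubicMatrix m n :0 :1 1F 3F) refl κ μ ν)))
      (∀₄
        (trans N₂₀ (by-ring 3 (λ k m n → :0 , k :* E.cubicMatrix m n :0 :1 2F 0F) refl κ μ ν))
        (trans (proj₂ (proj₂ shape)) (by-ring 3 (λ k m n → :0 , k :* E.cubicMatrix m n :0 :1 2F 1F) refl κ μ ν))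
        (trans (rescale (N 2F 2F)) (by-ring 3 (λ k m n → k :* m , k :* E.cubicMatrix m n :0 :1 2F 2F) refl κ μ ν))
        (trans (rescale (N 2F 3F)) (by-ring 3 (λ k m n → k :* n , k :* E.cubicMatrix m n :0 :1 2F 3F) refl κ μ ν)))
      (∀₄
        (trans N₃₀ (by-ring 3 (λ k m n → :0 , k :* E.cubicMatrix m n :0 :1 3F 0F) refl κ μ ν))
        (trans (proj₁ shape) (by-ring 3 (λ k m n → :0 , k :* E.cubicMatrix m n :0 :1 3F 1F) refl κ μ ν))
        (trans (proj₁ (proj₂ shape)) (by-ring 3 (λ k m n → :0 , k :* E.cubicMatrix m n :0 :1 3F 2F) refl κ μ ν))
        (by-ring 3 (λ k m n → k , k :* E.cubicMatrix m n :0 :1 3F 3F) refl κ μ ν))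

  apply-injective : ∀ M → Invertible M → ∀ {x y} → apply M x ∝ apply M y → x ∝ y
  apply-injective M (M⁻¹ , _ , inv) {x} {y} (k , k≢0 , e) = k , k≢0 , λ i → begin
    x i  ≡⟨ undo x i ⟨
    apply M⁻¹ (apply M x) i  ≡⟨ apply-cong M⁻¹ e i ⟩
    apply M⁻¹ (k ⊛ apply M y) i  ≡⟨ apply-scale M⁻¹ k (apply M y) i ⟩
    k * apply M⁻¹ (apply M y) i  ≡⟨ cong (k *_) (undo y i) ⟩
    k * y i  ∎
    where
    open ≡-Reasoning
    undo : ∀ x → apply M⁻¹ (apply M x) ≐ x
    undo x i = trans (sym (apply-∙ M⁻¹ M x i)) (trans (apply-≐ x inv i) (apply-idMat x i))

  module _ (M : Mat) (invertible : Invertible M) (images : ∀ s → ∃ λ t → apply M (cubicPt s) ∝ cubicPt t)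
    (g : GL₂) (M-∞ : apply M e₀ ∝ cubicPt (move g nothing))
    (N : Mat) (N≡ : ∀ x → apply N x ≐ act (g ⁻¹) (apply M x)) where
    private
      open ≡-Reasoning
      just≢nothing : ∀ {t : Carrier} → just t ≢ nothing
      just≢nothing ()
      M≡ : ∀ x → apply M x ≐ act g (apply N x)
      M≡ x i = trans (sym (act-inverseʳ g (apply M x) i)) (apply-cong (S³ g) (λ j → sym (N≡ x j)) i)
      N-image : ∀ s t → apply M (cubicPt s) ∝ cubicPt t → apply N (cubicPt s) ∝ cubicPt (move (g ⁻¹) t)
      N-image s t (k , k≢0 , e) = ∝-trans {apply N (cubicPt s)} {act (g ⁻¹) (cubicPt t)} {cubicPt (move (g ⁻¹) t)}
        (k , k≢0 , λ i → trans (N≡ (cubicPt s) i) (trans (apply-cong (S³ (g ⁻¹)) e i) (apply-scale (S³ (g ⁻¹)) k (cubicPt t) i)))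
        (act-cubicPt (g ⁻¹) t)
      N-∞ : apply N e₀ ∝ e₀
      N-∞ = subst (λ t → apply N e₀ ∝ cubicPt t) (move-inverseˡ g nothing) (N-image nothing (move g nothing) M-∞)
      collide : ∀ s s′ t → apply N (cubicPt s) ∝ cubicPt t → apply N (cubicPt s′) ∝ cubicPt t → s ≡ s′
      collide s s′ t a b = point-injective s s′ (apply-injective M invertible (scaled (∝-trans {apply N (cubicPt s)} {cubicPt t} {apply N (cubicPt s′)} a (∝-sym {apply N (cubicPt s′)} {cubicPt t} b))))
        where
        scaled : apply N (cubicPt s) ∝ apply N (cubicPt s′) → apply M (cubicPt s) ∝ apply M (cubicPt s′)
        scaled (k , k≢0 , e) = k , k≢0 , λ i → trans (M≡ (cubicPt s) i) (trans (apply-cong (S³ g) e i)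
          (trans (apply-scale (S³ g) k (apply N (cubicPt s′)) i) (cong (k *_) (sym (M≡ (cubicPt s′) i)))))
      finite : ∀ t s → apply N (cubicPt (just t)) ∝ cubicPt s → ∃ λ v → apply N (cubicPt (just t)) ∝ cubicPt (just v)
      finite t (just v) a = v , a
      finite t nothing a = ⊥-elim (just≢nothing (collide (just t) nothing nothing a N-∞))
      N-finite : ∀ t → ∃ λ v → apply N (cubicPt (just t)) ∝ cubicPt (just v)
      N-finite t = finite t (move (g ⁻¹) (proj₁ (images (just t)))) (N-image (just t) (proj₁ (images (just t))) (proj₂ (images (just t))))
      N-injective : ∀ s t v → apply N (cubicPt (just s)) ∝ cubicPt (just v) → apply N (cubicPt (just t)) ∝ cubicPt (just v) → s ≡ t
      N-injective s t v a b = just-injective (collide (just s) (just t) (just v) a b)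
      extend : (∃₂ λ h k → k ≢ 0# × (∀ i j → N i j ≡ k * S³ h i j)) → ∃₂ λ g k → k ≢ 0# × (∀ x → apply M x ≐ k ⊛ act g x)
      extend (h , k , k≢0 , e) = g ⋆ h , k , k≢0 , λ x i → begin
        apply M x i  ≡⟨ M≡ x i ⟩
        act g (apply N x) i  ≡⟨ apply-cong (S³ g) (λ j → trans (·-congˡ x (e j)) (·-scaleˡ k (S³ h j) x)) i ⟩
        act g (k ⊛ act h x) i  ≡⟨ apply-scale (S³ g) k (act h x) i ⟩
        k * act g (act h x) i  ≡⟨ cong (k *_) (act-⋆ g h x i) ⟨
        k * act (g ⋆ h) x i  ∎

    -- Here `N` is `g⁻¹ M`, which fixes P(∞) and so is a scalar multiple of some `S³ h`; therefore
    -- `M` acts as a multiple of `g ⋆ h`. Injectivity on the cubic, inherited from `M`, keeps the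
    -- finite points away from P(∞).
    moved-to-∞ : ∃₂ λ g k → k ≢ 0# × (∀ x → apply M x ≐ k ⊛ act g x)
    moved-to-∞ = extend (fixing-∞ N N-∞ N-finite N-injective)

  G⊆PGL₂ : ∀ M → InG M → ∃₂ λ g k → k ≢ 0# × (∀ x → apply M x ≐ k ⊛ act g x)
  G⊆PGL₂ M (invertible , images , _) = via (images′ nothing)
    where
    images′ : ∀ s → ∃ λ t → apply M (cubicPt s) ∝ cubicPt t
    images′ s = proj₁ (images s) , projEq⁻ {apply M (cubicPt s)} {cubicPt (proj₁ (images s))} (proj₂ (images s))
    from-frame : ∀ {s} → apply M e₀ ∝ cubicPt s → (∃ λ g → move g nothing ≡ s) → ∃₂ λ g k → k ≢ 0# × (∀ x → apply M x ≐ k ⊛ act g x)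
    from-frame p (g , refl) = moved-to-∞ M invertible images′ g p (S³ (g ⁻¹) ∙ M) (apply-∙ (S³ (g ⁻¹)) M)
    via : (∃ λ s → apply M e₀ ∝ cubicPt s) → ∃₂ λ g k → k ≢ 0# × (∀ x → apply M x ≐ k ⊛ act g x)
    via (s , p) = from-frame {s} p (frame s)

  representative : Class → Carrier
  representative square    = 1#
  representative nonsquare = proj₁ (nonsquare-exists (ℕ.≤-trans (ℕ.s≤s (ℕ.s≤s ℕ.z≤n)) 5≤q))

  representative∈ : ∀ j → T (inClass j (representative j))
  representative∈ square = square⁺ 1# 1≢0 (*-identityˡ 1#)
  representative∈ nonsquare = proj₂ (nonsquare-exists (ℕ.≤-trans (ℕ.s≤s (ℕ.s≤s ℕ.z≤n)) 5≤q))

  class-ratio : ∀ j {d} → T (inClass j d) → ∃ λ k → k ≢ 0# × d ≡ k * k * representative j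
  class-ratio square t = let x , x≢0 , e = square⁻ t in x , x≢0 , trans (sym e) (sym (*-identityʳ (x * x)))
  class-ratio nonsquare t = nonsquare-ratio t (representative∈ nonsquare)

  -- As `a = 0`, the value `a² - b` of this line is the representative itself.
  base : Class → V
  base j = dir 0# (- representative j)

  base-class : ∀ j → T (inClass j (0# * 0# - - representative j))
  base-class j = subst (λ d → T (inClass j d)) (by-ring 1 (λ d → d , :0 :* :0 :- :- d) refl (representative j)) (representative∈ j)

  same-act : ∀ g {a b u v} → Same a b u v → Same (act g a) (act g b) (act g u) (act g v)
  same-act g (ab , uv , s , t) = indep-act g ab , indep-act g uv , sub-apply (S³ g) s , sub-apply (S³ g) t

  -- The affine map `t ↦ k t + a` takes the line with first parameter 0 to one with first parameter
  -- `a` and multiplies D by `k²`; `class-ratio` supplies the `k` that produces the required D.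
  base-transitive : ∀ j a b → T (inClass j (a * a - b)) → ∃ λ h → Same (act h e₀) (act h (base j)) e₀ (dir a b)
  base-transitive j a b t = h , same-by-indep (indep-act h (base-indep 0# (- representative j)))
      ((k * (k * k) , 0# , λ i → trans (act-e₀ h i) (∀₄ {λ i → point k 0# i ≡ k * (k * k) * e₀ i + 0# * dir a b i}
          (by-ring 1 (λ k → k :* (k :* k) , k :* (k :* k) :* :1 :+ :0 :* :0) refl k)
          (by-ring 2 (λ k b → k :* k :* :0 , k :* (k :* k) :* :0 :+ :0 :* b) refl k b)
          (by-ring 2 (λ k a → k :* (:0 :* :0) , k :* (k :* k) :* :0 :+ :0 :* a) refl k a)
          (by-ring 1 (λ k → :0 :* (:0 :* :0) , k :* (k :* k) :* :0 :+ :0 :* :1) refl k) i)) ,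
       -- The last three coordinates already agree with `dir a b`, so the multiple of `e₀` is just
       -- the first coordinate.
       (act h (base j) 0F , 1# , λ i → ∀₄ {λ i → act h (base j) i ≡ act h (base j) 0F * e₀ i + 1# * dir a b i}
          (by-ring 1 (λ x → x , x :* :1 :+ :1 :* :0) refl (act h (base j) 0F))
          (trans (·-dir (S³ h 1F) 0# (- ρ)) (trans (by-ring 4 (λ k a r x → E.cubicMatrix k a :0 :1 1F 1F :* :- r :+ E.cubicMatrix k a :0 :1 1F 2F :* :0 :+ E.cubicMatrix k a :0 :1 1F 3F ,
              x :* :0 :+ :1 :* (a :* a :- k :* k :* r)) refl k a ρ (act h (base j) 0F))
            (cong (λ b → act h (base j) 0F * 0# + 1# * b) (trans (cong (λ d → a * a - d) (sym D≡)) (by-ring 2 (λ a b → a :* a :- (a :* a :- b) , b) refl a b)))))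
          (trans (·-dir (S³ h 2F) 0# (- ρ)) (by-ring 4 (λ k a r x → E.cubicMatrix k a :0 :1 2F 1F :* :- r :+ E.cubicMatrix k a :0 :1 2F 2F :* :0 :+ E.cubicMatrix k a :0 :1 2F 3F ,
              x :* :0 :+ :1 :* a) refl k a ρ (act h (base j) 0F)))
          (trans (·-dir (S³ h 3F) 0# (- ρ)) (by-ring 4 (λ k a r x → E.cubicMatrix k a :0 :1 3F 1F :* :- r :+ E.cubicMatrix k a :0 :1 3F 2F :* :0 :+ E.cubicMatrix k a :0 :1 3F 3F ,
              x :* :0 :+ :1 :* :1) refl k a ρ (act h (base j) 0F))) i))
    where
    ρ k : Carrier
    ρ = representative j
    k = proj₁ (class-ratio j t)
    k≢0 : k ≢ 0#
    k≢0 = proj₁ (proj₂ (class-ratio j t))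
    D≡ : a * a - b ≡ k * k * ρ
    D≡ = proj₂ (proj₂ (class-ratio j t))
    h : GL₂
    h = record { a = k ; b = a ; c = 0# ; d = 1# ; δ = proj₁ (inverse k k≢0)
      ; det = trans (by-ring 3 (λ m n i → (m :* :1 :- n :* :0) :* i , m :* i) refl k a (proj₁ (inverse k k≢0))) (proj₂ (inverse k k≢0)) }

  same-respˡ : ∀ {a b a′ b′ u v k} → k ≢ 0# → a ≐ k ⊛ a′ → b ≐ k ⊛ b′ → Same a b u v → Same a′ b′ u v
  same-respˡ {a} {b} {a′} {b′} {u} {v} {k} k≢0 ea eb s@(ab , _) = same-trans
    (same-sym (same-by-indep ab (span-respˡ ea (span-⊛ k span-fst) , span-respˡ eb (span-⊛ k span-snd)))) s

  -- `reach` needs only the matrices `S³ g`. In `stay` an arbitrary matrix of the group occurs, and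
  -- `G⊆PGL₂` is what shows that its image of the base line is again in standard position with the
  -- same D.
  O-isOrbit : ∀ j → IsOrbit (O j)
  O-isOrbit j = e₀ , base j , indep⁺ (base-indep 0# (- representative j)) , λ u v →
    (λ t → reach {u} {v} (O-frame {u} {v} j t)) , λ (M , M∈G , s) → stay u v {M} (G⊆PGL₂ M M∈G) (sameLine⁻ {apply M e₀} {apply M (base j)} {u} {v} s)
    where
    reach : ∀ {u v} → (∃ λ g → ∃₂ λ a b → Based g a b u v × T (inClass j (a * a - b))) →
      ∃ λ M → InG M × T (sameLine (apply M e₀) (apply M (base j)) u v)
    reach {u} {v} (g , a , b , based , t) = via (base-transitive j a b t)
      where
      via : (∃ λ h → Same (act h e₀) (act h (base j)) e₀ (dir a b)) → ∃ λ M → InG M × T (sameLine (apply M e₀) (apply M (base j)) u v)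
      via (h , s) = S³ (g ⋆ h) , S³∈G (g ⋆ h) , sameLine⁺ {act (g ⋆ h) e₀} {act (g ⋆ h) (base j)} {u} {v}
        (same-respˡ {act g (act h e₀)} {act g (act h (base j))} {act (g ⋆ h) e₀} {act (g ⋆ h) (base j)} {u} {v} {1#} 1≢0
          (λ i → trans (sym (act-⋆ g h e₀ i)) (sym (*-identityˡ _))) (λ i → trans (sym (act-⋆ g h (base j) i)) (sym (*-identityˡ _)))
          (same-trans (same-act g s) based))
    stay : ∀ u v {M} → (∃₂ λ g k → k ≢ 0# × (∀ x → apply M x ≐ k ⊛ act g x)) → Same (apply M e₀) (apply M (base j)) u v → T (O j u v)
    stay u v {M} (g , k , k≢0 , e) s = O⁺ {g} {0#} { - representative j} {u} {v} j
      (same-respˡ {apply M e₀} {apply M (base j)} {act g e₀} {act g (base j)} {u} {v} {k} k≢0 (e e₀) (e (base j)) s) (base-class j)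

-- The incidence numbers of the two orbits.

open import Data.Nat using (_+_; _*_; _∸_; _^_; _%_; _≤_)

theorem7p4 : (q : ℕ) (𝔽 : FiniteField q) → q % 2 ≡ 1 → 5 ≤ q →
  let open Geometry 𝔽 in
  Σ LineSet λ O₁ → Σ LineSet λ O₂ →
    IsOrbit O₁ × IsOrbit O₂
    × (∀ u v → (T (UnΓ u v) → T (O₁ u v) ⊎ T (O₂ u v))
               × (T (O₁ u v) ⊎ T (O₂ u v) → T (UnΓ u v)))
    × (∀ u v → ¬ (T (O₁ u v) × T (O₂ u v)))
    × 2 * size O₁ ≡ q ^ 3 ∸ q
    × 2 * size O₂ ≡ q ^ 3 ∸ q
    -- Π_{π,j} = Λ_{j,π} = 0 for π ∈ {Γ, 0_C}
    × PiIs Γ-plane O₁ (λ n → n ≡ 0) × PiIs Γ-plane O₂ (λ n → n ≡ 0)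
    × PiIs 0C-plane O₁ (λ n → n ≡ 0) × PiIs 0C-plane O₂ (λ n → n ≡ 0)
    × LamIs O₁ Γ-plane (λ n → n ≡ 0) × LamIs O₂ Γ-plane (λ n → n ≡ 0)
    × LamIs O₁ 0C-plane (λ n → n ≡ 0) × LamIs O₂ 0C-plane (λ n → n ≡ 0)
    -- Π_{2C,1} = 1, Π_{2C,2} = 3
    × PiIs 2C-plane O₁ (λ n → n ≡ 1) × PiIs 2C-plane O₂ (λ n → n ≡ 3)
    -- Λ_{1,2C} = Π_{3C,1} = Π_{1̄C,2} = Λ_{2,1̄C} = (q-1)/2
    × LamIs O₁ 2C-plane (λ n → 2 * n ≡ q ∸ 1)
    × PiIs 3C-plane O₁ (λ n → 2 * n ≡ q ∸ 1)
    × PiIs 1̄C-plane O₂ (λ n → 2 * n ≡ q ∸ 1)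
    × LamIs O₂ 1̄C-plane (λ n → 2 * n ≡ q ∸ 1)
    -- Π_{3C,2} = (q-3)/2
    × PiIs 3C-plane O₂ (λ n → 2 * n ≡ q ∸ 3)
    -- Λ_{2,3C} = 3(q-3)/2
    × LamIs O₂ 3C-plane (λ n → 2 * n ≡ 3 * (q ∸ 3))
    -- Λ_{2,2C} = Λ_{1,3C} = 3(q-1)/2
    × LamIs O₂ 2C-plane (λ n → 2 * n ≡ 3 * (q ∸ 1))
    × LamIs O₁ 3C-plane (λ n → 2 * n ≡ 3 * (q ∸ 1))
    -- Π_{1̄C,1} = Λ_{1,1̄C} = (q+1)/2
    × PiIs 1̄C-plane O₁ (λ n → 2 * n ≡ q + 1)
    × LamIs O₁ 1̄C-plane (λ n → 2 * n ≡ q + 1)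
theorem7p4 q 𝔽 odd 5≤q =
  -- The labelling is forced by the requirement of a single 2_C-plane on the lines of the first
  -- orbit: 4D then has no square root.
  O nonsquare , O square ,
  O-isOrbit nonsquare , O-isOrbit square ,
  (λ u v → (λ t → cover {u} {v} (UnΓ⇒O {u} {v} t)) , uncover {u} {v}) ,
  (λ u v (s , t) → distinct (O-disjoint nonsquare square {u} {v} s t)) ,
  size-doubled nonsquare , size-doubled square ,
  planes-empty Γ-plane nonsquare (λ _ → refl) refl , planes-empty Γ-plane square (λ _ → refl) refl ,
  planes-empty 0C-plane nonsquare (λ _ → refl) refl , planes-empty 0C-plane square (λ _ → refl) refl ,
  (λ c _ → lines-Γ nonsquare c) , (λ c _ → lines-Γ square c) ,
  (λ c _ → lines-0C nonsquare c) , (λ c _ → lines-0C square c) ,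
  planes-2C-through nonsquare , planes-2C-through square ,
  (λ c n → lines-2C-nonsquare c (normalized⁻ n)) ,
  planes-3C-through nonsquare ,
  planes-1̄C-through square ,
  (λ c n → lines-1̄C square c (normalized⁻ n)) ,
  planes-3C-through square ,
  (λ c n → lines-3C square c (normalized⁻ n)) ,
  (λ c n → lines-2C-square c (normalized⁻ n)) ,
  (λ c n → lines-3C nonsquare c (normalized⁻ n)) ,
  planes-1̄C-through nonsquare ,
  (λ c n → lines-1̄C nonsquare c (normalized⁻ n))
  where
  open Geometry 𝔽
  open CanonicalForms 𝔽
  open Squares 𝔽 odd
  open Lines 𝔽 odd
  open Counts 𝔽 odd
  open TangentPlanes 𝔽 odd
  open Orbits 𝔽 odd 5≤q
  distinct : ¬ (nonsquare ≡ square)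
  distinct ()
  cover : ∀ {u v} → ∃ (λ j → T (O j u v)) → T (O nonsquare u v) ⊎ T (O square u v)
  cover (nonsquare , t) = inj₁ t
  cover (square , t) = inj₂ t
  uncover : ∀ {u v} → T (O nonsquare u v) ⊎ T (O square u v) → T (UnΓ u v)
  uncover {u} {v} (inj₁ t) = UnΓ⁺ {u} {v} (O⇒UnΓ nonsquare {u} {v} t)
  uncover {u} {v} (inj₂ t) = UnΓ⁺ {u} {v} (O⇒UnΓ square {u} {v} t)
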